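{- Let $\mu\in\Delta^+_l\setminus\Pi$ and $I\in\mathfrak{Ab}_\mu$. Then the number of abelian ideals $I'\in\mathfrak{Ab}$ covering $I$ in $\mathfrak{Ab}$ with $I'\notin\mathfrak{Ab}_\mu$ equals $\#\{\alpha\in\Pi:(\mu,\alpha)>0\}$. In particular, this number does not depend on $I$, and if $\Delta$ is simply laced it equals $\kappa(\mu)$, the number of roots covered by $\mu$ in the root poset $\Delta^+$.
   Context: Let $\Delta$ be an irreducible reduced root system in a real Euclidean space $V$ with inner product $(\ ,\ )$, positive roots $\Delta^+$, simple roots $\Pi=\{\alpha_1,\dots,\alpha_n\}$, highest root $\theta$; $\Delta^+$ carries the root order ($\gamma$ covers $\mu$ iff $\gamma-\mu\in\Pi$). $\Delta^+_l$ is the set of long positive roots. An upper ideal $I\subset\Delta^+$ is abelian if $\gamma'+\gamma''\notin\Delta^+$ for all $\gamma',\gamma''\in I$; $\mathfrak{Ab}$ is the poset of abelian upper ideals ordered by inclusion. Affine setting: $\widehat V=V\oplus\mathbb R\delta\oplus\mathbb R\lambda$ with inner product extended by $(\delta,V)=(\lambda,V)=(\delta,\delta)=(\lambda,\lambda)=0$, $(\delta,\lambda)=1$; positive affine roots $\widehat\Delta^+=\Delta^+\cup\{\mu+k\delta:\mu\in\Delta,k\ge1\}$; $\alpha_0=\delta-\theta$; $\widehat W$ generated by $s_i(x)=x-(x,\alpha_i^\vee)\alpha_i$ ($0\le i\le n$). For $w\in\widehat W$, $N(w)=\{\nu\in\widehat\Delta^+:w(\nu)\in-\widehat\Delta^+\}$;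 for each $I\in\mathfrak{Ab}$ there is a unique $w_I\in\widehat W$ with $N(w_I)=\{\delta-\gamma:\gamma\in I\}$. It is known that for $I\ne\varnothing$, $\tau(I):=w_I(2\delta-\theta)\in\Delta^+_l$; set $\mathfrak{Ab}_\mu=\tau^{ -1}(\mu)$ for $\mu\in\Delta^+_l$.
   Formalization: The Euclidean space V is taken over the rationals, with a rational positive-definite inner product, instead of over the reals; every irreducible root system has such a form after rescaling the inner product. -}

module Defs where

open import Data.Nat as ℕ using (ℕ; zero; suc)
open import Data.Integer as ℤ using (ℤ)
open import Data.Rational as ℚ using (ℚ; 0ℚ; 1ℚ; _+_; _*_; _-_; -_; _÷_; _<_; _≤_; _/_; ≢-nonZero)
open import Data.Rational.Properties using (_≟_; _<?_)
open import Data.Fin using (Fin; zero; suc)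
open import Data.Fin.Subset as Sub using (Subset; _⊆_)
open import Data.Vec as Vec using (Vec; zipWith; replicate; foldr)
open import Data.List as List using (List; allFin; length; filter)
open import Data.List.Membership.Propositional as LM using ()
open import Data.List.Relation.Unary.Unique.Propositional using (Unique)
open import Data.Product using (Σ; ∃; ∃-syntax; _×_; _,_)
open import Data.Sum using (_⊎_)
open import Relation.Nullary using (¬_; yes; no)
open import Relation.Binary.PropositionalEquality using (_≡_; _≢_)
open import Relation.Binary.Construct.Closure.ReflexiveTransitive using (Star)

V : ℕ → Set
V n = Vec ℚ n

infixl 6 _+ᵥ_ _-ᵥ_
infixl 7 _·ᵥ_

_+ᵥ_ : ∀ {n} → V n → V n → V n
_+ᵥ_ = zipWith _+_

_·ᵥ_ : ∀ {n} → ℚ → V n → V n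
c ·ᵥ v = Vec.map (c *_) v

_-ᵥ_ : ∀ {n} → V n → V n → V n
u -ᵥ v = u +ᵥ ((- 1ℚ) ·ᵥ v)

0ᵥ : ∀ {n} → V n
0ᵥ = replicate _ 0ℚ

dot : ∀ {n} → V n → V n → ℚ
dot u v = foldr _ _+_ 0ℚ (zipWith _*_ u v)

lincomb : ∀ {n k} → (Fin k → ℚ) → (Fin k → V n) → V n
lincomb c f = List.foldr (λ i acc → (c i ·ᵥ f i) +ᵥ acc) 0ᵥ (allFin _)

-- total division (only ever used with nonzero divisors)
_÷₀_ : ℚ → ℚ → ℚ
p ÷₀ q with q ≟ 0ℚ
... | yes _ = 0ℚ
... | no q≢0 = _÷_ p q {{≢-nonZero q≢0}}

ℤ→ℚ : ℤ → ℚ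
ℤ→ℚ z = z / 1

ℕ→ℚ : ℕ → ℚ
ℕ→ℚ k = ℤ.+ k / 1

HasCard : ∀ {A : Set} → (A → Set) → ℕ → Set
HasCard {A} P k = Σ (List A) λ L →
  Unique L × (∀ x → (P x → x LM.∈ L) × (x LM.∈ L → P x)) × length L ≡ k

record RootSystem (n : ℕ) : Set where
  field
    G : Vec (Vec ℚ n) n
  ⟪_,_⟫ : V n → V n → ℚ
  ⟪ u , v ⟫ = dot u (Vec.map (λ row → dot row v) G)
  pair∨ : V n → V n → ℚ
  pair∨ x α = (ℕ→ℚ 2 * ⟪ x , α ⟫) ÷₀ ⟪ α , α ⟫
  refl-s : V n → V n → V n
  refl-s α x = x -ᵥ (pair∨ x α ·ᵥ α)
  field
    G-sym    : ∀ i j → Vec.lookup (Vec.lookup G i) j ≡ Vec.lookup (Vec.lookup G j) i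
    G-posdef : ∀ v → v ≢ 0ᵥ → 0ℚ < ⟪ v , v ⟫
    N        : ℕ
    root     : Fin N → V n
    root-inj : ∀ i j → root i ≡ root j → i ≡ j
    root≢0   : ∀ i → root i ≢ 0ᵥ
    spans    : ∀ v → ∃[ c ] lincomb c root ≡ v
    refl-closed : ∀ i j → ∃[ k ] refl-s (root i) (root j) ≡ root k
    crystal  : ∀ i j → ∃[ z ] pair∨ (root j) (root i) ≡ ℤ→ℚ z
    reduced  : ∀ i j (c : ℚ) → root j ≡ c ·ᵥ root i → c ≡ 1ℚ ⊎ c ≡ - 1ℚ
    irreducible : ∀ (P : Subset N) →
      (∀ i j → i Sub.∈ P → j Sub.∉ P → ⟪ root i , root j ⟫ ≡ 0ℚ) →
      (∀ i → i Sub.∈ P) ⊎ (∀ i → i Sub.∉ P)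
    simple   : Fin n → Fin N
  α : Fin n → V n
  α i = root (simple i)
  field
    simple-indep : ∀ (c : Fin n → ℚ) → lincomb c α ≡ 0ᵥ → ∀ i → c i ≡ 0ℚ
    simple-base  : ∀ j → Σ (Fin n → ℤ) λ c → (root j ≡ lincomb (λ i → ℤ→ℚ (c i)) α ×
                     ((∀ i → ℤ.0ℤ ℤ.≤ c i) ⊎ (∀ i → c i ℤ.≤ ℤ.0ℤ)))

  Pos : Fin N → Set
  Pos j = Σ (Fin n → ℕ) λ c → root j ≡ lincomb (λ i → ℕ→ℚ (c i)) α

  Long : Fin N → Set
  Long j = ∀ k → ⟪ root k , root k ⟫ ≤ ⟪ root j , root j ⟫

  SimplyLaced : Set
  SimplyLaced = ∀ i j → ⟪ root i , root i ⟫ ≡ ⟪ root j , root j ⟫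

  IsSimple : Fin N → Set
  IsSimple j = ∃[ i ] simple i ≡ j

  _⋖_ : Fin N → Fin N → Set
  μ ⋖ γ = ∃[ i ] root γ ≡ root μ +ᵥ α i

  _≼_ : Fin N → Fin N → Set
  _≼_ = Star _⋖_

  IsHighest : Fin N → Set
  IsHighest θ = Pos θ × (∀ γ → Pos γ → γ ≼ θ)

  IsUpperIdeal : Subset N → Set
  IsUpperIdeal I = (∀ γ → γ Sub.∈ I → Pos γ) ×
                   (∀ γ γ' → γ Sub.∈ I → Pos γ' → γ ≼ γ' → γ' Sub.∈ I)

  IsAbelian : Subset N → Set
  IsAbelian I = IsUpperIdeal I ×
    (∀ γ' γ'' → γ' Sub.∈ I → γ'' Sub.∈ I →
       ¬ (∃[ k ] (Pos k × root k ≡ root γ' +ᵥ root γ'')))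

  _⊂_ : Subset N → Subset N → Set
  I ⊂ J = I ⊆ J × I ≢ J

  AbCovers : Subset N → Subset N → Set
  AbCovers I I' = IsAbelian I × IsAbelian I' × I ⊂ I' ×
    (∀ J → IsAbelian J → I ⊂ J → ¬ (J ⊂ I'))

  -- affine setting:  \hat V = V ⊕ ℚδ ⊕ ℚλ,  (v , a , b) = v + aδ + bλ

  AV : Set
  AV = V n × ℚ × ℚ

  ⟪_,_⟫^ : AV → AV → ℚ
  ⟪ (v , a , b) , (v' , a' , b') ⟫^ = ⟪ v , v' ⟫ + (a * b' + b * a')

  _+^_ : AV → AV → AV
  (v , a , b) +^ (v' , a' , b') = (v +ᵥ v' , a + a' , b + b')

  _·^_ : ℚ → AV → AV
  c ·^ (v , a , b) = (c ·ᵥ v , c * a , c * b)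

  neg^ : AV → AV
  neg^ x = (- 1ℚ) ·^ x

  ι : V n → AV
  ι v = (v , 0ℚ , 0ℚ)

  δ : AV
  δ = (0ᵥ , 1ℚ , 0ℚ)

  refl^ : AV → AV → AV
  refl^ β x = x +^ ((- ((ℕ→ℚ 2 * ⟪ x , β ⟫^) ÷₀ ⟪ β , β ⟫^)) ·^ β)

  -- elements of \hat W given as words in s_0,…,s_n (s_0 ↔ α_0 = δ − θ)
  module Affine (θ : Fin N) where
    α^ : Fin (suc n) → AV
    α^ zero    = δ +^ neg^ (ι (root θ))
    α^ (suc i) = ι (α i)

    act : List (Fin (suc n)) → AV → AV
    act w x = List.foldr (λ i y → refl^ (α^ i) y) x w

    PosAff : AV → Set
    PosAff x = (∃[ j ] (Pos j × x ≡ ι (root j))) ⊎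
               (∃[ j ] ∃[ k ] x ≡ (root j , ℕ→ℚ (suc k) , 0ℚ))

    NegAff : AV → Set
    NegAff x = PosAff (neg^ x)

    N≡ : List (Fin (suc n)) → Subset N → Set
    N≡ w I = ∀ x → PosAff x →
      (NegAff (act w x) → ∃[ γ ] (γ Sub.∈ I × x ≡ δ +^ neg^ (ι (root γ)))) ×
      (∃[ γ ] (γ Sub.∈ I × x ≡ δ +^ neg^ (ι (root γ))) → NegAff (act w x))

    -- I ∈ 𝔄𝔟_μ, i.e. I abelian and τ(I) = w_I(2δ − θ) = μ
    InAb : Fin N → Subset N → Set
    InAb μ I = IsAbelian I ×
      ∃[ w ] (N≡ w I × act w ((ℕ→ℚ 2 ·^ δ) +^ neg^ (ι (root θ))) ≡ ι (root μ))

  posPairCount : Fin N → ℕ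
  posPairCount μ = length (filter (λ i → 0ℚ <? ⟪ root μ , α i ⟫) (allFin n))

{-# OPTIONS --safe #-}

-- Write w = w_I.  Any I′ covering I is I ∪ {γ}, and then w(δ − γ) is a simple affine root αᵢ: a
-- decomposition of w(δ − γ) into two positive affine roots pulls back along w to one of δ − γ, which is
-- excluded because I′ is an abelian upper ideal.  Conversely w(δ − γ) = αᵢ makes I ∪ {γ} an abelian upper ideal.
-- In both cases w_{I′} = sᵢ w, so τ(I′) = sᵢ μ, and I′ stays in 𝔄𝔟_μ exactly when (μ, αᵢ) = 0.  Now
-- (μ, αᵢ) = (2δ − θ, δ − γ) = (θ, γ) ≥ 0 since θ is dominant, while (μ, α₀) ≤ 0, so the covers leaving 𝔄𝔟_μ
-- give i ≥ 1 with (μ, αᵢ) > 0.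
--
-- Given such an i, write w⁻¹(αᵢ) = kδ − γ.  Then (γ, θ) > 0, so γ > 0 and, as μ ≠ αᵢ, θ − γ is a positive root.
-- Since w(kδ − γ) = αᵢ and w((2 − k)δ − (θ − γ)) = μ − αᵢ are both positive while N(w) contains only roots δ − κ,
-- both k ≥ 1 and 2 − k ≥ 1, that is k = 1.
--
-- The words representing w_I are not unique a priori.  That no word for I ∪ {γ} sends 2δ − θ to μ when (μ, αᵢ) > 0
-- is shown with heights: two words with the same inversion set differ by a map preserving positivity.
module Submission where

open import Defs
open import Data.Nat using (ℕ)
open import Data.Fin.Subset using (Subset)
open import Data.Product using (_×_)
open import Relation.Nullary using (¬_)

import Data.Nat as ℕ
import Data.Nat.Properties as ℕP
open import Data.Nat using (zero; suc)
open import Data.Integer as ℤ using (ℤ)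
import Data.Integer.Properties as ℤP
open import Data.Rational as ℚ using (ℚ; 0ℚ; 1ℚ; _+_; _*_; _-_; -_; 1/_; _<_; _≤_; ≢-nonZero)
import Data.Rational.Properties as ℚP
import Data.Rational.Unnormalised as ℚᵘ
import Data.Rational.Unnormalised.Properties as ℚᵘP
open import Data.Rational.Solver using (module +-*-Solver)
open import Data.Bool.Properties as BoolP using ()
open import Data.Empty using (⊥; ⊥-elim)
open import Data.Fin using (Fin; zero; suc)
import Data.Fin.Properties as FinP
open import Data.Fin.Subset as Sub using (_⊆_; _∪_; ⁅_⁆)
import Data.Fin.Subset.Properties as SubP
open import Data.List as List using (List; []; _∷_; _++_; length; allFin)
open import Data.List.Properties using (length-++-sucʳ; unfold-reverse; reverse-involutive)
open import Data.List.Membership.Propositional as LM using ()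
open import Data.List.Membership.Propositional.Properties using (∈-filter⁺; ∈-filter⁻; ∈-allFin)
open import Data.List.Relation.Binary.Pointwise as Pointwise using (Pointwise; []; _∷_)
open import Data.List.Relation.Unary.All as All using ()
open import Data.List.Relation.Unary.Any using (here; there)
open import Data.List.Relation.Unary.Unique.Propositional using (Unique; []; _∷_)
open import Data.List.Relation.Unary.Unique.Propositional.Properties using (filter⁺; allFin⁺)
open import Data.Product using (Σ; ∃-syntax; _,_; proj₁; proj₂)
open import Data.Sum as Sum using (_⊎_; inj₁; inj₂)
open import Data.Vec as Vec using (Vec; []; _∷_)
import Data.Vec.Properties as VecP
open import Algebra.Bundles using (CommutativeRing)
open import Algebra.Properties.CommutativeMonoid.Sum ℚP.+-0-commutativeMonoid using (sum; sum-cong-≗; ∑-comm)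
open import Algebra.Properties.Semiring.Sum (CommutativeRing.semiring ℚP.+-*-commutativeRing) using (*-distribˡ-sum)
open import Function using (_∘_; id)
open import Relation.Nullary using (yes; no; Dec)
open import Relation.Nullary.Decidable using (_×-dec_; ¬?; decidable-stable)
open import Relation.Binary.Construct.Closure.ReflexiveTransitive using (ε; _◅_; _◅◅_)
open import Relation.Binary.PropositionalEquality
import Relation.Binary.Reflection as Reflection

-- Everything known about w enters through two features of N(w) = {δ - γ : γ ∈ I}: its members lie
-- at level one, and their finite parts are negative. So w keeps positive every positive affine root
-- with positive finite part and every one at level two; this decides most of the signs below. The
-- delicate point is that I′ lies outside 𝔄𝔟_μ: membership asks for some word with the right
-- inversions, so every word w″ for I′ has to be refuted, not only w′ = sᵢw. A length function would
-- identify the two actions; a pair of inequalities suffices instead. The map u = w″w′⁻¹ sends sᵢμ =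
-- μ - cαᵢ to μ, with c > 0. It does not raise the height of μ, and u(αᵢ) has height at least one,
-- so that ht μ = ht(uμ) - c ht(uαᵢ) < ht μ. Heights also show that no αᵢ is a sum of two positive
-- affine roots: height is linear, at least one on positive affine roots and exactly one on the
-- simple ones.

module ℚS = +-*-Solver
open ℚS using (_:+_; _:*_; :-_; _:=_; con)

-- Arithmetic in ℚ.

-1ℚ : ℚ
-1ℚ = - 1ℚ

2ℚ : ℚ
2ℚ = ℕ→ℚ 2

ℤ→ℚ-+ : ∀ a b → ℤ→ℚ (a ℤ.+ b) ≡ ℤ→ℚ a + ℤ→ℚ b
ℤ→ℚ-+ a b = ℚP.toℚᵘ-injective (begin
  ℚ.toℚᵘ (ℤ→ℚ (a ℤ.+ b))            ≈⟨ ℚP.toℚᵘ-fromℚᵘ (ℚᵘ.mkℚᵘ (a ℤ.+ b) 0) ⟩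
  ℚᵘ.mkℚᵘ (a ℤ.+ b) 0               ≈⟨ ℚᵘ.*≡* (cong (ℤ._* ℤ.1ℤ) (sym (cong₂ ℤ._+_ (ℤP.*-identityʳ a) (ℤP.*-identityʳ b)))) ⟩
  ℚᵘ.mkℚᵘ a 0 ℚᵘ.+ ℚᵘ.mkℚᵘ b 0       ≈⟨ ℚᵘP.+-cong (ℚᵘP.≃-sym (ℚP.toℚᵘ-fromℚᵘ (ℚᵘ.mkℚᵘ a 0))) (ℚᵘP.≃-sym (ℚP.toℚᵘ-fromℚᵘ (ℚᵘ.mkℚᵘ b 0))) ⟩
  ℚ.toℚᵘ (ℤ→ℚ a) ℚᵘ.+ ℚ.toℚᵘ (ℤ→ℚ b) ≈⟨ ℚᵘP.≃-sym (ℚP.toℚᵘ-homo-+ (ℤ→ℚ a) (ℤ→ℚ b)) ⟩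
  ℚ.toℚᵘ (ℤ→ℚ a + ℤ→ℚ b)            ∎)
  where
  open ℚᵘP.≃-Reasoning

ℤ→ℚ-neg : ∀ a → ℤ→ℚ (ℤ.- a) ≡ - ℤ→ℚ a
ℤ→ℚ-neg a = begin
  x                            ≡⟨ ℚS.solve 2 (λ x y → x := (x :+ y) :+ :- y) refl x y ⟩
  (x + y) + - y                ≡⟨ cong (_+ - y) (trans (sym (ℤ→ℚ-+ (ℤ.- a) a)) (cong ℤ→ℚ (ℤP.+-inverseˡ a))) ⟩
  0ℚ + - y                     ≡⟨ ℚP.+-identityˡ (- y) ⟩
  - y                          ∎
  where
  x = ℤ→ℚ (ℤ.- a)
  y = ℤ→ℚ a
  open ≡-Reasoning

ℕ→ℚ-suc : ∀ k → ℕ→ℚ (suc k) ≡ 1ℚ + ℕ→ℚ k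
ℕ→ℚ-suc k = ℤ→ℚ-+ (ℤ.+ 1) (ℤ.+ k)

ℕ→ℚ-nonneg : ∀ k → 0ℚ ≤ ℕ→ℚ k
ℕ→ℚ-nonneg k = ℚP.nonNegative⁻¹ (ℕ→ℚ k) {{ℚP.normalize-nonNeg k 1}}

1≤ℕ→ℚ-suc : ∀ k → 1ℚ ≤ ℕ→ℚ (suc k)
1≤ℕ→ℚ-suc k = subst₂ _≤_ (ℚP.+-identityʳ 1ℚ) (sym (ℕ→ℚ-suc k)) (ℚP.+-monoʳ-≤ 1ℚ (ℕ→ℚ-nonneg k))

0<1 : 0ℚ < 1ℚ
0<1 = ℚP.positive⁻¹ 1ℚ

-- The common end of the height arguments: a lower bound obtained summand by summand meets an exact
-- value that is one too small.
≤-≡⊥ : ∀ {p q} → p ≤ q → p ≡ q + 1ℚ → ⊥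
≤-≡⊥ {p} {q} p≤q refl = ℚP.<-irrefl refl (ℚP.<-≤-trans q<q+1 p≤q)
  where
  q<q+1 : q < q + 1ℚ
  q<q+1 = subst (_< q + 1ℚ) (ℚP.+-identityʳ q) (ℚP.+-monoʳ-< q 0<1)

<-≡⊥ : ∀ {p q} → p < q → p ≡ q → ⊥
<-≡⊥ p<q p≡q = ℚP.<-irrefl p≡q p<q

≤⇒0≤- : ∀ {p q} → p ≤ q → 0ℚ ≤ q - p
≤⇒0≤- {p} {q} h = subst (_≤ q - p) (ℚP.+-inverseʳ p) (ℚP.+-monoˡ-≤ (- p) h)

0≤-⇒≤ : ∀ {p q} → 0ℚ ≤ q - p → p ≤ q
0≤-⇒≤ {p} {q} h = subst₂ _≤_ (ℚP.+-identityˡ p) (ℚS.solve 2 (λ p q → (q :+ :- p) :+ p := q) refl p q) (ℚP.+-monoˡ-≤ p h)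

*-pos : ∀ {p q} → 0ℚ < p → 0ℚ < q → 0ℚ < p * q
*-pos {p} {q} 0<p 0<q = ℚP.positive⁻¹ (p * q) {{ℚP.pos*pos⇒pos p {{ℚ.positive 0<p}} q {{ℚ.positive 0<q}}}}

*-nonneg : ∀ {p q} → 0ℚ ≤ p → 0ℚ ≤ q → 0ℚ ≤ p * q
*-nonneg {p} {q} 0≤p 0≤q = ℚP.nonNegative⁻¹ (p * q) {{ℚP.nonNeg*nonNeg⇒nonNeg p {{ℚ.nonNegative 0≤p}} q {{ℚ.nonNegative 0≤q}}}}

*-cancel-pos : ∀ {p q r} → 0ℚ < r → p * r ≡ q * r → p ≡ q
*-cancel-pos {p} {q} {r} 0<r e = ℚP.≤-antisym (c e) (c (sym e))
  where
  c : ∀ {p q} → p * r ≡ q * r → p ≤ q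
  c e = ℚP.*-cancelʳ-≤-pos r {{ℚ.positive 0<r}} (ℚP.≤-reflexive e)

÷₀-* : ∀ p q → q ≢ 0ℚ → (p ÷₀ q) * q ≡ p
÷₀-* p q q≢0 with q ℚP.≟ 0ℚ
... | yes q≡0 = ⊥-elim (q≢0 q≡0)
... | no q≢0 = begin
  p * 1/q * q   ≡⟨ ℚP.*-assoc p 1/q q ⟩
  p * (1/q * q) ≡⟨ cong (p *_) (ℚP.*-inverseˡ q {{≢-nonZero q≢0}}) ⟩
  p * 1ℚ        ≡⟨ ℚP.*-identityʳ p ⟩
  p             ∎
  where
  1/q = (1/ q) {{≢-nonZero q≢0}}
  open ≡-Reasoning

-- Rational vector spaces and linear identities.

record QModule : Set₁ where
  infixl 6 _⊕_
  infixl 7 _⊙_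
  field
    Carrier : Set
    _⊕_     : Carrier → Carrier → Carrier
    _⊙_     : ℚ → Carrier → Carrier
    𝟘       : Carrier
    ⊕-assoc : ∀ x y z → (x ⊕ y) ⊕ z ≡ x ⊕ (y ⊕ z)
    ⊕-comm  : ∀ x y → x ⊕ y ≡ y ⊕ x
    ⊕-idˡ   : ∀ x → 𝟘 ⊕ x ≡ x
    ⊙-distˡ : ∀ a x y → a ⊙ (x ⊕ y) ≡ a ⊙ x ⊕ a ⊙ y
    ⊙-distʳ : ∀ a b x → (a + b) ⊙ x ≡ a ⊙ x ⊕ b ⊙ x
    ⊙-assoc : ∀ a b x → (a * b) ⊙ x ≡ a ⊙ (b ⊙ x)
    1⊙      : ∀ x → 1ℚ ⊙ x ≡ x
    -- Subtraction is written with the scalar -1, so this law takes the place of additive inverses.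
    0⊙      : ∀ x → 0ℚ ⊙ x ≡ 𝟘

  ⊙𝟘 : ∀ a → a ⊙ 𝟘 ≡ 𝟘
  ⊙𝟘 a = begin
    a ⊙ 𝟘        ≡⟨ cong (a ⊙_) (0⊙ 𝟘) ⟨
    a ⊙ (0ℚ ⊙ 𝟘) ≡⟨ ⊙-assoc a 0ℚ 𝟘 ⟨
    (a * 0ℚ) ⊙ 𝟘 ≡⟨ cong (_⊙ 𝟘) (ℚP.*-zeroʳ a) ⟩
    0ℚ ⊙ 𝟘       ≡⟨ 0⊙ 𝟘 ⟩
    𝟘            ∎
    where open ≡-Reasoning

  interchange : ∀ x y z t → (x ⊕ y) ⊕ (z ⊕ t) ≡ (x ⊕ z) ⊕ (y ⊕ t)
  interchange x y z t = begin
    (x ⊕ y) ⊕ (z ⊕ t) ≡⟨ ⊕-assoc x y (z ⊕ t) ⟩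
    x ⊕ (y ⊕ (z ⊕ t)) ≡⟨ cong (x ⊕_) (⊕-assoc y z t) ⟨
    x ⊕ ((y ⊕ z) ⊕ t) ≡⟨ cong (λ s → x ⊕ (s ⊕ t)) (⊕-comm y z) ⟩
    x ⊕ ((z ⊕ y) ⊕ t) ≡⟨ cong (x ⊕_) (⊕-assoc z y t) ⟩
    x ⊕ (z ⊕ (y ⊕ t)) ≡⟨ ⊕-assoc x z (y ⊕ t) ⟨
    (x ⊕ z) ⊕ (y ⊕ t) ∎
    where open ≡-Reasoning

-- A solver for identities between linear combinations whose coefficients are literals.
module Linear (M : QModule) where
  open QModule M

  infixl 6 _⊞_
  infixl 7 _⊡_
  data Expr (k : ℕ) : Set where
    var : Fin k → Expr k
    𝕫   : Expr k
    _⊞_ : Expr k → Expr k → Expr k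
    _⊡_ : ℚ → Expr k → Expr k

  ⟦_⟧ : ∀ {k} → Expr k → Vec Carrier k → Carrier
  ⟦ var i ⟧ ρ = Vec.lookup ρ i
  ⟦ 𝕫 ⟧ ρ     = 𝟘
  ⟦ e ⊞ f ⟧ ρ = ⟦ e ⟧ ρ ⊕ ⟦ f ⟧ ρ
  ⟦ c ⊡ e ⟧ ρ = c ⊙ ⟦ e ⟧ ρ

  unit : ∀ {k} → Fin k → Vec ℚ k
  unit zero    = 1ℚ ∷ 0ᵥ
  unit (suc i) = 0ℚ ∷ unit i

  coeffs : ∀ {k} → Expr k → Vec ℚ k
  coeffs (var i) = unit i
  coeffs 𝕫       = 0ᵥ
  coeffs (e ⊞ f) = coeffs e +ᵥ coeffs f
  coeffs (c ⊡ e) = c ·ᵥ coeffs e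

  combine : ∀ {k} → Vec ℚ k → Vec Carrier k → Carrier
  combine []       []       = 𝟘
  combine (c ∷ cs) (x ∷ xs) = c ⊙ x ⊕ combine cs xs

  combine-0 : ∀ {k} (ρ : Vec Carrier k) → combine 0ᵥ ρ ≡ 𝟘
  combine-0 []      = refl
  combine-0 (x ∷ ρ) = trans (cong₂ _⊕_ (0⊙ x) (combine-0 ρ)) (⊕-idˡ 𝟘)

  combine-unit : ∀ {k} (i : Fin k) ρ → combine (unit i) ρ ≡ Vec.lookup ρ i
  combine-unit zero    (x ∷ ρ) = trans (cong₂ _⊕_ (1⊙ x) (combine-0 ρ)) (trans (⊕-comm x 𝟘) (⊕-idˡ x))
  combine-unit (suc i) (x ∷ ρ) = trans (cong₂ _⊕_ (0⊙ x) (combine-unit i ρ)) (⊕-idˡ _)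

  combine-+ : ∀ {k} (c d : Vec ℚ k) ρ → combine (c +ᵥ d) ρ ≡ combine c ρ ⊕ combine d ρ
  combine-+ []      []      []      = sym (⊕-idˡ 𝟘)
  combine-+ (a ∷ c) (b ∷ d) (x ∷ ρ) =
    trans (cong₂ _⊕_ (⊙-distʳ a b x) (combine-+ c d ρ)) (interchange _ _ _ _)

  combine-· : ∀ {k} a (c : Vec ℚ k) ρ → combine (a ·ᵥ c) ρ ≡ a ⊙ combine c ρ
  combine-· a []      []      = sym (⊙𝟘 a)
  combine-· a (b ∷ c) (x ∷ ρ) =
    trans (cong₂ _⊕_ (⊙-assoc a b x) (combine-· a c ρ)) (sym (⊙-distˡ a _ _))

  correct : ∀ {k} (e : Expr k) ρ → combine (coeffs e) ρ ≡ ⟦ e ⟧ ρ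
  correct (var i) ρ = combine-unit i ρ
  correct 𝕫       ρ = combine-0 ρ
  correct (e ⊞ f) ρ = trans (combine-+ (coeffs e) (coeffs f) ρ) (cong₂ _⊕_ (correct e ρ) (correct f ρ))
  correct (c ⊡ e) ρ = trans (combine-· c (coeffs e) ρ) (cong (c ⊙_) (correct e ρ))

  open Reflection (setoid Carrier) var ⟦_⟧ (λ e → combine (coeffs e)) correct public
    using (solve; _⊜_)

ℚ-module : QModule
ℚ-module = record
  { Carrier = ℚ ; _⊕_ = _+_ ; _⊙_ = _*_ ; 𝟘 = 0ℚ
  ; ⊕-assoc = ℚP.+-assoc ; ⊕-comm = ℚP.+-comm ; ⊕-idˡ = ℚP.+-identityˡ
  ; ⊙-distˡ = ℚP.*-distribˡ-+ ; ⊙-distʳ = λ a b x → ℚP.*-distribʳ-+ x a b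
  ; ⊙-assoc = ℚP.*-assoc ; 1⊙ = ℚP.*-identityˡ ; 0⊙ = ℚP.*-zeroˡ }

V-module : ℕ → QModule
V-module n = record
  { Carrier = V n ; _⊕_ = _+ᵥ_ ; _⊙_ = _·ᵥ_ ; 𝟘 = 0ᵥ
  ; ⊕-assoc = VecP.zipWith-assoc ℚP.+-assoc
  ; ⊕-comm  = VecP.zipWith-comm ℚP.+-comm
  ; ⊕-idˡ   = VecP.zipWith-identityˡ ℚP.+-identityˡ
  ; ⊙-distˡ = distˡ ; ⊙-distʳ = distʳ
  ; ⊙-assoc = assoc ; 1⊙ = one ; 0⊙ = nil }
  where
  distˡ : ∀ {n} a (x y : V n) → a ·ᵥ (x +ᵥ y) ≡ a ·ᵥ x +ᵥ a ·ᵥ y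
  distˡ a []      []      = refl
  distˡ a (p ∷ x) (q ∷ y) = cong₂ _∷_ (ℚP.*-distribˡ-+ a p q) (distˡ a x y)
  distʳ : ∀ {n} a b (x : V n) → (a + b) ·ᵥ x ≡ a ·ᵥ x +ᵥ b ·ᵥ x
  distʳ a b []      = refl
  distʳ a b (p ∷ x) = cong₂ _∷_ (ℚP.*-distribʳ-+ p a b) (distʳ a b x)
  assoc : ∀ {n} a b (x : V n) → (a * b) ·ᵥ x ≡ a ·ᵥ (b ·ᵥ x)
  assoc a b []      = refl
  assoc a b (p ∷ x) = cong₂ _∷_ (ℚP.*-assoc a b p) (assoc a b x)
  one : ∀ {n} (x : V n) → 1ℚ ·ᵥ x ≡ x
  one []      = refl
  one (p ∷ x) = cong₂ _∷_ (ℚP.*-identityˡ p) (one x)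
  nil : ∀ {n} (x : V n) → 0ℚ ·ᵥ x ≡ 0ᵥ
  nil []      = refl
  nil (p ∷ x) = cong₂ _∷_ (ℚP.*-zeroˡ p) (nil x)

_×-module_ : QModule → QModule → QModule
M ×-module M′ = record
  { Carrier = M.Carrier × M′.Carrier
  ; _⊕_     = λ { (x , x′) (y , y′) → x M.⊕ y , x′ M′.⊕ y′ }
  ; _⊙_     = λ { a (x , x′) → a M.⊙ x , a M′.⊙ x′ }
  ; 𝟘       = M.𝟘 , M′.𝟘
  ; ⊕-assoc = λ x y z → cong₂ _,_ (M.⊕-assoc _ _ _) (M′.⊕-assoc _ _ _)
  ; ⊕-comm  = λ x y → cong₂ _,_ (M.⊕-comm _ _) (M′.⊕-comm _ _)
  ; ⊕-idˡ   = λ x → cong₂ _,_ (M.⊕-idˡ _) (M′.⊕-idˡ _)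
  ; ⊙-distˡ = λ a x y → cong₂ _,_ (M.⊙-distˡ _ _ _) (M′.⊙-distˡ _ _ _)
  ; ⊙-distʳ = λ a b x → cong₂ _,_ (M.⊙-distʳ _ _ _) (M′.⊙-distʳ _ _ _)
  ; ⊙-assoc = λ a b x → cong₂ _,_ (M.⊙-assoc _ _ _) (M′.⊙-assoc _ _ _)
  ; 1⊙      = λ x → cong₂ _,_ (M.1⊙ _) (M′.1⊙ _)
  ; 0⊙      = λ x → cong₂ _,_ (M.0⊙ _) (M′.0⊙ _) }
  where
  module M  = QModule M
  module M′ = QModule M′

module LV {n} = Linear (V-module n)
open LV using (_⊞_; _⊡_; _⊜_; 𝕫)

-- Linear combinations, and the form in coordinates.

module Combinations (M : QModule) where
  open QModule M

  -- Unfolds exactly as `lincomb` does, so its laws apply to `lincomb` as they stand; over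
  -- `ℚ-module` the same sum evaluates a linear form from its values on the simple roots.
  comb : ∀ {k} → (Fin k → ℚ) → (Fin k → Carrier) → Carrier
  comb c f = List.foldr (λ i acc → (c i ⊙ f i) ⊕ acc) 𝟘 (allFin _)

  private
    combL : ∀ {k} → (Fin k → ℚ) → (Fin k → Carrier) → List (Fin k) → Carrier
    combL c f = List.foldr (λ i acc → (c i ⊙ f i) ⊕ acc) 𝟘

  comb-cong : ∀ {k} {c d : Fin k → ℚ} (f : Fin k → Carrier) → (∀ i → c i ≡ d i) → comb c f ≡ comb d f
  comb-cong {k} {c} {d} f c≗d = go (allFin k)
    where
    go : ∀ l → combL c f l ≡ combL d f l
    go []      = refl
    go (i ∷ l) = cong₂ _⊕_ (cong (_⊙ f i) (c≗d i)) (go l)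

  comb-+ : ∀ {k} (c d : Fin k → ℚ) f → comb (λ i → c i + d i) f ≡ comb c f ⊕ comb d f
  comb-+ {k} c d f = go (allFin k)
    where
    go : ∀ l → combL (λ i → c i + d i) f l ≡ combL c f l ⊕ combL d f l
    go []      = sym (⊕-idˡ 𝟘)
    go (i ∷ l) = trans (cong₂ _⊕_ (⊙-distʳ _ _ _) (go l)) (interchange _ _ _ _)

  comb-· : ∀ {k} a (c : Fin k → ℚ) f → comb (λ i → a * c i) f ≡ a ⊙ comb c f
  comb-· {k} a c f = go (allFin k)
    where
    go : ∀ l → combL (λ i → a * c i) f l ≡ a ⊙ combL c f l
    go []      = sym (⊙𝟘 a)
    go (i ∷ l) = trans (cong₂ _⊕_ (⊙-assoc _ _ _) (go l)) (sym (⊙-distˡ _ _ _))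

  comb-0 : ∀ {k} (f : Fin k → Carrier) → comb (λ _ → 0ℚ) f ≡ 𝟘
  comb-0 {k} f = go (allFin k)
    where
    go : ∀ l → combL (λ _ → 0ℚ) f l ≡ 𝟘
    go []      = refl
    go (i ∷ l) = trans (cong₂ _⊕_ (0⊙ _) (go l)) (⊕-idˡ 𝟘)

  comb-single : ∀ {k} (i : Fin k) (c : Fin k → ℚ) f → (∀ j → j ≢ i → c j ≡ 0ℚ) → comb c f ≡ c i ⊙ f i
  comb-single {k} i c f c≡0 = only k i id c≡0
    where
    -- The tail of `allFin` is a `tabulate suc`, so both inductions run over `tabulate g` for
    -- arbitrary `g`.
    none : ∀ m (g : Fin m → Fin k) → (∀ j → c (g j) ≡ 0ℚ) → combL c f (List.tabulate g) ≡ 𝟘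
    none zero    g z = refl
    none (suc m) g z = trans (cong₂ _⊕_ (trans (cong (_⊙ _) (z zero)) (0⊙ _)) (none m (g ∘ suc) (z ∘ suc))) (⊕-idˡ 𝟘)
    only : ∀ m (i : Fin m) (g : Fin m → Fin k) → (∀ j → j ≢ i → c (g j) ≡ 0ℚ) →
           combL c f (List.tabulate g) ≡ c (g i) ⊙ f (g i)
    only (suc m) zero    g z = trans (cong (_ ⊕_) (none m (g ∘ suc) (λ j → z (suc j) (λ ())))) (trans (⊕-comm _ _) (⊕-idˡ _))
    only (suc m) (suc i) g z = trans (cong₂ _⊕_ (trans (cong (_⊙ _) (z zero (λ ()))) (0⊙ _))
                                     (only m i (g ∘ suc) (λ j j≢i → z (suc j) (j≢i ∘ FinP.suc-injective)))) (⊕-idˡ _)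

-- Natural-valued because `Pos` asks for natural coefficients.
kronecker : ∀ {k} → Fin k → Fin k → ℕ
kronecker i j with i FinP.≟ j
... | yes _ = 1
... | no _  = 0

kronecker-refl : ∀ {k} (i : Fin k) → kronecker i i ≡ 1
kronecker-refl i with i FinP.≟ i
... | yes _  = refl
... | no i≢i = ⊥-elim (i≢i refl)

kronecker-≢ : ∀ {k} {i j : Fin k} → i ≢ j → kronecker i j ≡ 0
kronecker-≢ {i = i} {j} i≢j with i FinP.≟ j
... | yes i≡j = ⊥-elim (i≢j i≡j)
... | no _    = refl

module LQ = Combinations ℚ-module
module LC {n} = Combinations (V-module n)

dot-sum : ∀ {m} (u v : V m) → dot u v ≡ sum (λ i → Vec.lookup u i * Vec.lookup v i)
dot-sum []      []      = refl
dot-sum (a ∷ u) (b ∷ v) = cong (a * b +_) (dot-sum u v)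

dot-+ˡ : ∀ {m} (u v w : V m) → dot (u +ᵥ v) w ≡ dot u w + dot v w
dot-+ˡ []      []      []      = refl
dot-+ˡ (a ∷ u) (b ∷ v) (c ∷ w) = trans (cong ((a + b) * c +_) (dot-+ˡ u v w))
  (ℚS.solve 5 (λ a b c x y → (a :+ b) :* c :+ (x :+ y) := (a :* c :+ x) :+ (b :* c :+ y)) refl a b c _ _)

dot-·ˡ : ∀ {m} a (u w : V m) → dot (a ·ᵥ u) w ≡ a * dot u w
dot-·ˡ a []      []      = sym (ℚP.*-zeroʳ a)
dot-·ˡ a (b ∷ u) (c ∷ w) = trans (cong ((a * b) * c +_) (dot-·ˡ a u w))
  (ℚS.solve 4 (λ a b c x → (a :* b) :* c :+ a :* x := a :* (b :* c :+ x)) refl a b c _)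

-- In this shape, symmetry of the form is an exchange of summations together with `G-sym`.
dot-matrix : ∀ {m k} (u : V m) (G : Vec (V k) m) (v : V k) →
  dot u (Vec.map (λ row → dot row v) G) ≡
  sum (λ i → sum (λ j → Vec.lookup u i * (Vec.lookup (Vec.lookup G i) j * Vec.lookup v j)))
dot-matrix u G v = trans (dot-sum u _) (sum-cong-≗ λ i → begin
  Vec.lookup u i * Vec.lookup (Vec.map (λ row → dot row v) G) i
    ≡⟨ cong (Vec.lookup u i *_) (VecP.lookup-map i (λ row → dot row v) G) ⟩
  Vec.lookup u i * dot (Vec.lookup G i) v
    ≡⟨ cong (Vec.lookup u i *_) (dot-sum (Vec.lookup G i) v) ⟩
  Vec.lookup u i * sum (λ j → Vec.lookup (Vec.lookup G i) j * Vec.lookup v j)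
    ≡⟨ *-distribˡ-sum (Vec.lookup u i) (λ j → Vec.lookup (Vec.lookup G i) j * Vec.lookup v j) ⟩
  _ ∎)
  where open ≡-Reasoning

½*2 : ∀ p → ℚ.½ * (2ℚ * p) ≡ p
½*2 p = ℚS.solve 1 (λ p → con ℚ.½ :* (con 2ℚ :* p) := p) refl p

-- Here z is the Cartan integer of two roots with inner product p, and q is the squared length of
-- the second. Positivity leaves z = 1 or z ≥ 2, and the latter says q ≤ p.
integer-multiple : ∀ z {p q} → 0ℚ < q → 0ℚ < p → ℤ→ℚ z * q ≡ 2ℚ * p → ℤ→ℚ z ≡ 1ℚ ⊎ q ≤ p
integer-multiple (ℤ.+ 0) {p} {q} 0<q 0<p e =
  ⊥-elim (<-≡⊥ (*-pos {2ℚ} (ℚP.positive⁻¹ 2ℚ) 0<p) (trans (sym (ℚP.*-zeroˡ q)) e))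
integer-multiple (ℤ.+ 1) 0<q 0<p e = inj₁ refl
integer-multiple (ℤ.+ suc (suc k)) {p} {q} 0<q 0<p e = inj₂ (0≤-⇒≤ (subst (0ℚ ≤_) eq
  (*-nonneg {ℚ.½} (ℚP.nonNegative⁻¹ ℚ.½) (*-nonneg (ℕ→ℚ-nonneg k) (ℚP.<⇒≤ 0<q)))))
  where
  open ≡-Reasoning
  c = ℕ→ℚ k
  eq : ℚ.½ * (c * q) ≡ p - q
  eq = begin
    ℚ.½ * (c * q)
      ≡⟨ ℚS.solve 2 (λ c q → con ℚ.½ :* (c :* q) := con ℚ.½ :* ((con 1ℚ :+ (con 1ℚ :+ c)) :* q) :+ :- q) refl c q ⟩
    ℚ.½ * ((1ℚ + (1ℚ + c)) * q) - q
      ≡⟨ cong (λ t → ℚ.½ * (t * q) - q) (trans (ℕ→ℚ-suc (suc k)) (cong (1ℚ +_) (ℕ→ℚ-suc k))) ⟨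
    ℚ.½ * (ℤ→ℚ (ℤ.+ suc (suc k)) * q) - q
      ≡⟨ cong (λ t → ℚ.½ * t - q) e ⟩
    ℚ.½ * (2ℚ * p) - q
      ≡⟨ cong (_- q) (½*2 p) ⟩
    p - q ∎
integer-multiple ℤ.-[1+ k ] {p} {q} 0<q 0<p e =
  ⊥-elim (<-≡⊥ (ℚP.+-mono-< (*-pos {2ℚ} (ℚP.positive⁻¹ 2ℚ) 0<p) (*-pos (ℚP.<-≤-trans 0<1 (1≤ℕ→ℚ-suc k)) 0<q)) eq)
  where
  open ≡-Reasoning
  c = ℕ→ℚ (suc k)
  eq : 0ℚ + 0ℚ ≡ 2ℚ * p + c * q
  eq = begin
    0ℚ + 0ℚ               ≡⟨ ℚS.solve 2 (λ c q → con (0ℚ + 0ℚ) := :- c :* q :+ c :* q) refl c q ⟩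
    - c * q + c * q       ≡⟨ cong (λ t → t * q + c * q) (ℤ→ℚ-neg (ℤ.+ suc k)) ⟨
    ℤ→ℚ ℤ.-[1+ k ] * q + c * q ≡⟨ cong (_+ c * q) e ⟩
    2ℚ * p + c * q        ∎

-- Division by zero yields zero, so additivity has no exception, and reflections are linear for
-- every β, isotropic ones included.
÷₀-+ : ∀ p q r → (p + q) ÷₀ r ≡ p ÷₀ r + q ÷₀ r
÷₀-+ p q r with r ℚP.≟ 0ℚ
... | yes _  = refl
... | no r≢0 = ℚP.*-distribʳ-+ ((1/ r) {{≢-nonZero r≢0}}) p q

÷₀-· : ∀ a p r → (a * p) ÷₀ r ≡ a * (p ÷₀ r)
÷₀-· a p r with r ℚP.≟ 0ℚ
... | yes _  = sym (ℚP.*-zeroʳ a)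
... | no r≢0 = ℚP.*-assoc a p ((1/ r) {{≢-nonZero r≢0}})

ℤ→ℚ-* : ∀ a b → ℤ→ℚ (a ℤ.* b) ≡ ℤ→ℚ a * ℤ→ℚ b
ℤ→ℚ-* a b = ℚP.toℚᵘ-injective (begin
  ℚ.toℚᵘ (ℤ→ℚ (a ℤ.* b))            ≈⟨ ℚP.toℚᵘ-fromℚᵘ (ℚᵘ.mkℚᵘ (a ℤ.* b) 0) ⟩
  ℚᵘ.mkℚᵘ a 0 ℚᵘ.* ℚᵘ.mkℚᵘ b 0       ≈⟨ ℚᵘP.*-cong (ℚᵘP.≃-sym (ℚP.toℚᵘ-fromℚᵘ (ℚᵘ.mkℚᵘ a 0))) (ℚᵘP.≃-sym (ℚP.toℚᵘ-fromℚᵘ (ℚᵘ.mkℚᵘ b 0))) ⟩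
  ℚ.toℚᵘ (ℤ→ℚ a) ℚᵘ.* ℚ.toℚᵘ (ℤ→ℚ b) ≈⟨ ℚᵘP.≃-sym (ℚP.toℚᵘ-homo-* (ℤ→ℚ a) (ℤ→ℚ b)) ⟩
  ℚ.toℚᵘ (ℤ→ℚ a * ℤ→ℚ b)            ∎)
  where
  open ℚᵘP.≃-Reasoning

AV-module : ℕ → QModule
AV-module n = V-module n ×-module (ℚ-module ×-module ℚ-module)

module LA {n} = Linear (AV-module n)

-- Adding one element to a subset; counting along a relation.

∈-insert⁻ : ∀ {m} {I : Subset m} {γ κ} → κ Sub.∈ I ∪ ⁅ γ ⁆ → κ ≡ γ ⊎ κ Sub.∈ I
∈-insert⁻ {I = I} {γ} κ∈ = Sum.swap (Sum.map₂ (SubP.x∈⁅y⁆⇒x≡y γ) (SubP.x∈p∪q⁻ I ⁅ γ ⁆ κ∈))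

∈-insert : ∀ {m} {I : Subset m} {γ} → γ Sub.∈ I ∪ ⁅ γ ⁆
∈-insert {γ = γ} = SubP.x∈p∪q⁺ (inj₂ (SubP.x∈⁅x⁆ γ))

⊆-insert : ∀ {m} {I : Subset m} {γ} → I ⊆ I ∪ ⁅ γ ⁆
⊆-insert {γ = γ} = SubP.p⊆p∪q ⁅ γ ⁆

insert-⊆ : ∀ {m} {I J : Subset m} {γ} → I ⊆ J → γ Sub.∈ J → I ∪ ⁅ γ ⁆ ⊆ J
insert-⊆ {J = J} I⊆J γ∈J κ∈ = Sum.[ (λ κ≡γ → subst (Sub._∈ J) (sym κ≡γ) γ∈J) , I⊆J ] (∈-insert⁻ κ∈)

-- `HasCard` asks for a repetition-free list of exactly the elements of P. Such a list is
-- transported from `xs` along a one-to-one relation; a relation is more convenient than a function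
-- because images exist only for members of `xs`.
module Correspondence {A B : Set} (_~_ : A → B → Set)
  (functional : ∀ {x y y′} → x ~ y → x ~ y′ → y ≡ y′)
  (injective : ∀ {x x′ y} → x ~ y → x′ ~ y → x ≡ x′) where

  images : ∀ xs → (∀ {x} → x LM.∈ xs → ∃[ y ] x ~ y) → ∃[ ys ] Pointwise _~_ xs ys
  images []       f = [] , []
  images (x ∷ xs) f =
    let y , x~y = f (here refl) ; ys , xs~ys = images xs (f ∘ there) in y ∷ ys , x~y ∷ xs~ys

  image-∈ : ∀ {xs ys x} → Pointwise _~_ xs ys → x LM.∈ xs → ∃[ y ] (y LM.∈ ys × x ~ y)
  image-∈ (x~y ∷ _) (here refl) = _ , here refl , x~y
  image-∈ (_ ∷ p) (there x∈) = let y , y∈ , x~y = image-∈ p x∈ in y , there y∈ , x~y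

  preimage-∈ : ∀ {xs ys y} → Pointwise _~_ xs ys → y LM.∈ ys → ∃[ x ] (x LM.∈ xs × x ~ y)
  preimage-∈ (x~y ∷ _) (here refl) = _ , here refl , x~y
  preimage-∈ (_ ∷ p) (there y∈) = let x , x∈ , x~y = preimage-∈ p y∈ in x , there x∈ , x~y

  images-unique : ∀ {xs ys} → Unique xs → Pointwise _~_ xs ys → Unique ys
  images-unique []         []        = []
  images-unique (x∉ ∷ uxs) (x~y ∷ p) = All.tabulate (λ y′∈ y≡y′ →
    let x′ , x′∈ , x′~y′ = preimage-∈ p y′∈
    in All.lookup x∉ x′∈ (injective x~y (subst (x′ ~_) (sym y≡y′) x′~y′))) ∷ images-unique uxs p

  HasCard-image : ∀ {P : B → Set} {xs} → Unique xs →
    (∀ {x} → x LM.∈ xs → ∃[ y ] x ~ y) →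
    (∀ {x y} → x LM.∈ xs → x ~ y → P y) →
    (∀ {y} → P y → ∃[ x ] (x LM.∈ xs × x ~ y)) → HasCard P (length xs)
  HasCard-image {P} {xs} uxs total sound complete =
    let ys , p = images xs total in
    ys , images-unique uxs p ,
    (λ y → (λ py → let x , x∈ , x~y = complete py ; y′ , y′∈ , x~y′ = image-∈ p x∈ in subst (LM._∈ ys) (functional x~y′ x~y) y′∈) ,
           (λ y∈ → let x , x∈ , x~y = preimage-∈ p y∈ in sound x∈ x~y)) ,
    sym (Pointwise.Pointwise-length p)

*-cancel-0< : ∀ {p q} → 0ℚ ≤ q → 0ℚ < p * q → 0ℚ < p
*-cancel-0< {p} {q} 0≤q 0<pq = ℚP.*-cancelʳ-<-nonNeg q {{ℚ.nonNegative 0≤q}} (subst (_< p * q) (sym (ℚP.*-zeroˡ q)) 0<pq)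

≤∧≢⇒< : ∀ {p q} → p ≤ q → p ≢ q → p < q
≤∧≢⇒< p≤q p≢q = ℚP.≰⇒> (λ q≤p → p≢q (ℚP.≤-antisym p≤q q≤p))

-- The inner product; differences and sums of roots.

module RootSystemProperties {n} (R : RootSystem n) where
  open RootSystem R
  open ≡-Reasoning

  ⟪⟫-comm : ∀ u v → ⟪ u , v ⟫ ≡ ⟪ v , u ⟫
  ⟪⟫-comm u v = begin
    ⟪ u , v ⟫ ≡⟨ dot-matrix u G v ⟩
    sum (λ i → sum (λ j → Vec.lookup u i * (Vec.lookup (Vec.lookup G i) j * Vec.lookup v j)))
      ≡⟨ ∑-comm (λ i j → Vec.lookup u i * (Vec.lookup (Vec.lookup G i) j * Vec.lookup v j)) ⟩
    sum (λ j → sum (λ i → Vec.lookup u i * (Vec.lookup (Vec.lookup G i) j * Vec.lookup v j)))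
      ≡⟨ sum-cong-≗ (λ j → sum-cong-≗ (λ i →
           trans (ℚS.solve 3 (λ a g b → a :* (g :* b) := b :* (g :* a)) refl (Vec.lookup u i) (Vec.lookup (Vec.lookup G i) j) (Vec.lookup v j))
                 (cong (λ g → Vec.lookup v j * (g * Vec.lookup u i)) (G-sym i j)))) ⟩
    sum (λ j → sum (λ i → Vec.lookup v j * (Vec.lookup (Vec.lookup G j) i * Vec.lookup u i)))
      ≡⟨ dot-matrix v G u ⟨
    ⟪ v , u ⟫ ∎

  ⟪⟫-+ˡ : ∀ u v w → ⟪ u +ᵥ v , w ⟫ ≡ ⟪ u , w ⟫ + ⟪ v , w ⟫
  ⟪⟫-+ˡ u v w = dot-+ˡ u v _

  ⟪⟫-·ˡ : ∀ a u w → ⟪ a ·ᵥ u , w ⟫ ≡ a * ⟪ u , w ⟫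
  ⟪⟫-·ˡ a u w = dot-·ˡ a u _

  ⟪⟫-+ʳ : ∀ u v w → ⟪ u , v +ᵥ w ⟫ ≡ ⟪ u , v ⟫ + ⟪ u , w ⟫
  ⟪⟫-+ʳ u v w = trans (⟪⟫-comm u _) (trans (⟪⟫-+ˡ v w u) (cong₂ _+_ (⟪⟫-comm v u) (⟪⟫-comm w u)))

  ⟪⟫-·ʳ : ∀ a u w → ⟪ u , a ·ᵥ w ⟫ ≡ a * ⟪ u , w ⟫
  ⟪⟫-·ʳ a u w = trans (⟪⟫-comm u _) (trans (⟪⟫-·ˡ a w u) (cong (a *_) (⟪⟫-comm w u)))

  ⟪⟫-0ˡ : ∀ u → ⟪ 0ᵥ , u ⟫ ≡ 0ℚ
  ⟪⟫-0ˡ u = trans (cong (λ z → ⟪ z , u ⟫) (sym (QModule.0⊙ (V-module n) 0ᵥ))) (trans (⟪⟫-·ˡ 0ℚ 0ᵥ u) (ℚP.*-zeroˡ ⟪ 0ᵥ , u ⟫))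

  ⟪⟫-sub : ∀ u v → ⟪ u -ᵥ v , u -ᵥ v ⟫ ≡ (⟪ u , u ⟫ + ⟪ v , v ⟫) - 2ℚ * ⟪ u , v ⟫
  ⟪⟫-sub u v = begin
    ⟪ u -ᵥ v , u -ᵥ v ⟫
      ≡⟨ ⟪⟫-+ˡ u (-1ℚ ·ᵥ v) (u -ᵥ v) ⟩
    ⟪ u , u -ᵥ v ⟫ + ⟪ -1ℚ ·ᵥ v , u -ᵥ v ⟫
      ≡⟨ cong₂ _+_ (sub-right u) (trans (⟪⟫-·ˡ -1ℚ v (u -ᵥ v)) (cong (-1ℚ *_) (sub-right v))) ⟩
    (⟪ u , u ⟫ + -1ℚ * ⟪ u , v ⟫) + -1ℚ * (⟪ v , u ⟫ + -1ℚ * ⟪ v , v ⟫)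
      ≡⟨ cong (λ t → (⟪ u , u ⟫ + -1ℚ * ⟪ u , v ⟫) + -1ℚ * (t + -1ℚ * ⟪ v , v ⟫)) (⟪⟫-comm v u) ⟩
    (⟪ u , u ⟫ + -1ℚ * ⟪ u , v ⟫) + -1ℚ * (⟪ u , v ⟫ + -1ℚ * ⟪ v , v ⟫)
      ≡⟨ ℚS.solve 3 (λ a b c → (a :+ con -1ℚ :* b) :+ con -1ℚ :* (b :+ con -1ℚ :* c) := (a :+ c) :+ :- (con 2ℚ :* b))
           refl ⟪ u , u ⟫ ⟪ u , v ⟫ ⟪ v , v ⟫ ⟩
    (⟪ u , u ⟫ + ⟪ v , v ⟫) - 2ℚ * ⟪ u , v ⟫ ∎
    where
    sub-right : ∀ w → ⟪ w , u -ᵥ v ⟫ ≡ ⟪ w , u ⟫ + -1ℚ * ⟪ w , v ⟫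
    sub-right w = trans (⟪⟫-+ʳ w u (-1ℚ ·ᵥ v)) (cong (⟪ w , u ⟫ +_) (⟪⟫-·ʳ -1ℚ w v))

  norm-pos : ∀ i → 0ℚ < ⟪ root i , root i ⟫
  norm-pos i = G-posdef (root i) (root≢0 i)

  pair∨-* : ∀ x i → pair∨ x (root i) * ⟪ root i , root i ⟫ ≡ 2ℚ * ⟪ x , root i ⟫
  pair∨-* x i = ÷₀-* (2ℚ * ⟪ x , root i ⟫) ⟪ root i , root i ⟫ (λ e → <-≡⊥ (norm-pos i) (sym e))

  pair∨-unique : ∀ x i c → c * ⟪ root i , root i ⟫ ≡ 2ℚ * ⟪ x , root i ⟫ → pair∨ x (root i) ≡ c
  pair∨-unique x i c e = *-cancel-pos (norm-pos i) (trans (pair∨-* x i) (sym e))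

  negate : ∀ i → ∃[ k ] root k ≡ -1ℚ ·ᵥ root i
  negate i with refl-closed i i
  ... | k , e = k , (begin
    root k                                              ≡⟨ e ⟨
    root i -ᵥ (pair∨ (root i) (root i) ·ᵥ root i)       ≡⟨ cong (λ c → root i -ᵥ (c ·ᵥ root i)) (pair∨-unique (root i) i 2ℚ refl) ⟩
    root i -ᵥ (2ℚ ·ᵥ root i)                            ≡⟨ LV.solve 1 (λ x → x ⊞ -1ℚ ⊡ (2ℚ ⊡ x) ⊜ -1ℚ ⊡ x) refl (root i) ⟩
    -1ℚ ·ᵥ root i                                       ∎)

  -- If one of the two Cartan integers is 1, a reflection gives the difference up to sign. Otherwise
  -- both squared lengths are at most the inner product, so the difference has squared length at
  -- most zero, although the two roots are distinct.
  sub-root : ∀ i j → 0ℚ < ⟪ root i , root j ⟫ → root i ≢ root j → ∃[ k ] root k ≡ root i -ᵥ root j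
  sub-root i j 0<ij i≢j = by-cases (multiple i j 0<ij) (multiple j i (subst (0ℚ <_) (⟪⟫-comm (root i) (root j)) 0<ij))
    where
    ii = ⟪ root i , root i ⟫
    jj = ⟪ root j , root j ⟫
    ij = ⟪ root i , root j ⟫

    multiple : ∀ i j → 0ℚ < ⟪ root i , root j ⟫ →
               pair∨ (root i) (root j) ≡ 1ℚ ⊎ ⟪ root j , root j ⟫ ≤ ⟪ root i , root j ⟫
    multiple i j 0<ij = from-integer (crystal j i)
      where
      from-integer : ∃[ z ] pair∨ (root i) (root j) ≡ ℤ→ℚ z →
                     pair∨ (root i) (root j) ≡ 1ℚ ⊎ ⟪ root j , root j ⟫ ≤ ⟪ root i , root j ⟫
      from-integer (z , e) = Sum.map₁ (trans e) (integer-multiple z (norm-pos j) 0<ij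
        (trans (cong (_* ⟪ root j , root j ⟫) (sym e)) (pair∨-* (root i) j)))

    reflected : ∀ i j → pair∨ (root i) (root j) ≡ 1ℚ → ∃[ k ] root k ≡ root i -ᵥ root j
    reflected i j p≡1 = proj₁ (refl-closed j i) , (begin
      root (proj₁ (refl-closed j i))
        ≡⟨ proj₂ (refl-closed j i) ⟨
      root i -ᵥ (pair∨ (root i) (root j) ·ᵥ root j)
        ≡⟨ cong (λ c → root i -ᵥ (c ·ᵥ root j)) p≡1 ⟩
      root i -ᵥ (1ℚ ·ᵥ root j)
        ≡⟨ cong (root i -ᵥ_) (QModule.1⊙ (V-module n) (root j)) ⟩
      root i -ᵥ root j ∎)

    d≢0 : root i -ᵥ root j ≢ 0ᵥ
    d≢0 e = i≢j (begin
      root i                          ≡⟨ LV.solve 2 (λ x y → x ⊜ (x ⊞ -1ℚ ⊡ y) ⊞ y) refl (root i) (root j) ⟩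
      (root i -ᵥ root j) +ᵥ root j    ≡⟨ cong (_+ᵥ root j) e ⟩
      0ᵥ +ᵥ root j                    ≡⟨ QModule.⊕-idˡ (V-module n) (root j) ⟩
      root j                          ∎)

    by-cases : pair∨ (root i) (root j) ≡ 1ℚ ⊎ jj ≤ ij →
               pair∨ (root j) (root i) ≡ 1ℚ ⊎ ii ≤ ⟪ root j , root i ⟫ →
               ∃[ k ] root k ≡ root i -ᵥ root j
    by-cases (inj₁ e) _ = reflected i j e
    by-cases (inj₂ _) (inj₁ e) = let k , f = reflected j i e ; l , g = negate k in l , (begin
      root l                      ≡⟨ g ⟩
      -1ℚ ·ᵥ root k               ≡⟨ cong (-1ℚ ·ᵥ_) f ⟩
      -1ℚ ·ᵥ (root j -ᵥ root i)   ≡⟨ LV.solve 2 (λ x y → -1ℚ ⊡ (y ⊞ -1ℚ ⊡ x) ⊜ x ⊞ -1ℚ ⊡ y) refl (root i) (root j) ⟩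
      root i -ᵥ root j            ∎)
    by-cases (inj₂ jj≤ij) (inj₂ ii≤ji) =
      ⊥-elim (<-≡⊥ (ℚP.+-mono-<-≤ (G-posdef (root i -ᵥ root j) d≢0) (ℚP.+-mono-≤ jj≤ij ii≤ji)) (begin
        0ℚ + (jj + ii)
          ≡⟨ ℚS.solve 3 (λ ii jj ij → con 0ℚ :+ (jj :+ ii) := ((ii :+ jj) :+ :- (con 2ℚ :* ij)) :+ (ij :+ ij)) refl ii jj ij ⟩
        ((ii + jj) - 2ℚ * ij) + (ij + ij)
          ≡⟨ cong₂ (λ s t → s + (ij + t)) (⟪⟫-sub (root i) (root j)) (⟪⟫-comm (root j) (root i)) ⟨
        ⟪ root i -ᵥ root j , root i -ᵥ root j ⟫ + (ij + ⟪ root j , root i ⟫) ∎))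

  add-root : ∀ i j → ⟪ root i , root j ⟫ < 0ℚ → root i ≢ -1ℚ ·ᵥ root j → ∃[ k ] root k ≡ root i +ᵥ root j
  add-root i j ij<0 i≢-j =
    let j′ , e = negate j
        k , f  = sub-root i j′ (subst (0ℚ <_) (eq j′ e) (ℚP.neg-antimono-< ij<0)) (λ h → i≢-j (trans h e))
    in k , (begin
    root k                        ≡⟨ f ⟩
    root i -ᵥ root j′             ≡⟨ cong (root i -ᵥ_) e ⟩
    root i -ᵥ (-1ℚ ·ᵥ root j)     ≡⟨ LV.solve 2 (λ x y → x ⊞ -1ℚ ⊡ (-1ℚ ⊡ y) ⊜ x ⊞ y) refl (root i) (root j) ⟩
    root i +ᵥ root j              ∎)
    where
    eq : ∀ j′ → root j′ ≡ -1ℚ ·ᵥ root j → - ⟪ root i , root j ⟫ ≡ ⟪ root i , root j′ ⟫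
    eq j′ e = begin
      - ⟪ root i , root j ⟫     ≡⟨ ℚS.solve 1 (λ x → :- x := con -1ℚ :* x) refl ⟪ root i , root j ⟫ ⟩
      -1ℚ * ⟪ root i , root j ⟫ ≡⟨ ⟪⟫-·ʳ -1ℚ (root i) (root j) ⟨
      ⟪ root i , -1ℚ ·ᵥ root j ⟫ ≡⟨ cong ⟪ root i ,_⟫ e ⟨
      ⟪ root i , root j′ ⟫      ∎

  -- Linear functionals and heights

  Span : V n → Set
  Span v = ∃[ c ] lincomb c α ≡ v

  span-+ : ∀ {u v} → Span u → Span v → Span (u +ᵥ v)
  span-+ (c , refl) (d , refl) = (λ i → c i + d i) , LC.comb-+ c d α

  span-· : ∀ a {u} → Span u → Span (a ·ᵥ u)
  span-· a (c , refl) = (λ i → a * c i) , LC.comb-· a c α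

  span-root : ∀ j → Span (root j)
  span-root j with simple-base j
  ... | c , e , _ = (λ i → ℤ→ℚ (c i)) , sym e

  span-simple : ∀ v → Span v
  span-simple v with spans v
  ... | c , refl = go (allFin N)
    where
    go : ∀ l → Span (List.foldr (λ i acc → (c i ·ᵥ root i) +ᵥ acc) 0ᵥ l)
    go []      = (λ _ → 0ℚ) , LC.comb-0 α
    go (i ∷ l) = span-+ (span-· (c i) (span-root i)) (go l)

  coord : V n → Fin n → ℚ
  coord v = proj₁ (span-simple v)

  -- `coord` is read off whatever witness `span-simple` returns; independence of the simple roots
  -- makes it canonical, and thereby linear.
  coord-unique : ∀ c {v} → lincomb c α ≡ v → ∀ i → coord v i ≡ c i
  coord-unique c {v} e i = begin
    coord v i                   ≡⟨ ℚS.solve 2 (λ x y → x := (x :+ con -1ℚ :* y) :+ y) refl (coord v i) (c i) ⟩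
    coord v i + -1ℚ * c i + c i ≡⟨ cong (_+ c i) (simple-indep (λ i → coord v i + -1ℚ * c i) zero-comb i) ⟩
    0ℚ + c i                    ≡⟨ ℚP.+-identityˡ (c i) ⟩
    c i                         ∎
    where
    zero-comb : lincomb (λ i → coord v i + -1ℚ * c i) α ≡ 0ᵥ
    zero-comb = begin
      lincomb (λ i → coord v i + -1ℚ * c i) α       ≡⟨ LC.comb-+ (coord v) (λ i → -1ℚ * c i) α ⟩
      lincomb (coord v) α +ᵥ lincomb (λ i → -1ℚ * c i) α ≡⟨ cong₂ _+ᵥ_ (proj₂ (span-simple v)) (trans (LC.comb-· -1ℚ c α) (cong (-1ℚ ·ᵥ_) e)) ⟩
      v +ᵥ (-1ℚ ·ᵥ v)                               ≡⟨ LV.solve 1 (λ v → v ⊞ -1ℚ ⊡ v ⊜ 𝕫) refl v ⟩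
      0ᵥ                                            ∎

  -- The linear form with prescribed values on the simple roots. Heights, the separation of simple
  -- roots and the affine forms are all obtained from it.
  functional : (Fin n → ℚ) → V n → ℚ
  functional f v = LQ.comb (coord v) f

  functional-+ : ∀ f u v → functional f (u +ᵥ v) ≡ functional f u + functional f v
  functional-+ f u v = trans
    (LQ.comb-cong {c = coord (u +ᵥ v)} {d = λ i → coord u i + coord v i} f (coord-unique _ (trans (LC.comb-+ (coord u) (coord v) α) (cong₂ _+ᵥ_ (proj₂ (span-simple u)) (proj₂ (span-simple v))))))
    (LQ.comb-+ (coord u) (coord v) f)

  functional-· : ∀ f a v → functional f (a ·ᵥ v) ≡ a * functional f v
  functional-· f a v = trans
    (LQ.comb-cong {c = coord (a ·ᵥ v)} {d = λ i → a * coord v i} f (coord-unique _ (trans (LC.comb-· a (coord v) α) (cong (a ·ᵥ_) (proj₂ (span-simple v))))))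
    (LQ.comb-· a (coord v) f)

  lincomb-kronecker : ∀ i → lincomb (λ j → ℕ→ℚ (kronecker i j)) α ≡ α i
  lincomb-kronecker i = begin
    lincomb (λ j → ℕ→ℚ (kronecker i j)) α
      ≡⟨ LC.comb-single i (λ j → ℕ→ℚ (kronecker i j)) α (λ j j≢i → cong ℕ→ℚ (kronecker-≢ (j≢i ∘ sym))) ⟩
    ℕ→ℚ (kronecker i i) ·ᵥ α i ≡⟨ cong (λ k → ℕ→ℚ k ·ᵥ α i) (kronecker-refl i) ⟩
    1ℚ ·ᵥ α i                  ≡⟨ QModule.1⊙ (V-module n) (α i) ⟩
    α i                        ∎

  functional-α : ∀ f i → functional f (α i) ≡ f i
  functional-α f i = begin
    LQ.comb (coord (α i)) f ≡⟨ LQ.comb-cong {c = coord (α i)} {d = λ j → ℕ→ℚ (kronecker i j)} f (coord-unique _ (lincomb-kronecker i)) ⟩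
    LQ.comb (λ j → ℕ→ℚ (kronecker i j)) f
      ≡⟨ LQ.comb-single i (λ j → ℕ→ℚ (kronecker i j)) f (λ j j≢i → cong ℕ→ℚ (kronecker-≢ (j≢i ∘ sym))) ⟩
    ℕ→ℚ (kronecker i i) * f i ≡⟨ cong (λ k → ℕ→ℚ k * f i) (kronecker-refl i) ⟩
    1ℚ * f i                  ≡⟨ ℚP.*-identityˡ (f i) ⟩
    f i                       ∎

  functional-0 : ∀ f → functional f 0ᵥ ≡ 0ℚ
  functional-0 f = begin
    functional f 0ᵥ         ≡⟨ cong (functional f) (QModule.0⊙ (V-module n) 0ᵥ) ⟨
    functional f (0ℚ ·ᵥ 0ᵥ) ≡⟨ functional-· f 0ℚ 0ᵥ ⟩
    0ℚ * functional f 0ᵥ    ≡⟨ ℚP.*-zeroˡ (functional f 0ᵥ) ⟩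
    0ℚ                      ∎

  -- A sum of simple roots is recorded as the list of its summands, so its height is the length.

  Σα : List (Fin n) → V n
  Σα = List.foldr (λ i v → α i +ᵥ v) 0ᵥ

  Σα-++ : ∀ xs ys → Σα (xs ++ ys) ≡ Σα xs +ᵥ Σα ys
  Σα-++ []       ys = sym (QModule.⊕-idˡ (V-module n) (Σα ys))
  Σα-++ (x ∷ xs) ys = trans (cong (α x +ᵥ_) (Σα-++ xs ys)) (sym (QModule.⊕-assoc (V-module n) (α x) (Σα xs) (Σα ys)))

  Σα-insert : ∀ xs i ys → Σα (xs ++ i ∷ ys) ≡ α i +ᵥ Σα (xs ++ ys)
  Σα-insert xs i ys = begin
    Σα (xs ++ i ∷ ys)          ≡⟨ Σα-++ xs (i ∷ ys) ⟩
    Σα xs +ᵥ (α i +ᵥ Σα ys)    ≡⟨ LV.solve 3 (λ x a y → x ⊞ (a ⊞ y) ⊜ a ⊞ (x ⊞ y)) refl (Σα xs) (α i) (Σα ys) ⟩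
    α i +ᵥ (Σα xs +ᵥ Σα ys)    ≡⟨ cong (α i +ᵥ_) (Σα-++ xs ys) ⟨
    α i +ᵥ Σα (xs ++ ys)       ∎

  ht : V n → ℚ
  ht = functional (λ _ → 1ℚ)

  ht-Σα : ∀ ms → ht (Σα ms) ≡ ℕ→ℚ (length ms)
  ht-Σα []       = functional-0 _
  ht-Σα (i ∷ ms) = begin
    ht (α i +ᵥ Σα ms)        ≡⟨ functional-+ _ (α i) (Σα ms) ⟩
    ht (α i) + ht (Σα ms)    ≡⟨ cong₂ _+_ (functional-α _ i) (ht-Σα ms) ⟩
    1ℚ + ℕ→ℚ (length ms)     ≡⟨ ℕ→ℚ-suc (length ms) ⟨
    ℕ→ℚ (suc (length ms))    ∎

  Pos⇒Σα : ∀ {j} → Pos j → ∃[ ms ] root j ≡ Σα ms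
  Pos⇒Σα (c , e) with go (allFin n)
    where
    copies : ∀ k i ms → ∃[ ms′ ] ℕ→ℚ k ·ᵥ α i +ᵥ Σα ms ≡ Σα ms′
    copies zero    i ms = ms , LV.solve 2 (λ a x → 0ℚ ⊡ a ⊞ x ⊜ x) refl (α i) (Σα ms)
    copies (suc k) i ms with copies k i ms
    ... | ms′ , e = i ∷ ms′ , (begin
      ℕ→ℚ (suc k) ·ᵥ α i +ᵥ Σα ms           ≡⟨ cong (λ c → c ·ᵥ α i +ᵥ Σα ms) (ℕ→ℚ-suc k) ⟩
      (1ℚ + ℕ→ℚ k) ·ᵥ α i +ᵥ Σα ms          ≡⟨ cong (_+ᵥ Σα ms) (QModule.⊙-distʳ (V-module n) 1ℚ (ℕ→ℚ k) (α i)) ⟩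
      (1ℚ ·ᵥ α i +ᵥ ℕ→ℚ k ·ᵥ α i) +ᵥ Σα ms  ≡⟨ LV.solve 3 (λ a b x → (1ℚ ⊡ a ⊞ b) ⊞ x ⊜ a ⊞ (b ⊞ x)) refl (α i) (ℕ→ℚ k ·ᵥ α i) (Σα ms) ⟩
      α i +ᵥ (ℕ→ℚ k ·ᵥ α i +ᵥ Σα ms)        ≡⟨ cong (α i +ᵥ_) e ⟩
      Σα (i ∷ ms′)                          ∎)
    go : ∀ l → ∃[ ms ] List.foldr (λ i acc → (ℕ→ℚ (c i) ·ᵥ α i) +ᵥ acc) 0ᵥ l ≡ Σα ms
    go []      = [] , refl
    go (i ∷ l) with go l
    ... | ms , e with copies (c i) i ms
    ...   | ms′ , e′ = ms′ , trans (cong ((ℕ→ℚ (c i) ·ᵥ α i) +ᵥ_) e) e′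
  ... | ms , e′ = ms , trans e e′

  Σα⇒Pos : ∀ {j} ms → root j ≡ Σα ms → Pos j
  Σα⇒Pos ms e with go ms
    where
    go : ∀ ms → Σ (Fin n → ℕ) λ c → Σα ms ≡ lincomb (λ i → ℕ→ℚ (c i)) α
    go []       = (λ _ → 0) , sym (LC.comb-0 α)
    go (i ∷ ms) with go ms
    ... | c , e = (λ j → kronecker i j ℕ.+ c j) , (begin
      α i +ᵥ Σα ms
        ≡⟨ cong₂ _+ᵥ_ (sym (lincomb-kronecker i)) e ⟩
      lincomb (λ j → ℕ→ℚ (kronecker i j)) α +ᵥ lincomb (λ j → ℕ→ℚ (c j)) α
        ≡⟨ LC.comb-+ (λ j → ℕ→ℚ (kronecker i j)) (λ j → ℕ→ℚ (c j)) α ⟨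
      lincomb (λ j → ℕ→ℚ (kronecker i j) + ℕ→ℚ (c j)) α
        ≡⟨ LC.comb-cong α (λ j → sym (ℤ→ℚ-+ (ℤ.+ kronecker i j) (ℤ.+ c j))) ⟩
      lincomb (λ j → ℕ→ℚ (kronecker i j ℕ.+ c j)) α ∎)
  ... | c , e′ = c , trans e e′

  Pos-α : ∀ i → Pos (simple i)
  Pos-α i = Σα⇒Pos (i ∷ []) (LV.solve 1 (λ a → a ⊜ a ⊞ 𝕫) refl (α i))

  Pos-+ : ∀ {i j k} → Pos i → Pos j → root k ≡ root i +ᵥ root j → Pos k
  Pos-+ pi pj e with Pos⇒Σα pi | Pos⇒Σα pj
  ... | xs , ei | ys , ej = Σα⇒Pos (xs ++ ys) (trans e (trans (cong₂ _+ᵥ_ ei ej) (sym (Σα-++ xs ys))))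

  Pos-or-negative : ∀ j → Pos j ⊎ ∃[ k ] (Pos k × root k ≡ -1ℚ ·ᵥ root j)
  Pos-or-negative j = from-base (simple-base j)
    where
    from-base : Σ (Fin n → ℤ) (λ c → root j ≡ lincomb (λ i → ℤ→ℚ (c i)) α × ((∀ i → ℤ.0ℤ ℤ.≤ c i) ⊎ (∀ i → c i ℤ.≤ ℤ.0ℤ))) →
                Pos j ⊎ ∃[ k ] (Pos k × root k ≡ -1ℚ ·ᵥ root j)
    from-base (c , e , inj₁ c≥0) =
      inj₁ ((λ i → ℤ.∣ c i ∣) , trans e (LC.comb-cong α (λ i → cong ℤ→ℚ (sym (ℤP.0≤i⇒+∣i∣≡i (c≥0 i))))))
    from-base (c , e , inj₂ c≤0) = inj₂ (proj₁ (negate j) , ((λ i → ℤ.∣ c i ∣) , (begin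
      root (proj₁ (negate j))                 ≡⟨ proj₂ (negate j) ⟩
      -1ℚ ·ᵥ root j                           ≡⟨ cong (-1ℚ ·ᵥ_) e ⟩
      -1ℚ ·ᵥ lincomb (λ i → ℤ→ℚ (c i)) α      ≡⟨ LC.comb-· -1ℚ (λ i → ℤ→ℚ (c i)) α ⟨
      lincomb (λ i → -1ℚ * ℤ→ℚ (c i)) α       ≡⟨ LC.comb-cong α coefficient ⟩
      lincomb (λ i → ℕ→ℚ ℤ.∣ c i ∣) α         ∎)) , proj₂ (negate j))
      where
      coefficient : ∀ i → -1ℚ * ℤ→ℚ (c i) ≡ ℕ→ℚ ℤ.∣ c i ∣
      coefficient i = begin
        -1ℚ * ℤ→ℚ (c i)    ≡⟨ ℚS.solve 1 (λ x → con -1ℚ :* x := :- x) refl (ℤ→ℚ (c i)) ⟩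
        - ℤ→ℚ (c i)        ≡⟨ ℤ→ℚ-neg (c i) ⟨
        ℤ→ℚ (ℤ.- c i)      ≡⟨ cong ℤ→ℚ (ℤP.0≤i⇒+∣i∣≡i (ℤP.neg-mono-≤ (c≤0 i))) ⟨
        ℕ→ℚ ℤ.∣ ℤ.- c i ∣  ≡⟨ cong ℕ→ℚ (ℤP.∣-i∣≡∣i∣ (c i)) ⟩
        ℕ→ℚ ℤ.∣ c i ∣      ∎

  Pos⇒1≤ht : ∀ {j} → Pos j → 1ℚ ≤ ht (root j)
  Pos⇒1≤ht {j} p with Pos⇒Σα p
  ... | []     , e = ⊥-elim (root≢0 j e)
  ... | i ∷ ms , e = subst (1ℚ ≤_) (sym (trans (cong ht e) (ht-Σα (i ∷ ms)))) (1≤ℕ→ℚ-suc (length ms))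

  ht-+ : ∀ u v → ht (u +ᵥ v) ≡ ht u + ht v
  ht-+ = functional-+ (λ _ → 1ℚ)

  ht-· : ∀ a v → ht (a ·ᵥ v) ≡ a * ht v
  ht-· = functional-· (λ _ → 1ℚ)

  ht-α : ∀ i → ht (α i) ≡ 1ℚ
  ht-α = functional-α (λ _ → 1ℚ)

  -- The root order and sums of simple roots.

  positive-summand : ∀ ms d → 0ℚ < ⟪ Σα ms , d ⟫ →
    ∃[ xs ] ∃[ i ] ∃[ ys ] (ms ≡ xs ++ i ∷ ys × 0ℚ < ⟪ α i , d ⟫)
  positive-summand []       d 0<0 = ⊥-elim (<-≡⊥ 0<0 (sym (⟪⟫-0ˡ d)))
  positive-summand (i ∷ ms) d 0<Σ = by-cases (0ℚ ℚP.<? ⟪ α i , d ⟫)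
    where
    by-cases : Dec (0ℚ < ⟪ α i , d ⟫) → ∃[ xs ] ∃[ j ] ∃[ ys ] (i ∷ ms ≡ xs ++ j ∷ ys × 0ℚ < ⟪ α j , d ⟫)
    by-cases (yes 0<αd) = [] , i , ms , refl , 0<αd
    by-cases (no 0≮αd) =
      let xs , j , ys , e , 0<j = positive-summand ms d (ℚP.<-≤-trans
            (subst (0ℚ <_) (⟪⟫-+ˡ (α i) (Σα ms) d) 0<Σ)
            (subst (⟪ α i , d ⟫ + ⟪ Σα ms , d ⟫ ≤_) (ℚP.+-identityˡ ⟪ Σα ms , d ⟫)
              (ℚP.+-monoˡ-≤ ⟪ Σα ms , d ⟫ (ℚP.≮⇒≥ 0≮αd))))
      in i ∷ xs , j , ys , cong (i ∷_) e , 0<j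

  -- A nonzero difference S = γ′ - γ has (S, S) > 0, so some summand αᵢ of it satisfies (αᵢ, S) > 0.
  -- Then either (γ′, αᵢ) > 0 and γ′ - αᵢ is a root, or (γ, αᵢ) < 0 and γ + αᵢ is one; in both cases
  -- the difference loses αᵢ. The number k makes the recursion structural, since αᵢ may be removed
  -- from any position.
  difference-cone⇒≼ : ∀ k ms γ γ′ → length ms ≡ k → Pos γ → root γ′ ≡ root γ +ᵥ Σα ms → γ ≼ γ′
  difference-cone⇒≼ zero    []         γ γ′ refl p e =
    subst (γ ≼_) (root-inj γ γ′ (sym (trans e (LV.solve 1 (λ x → x ⊞ 𝕫 ⊜ x) refl (root γ))))) ε
  difference-cone⇒≼ (suc k) ms@(_ ∷ _) γ γ′ l p e = from-summand (positive-summand ms (Σα ms) (G-posdef (Σα ms) Σ≢0))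
    where
    Σ≢0 : Σα ms ≢ 0ᵥ
    Σ≢0 s = ≤-≡⊥ (1≤ℕ→ℚ-suc k) (begin
      1ℚ                      ≡⟨⟩
      0ℚ + 1ℚ                 ≡⟨ cong (_+ 1ℚ) (trans (cong ht s) (functional-0 _)) ⟨
      ht (Σα ms) + 1ℚ         ≡⟨ cong (_+ 1ℚ) (trans (ht-Σα ms) (cong ℕ→ℚ l)) ⟩
      ℕ→ℚ (suc k) + 1ℚ        ∎)

    from-summand : ∃[ xs ] ∃[ i ] ∃[ ys ] (ms ≡ xs ++ i ∷ ys × 0ℚ < ⟪ α i , Σα ms ⟫) → γ ≼ γ′
    from-summand (xs , i , ys , s , 0<i) = by-cases (0ℚ ℚP.<? ⟪ root γ′ , α i ⟫)
      where
      ms′ = xs ++ ys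
      l′ : length ms′ ≡ k
      l′ = ℕP.suc-injective (trans (sym (length-++-sucʳ xs i ys)) (trans (cong length (sym s)) l))

      e′ : root γ′ ≡ root γ +ᵥ (α i +ᵥ Σα ms′)
      e′ = trans e (cong (root γ +ᵥ_) (trans (cong Σα s) (Σα-insert xs i ys)))

      γ′≢αi : root γ′ ≢ α i
      γ′≢αi h = ≤-≡⊥ (ℚP.+-mono-≤ (Pos⇒1≤ht p) (1≤ℕ→ℚ-suc k)) (begin
        1ℚ + 1ℚ                       ≡⟨ cong (_+ 1ℚ) (ht-α i) ⟨
        ht (α i) + 1ℚ                 ≡⟨ cong (λ v → ht v + 1ℚ) h ⟨
        ht (root γ′) + 1ℚ             ≡⟨ cong (λ v → ht v + 1ℚ) e ⟩
        ht (root γ +ᵥ Σα ms) + 1ℚ     ≡⟨ cong (_+ 1ℚ) (trans (ht-+ (root γ) (Σα ms)) (cong (ht (root γ) +_) (trans (ht-Σα ms) (cong ℕ→ℚ l)))) ⟩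
        (ht (root γ) + ℕ→ℚ (suc k)) + 1ℚ ∎)

      γ≢-αi : root γ ≢ -1ℚ ·ᵥ α i
      γ≢-αi h = ≤-≡⊥ (ℚP.+-mono-≤ (ℚP.<⇒≤ 0<1) (Pos⇒1≤ht p)) (begin
        0ℚ + 1ℚ                         ≡⟨⟩
        (0ℚ + -1ℚ * 1ℚ) + 1ℚ + 1ℚ       ≡⟨ cong (λ t → (0ℚ + -1ℚ * t) + 1ℚ + 1ℚ) (ht-α i) ⟨
        (0ℚ + -1ℚ * ht (α i)) + 1ℚ + 1ℚ ≡⟨ cong (λ t → (0ℚ + t) + 1ℚ + 1ℚ) (ht-· -1ℚ (α i)) ⟨
        (0ℚ + ht (-1ℚ ·ᵥ α i)) + 1ℚ + 1ℚ ≡⟨ cong (λ t → (0ℚ + ht t) + 1ℚ + 1ℚ) h ⟨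
        (0ℚ + ht (root γ)) + 1ℚ + 1ℚ    ≡⟨ ℚS.solve 1 (λ t → (con 0ℚ :+ t) :+ con 1ℚ :+ con 1ℚ := (con 1ℚ :+ t) :+ con 1ℚ) refl (ht (root γ)) ⟩
        (1ℚ + ht (root γ)) + 1ℚ         ∎)

      by-cases : Dec (0ℚ < ⟪ root γ′ , α i ⟫) → γ ≼ γ′
      by-cases (yes 0<γ′i) =
        let κ , f = sub-root γ′ (simple i) 0<γ′i γ′≢αi in
        difference-cone⇒≼ k ms′ γ κ l′ p (begin
          root κ                                       ≡⟨ f ⟩
          root γ′ -ᵥ α i                               ≡⟨ cong (_-ᵥ α i) e′ ⟩
          (root γ +ᵥ (α i +ᵥ Σα ms′)) -ᵥ α i           ≡⟨ LV.solve 3 (λ g a s → (g ⊞ (a ⊞ s)) ⊞ -1ℚ ⊡ a ⊜ g ⊞ s) refl (root γ) (α i) (Σα ms′) ⟩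
          root γ +ᵥ Σα ms′                             ∎)
        ◅◅ ((i , (begin
          root γ′                 ≡⟨ LV.solve 2 (λ g a → g ⊜ (g ⊞ -1ℚ ⊡ a) ⊞ a) refl (root γ′) (α i) ⟩
          (root γ′ -ᵥ α i) +ᵥ α i ≡⟨ cong (_+ᵥ α i) f ⟨
          root κ +ᵥ α i           ∎)) ◅ ε)
      by-cases (no 0≮γ′i) =
        let κ , f = add-root γ (simple i) γi<0 γ≢-αi in
        (i , f) ◅ difference-cone⇒≼ k ms′ κ γ′ l′ (Pos-+ p (Pos-α i) f) (begin
          root γ′                          ≡⟨ e′ ⟩
          root γ +ᵥ (α i +ᵥ Σα ms′)        ≡⟨ QModule.⊕-assoc (V-module n) (root γ) (α i) (Σα ms′) ⟨
          (root γ +ᵥ α i) +ᵥ Σα ms′        ≡⟨ cong (_+ᵥ Σα ms′) f ⟨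
          root κ +ᵥ Σα ms′                 ∎)
        where
        γi<0 : ⟪ root γ , α i ⟫ < 0ℚ
        γi<0 = subst₂ _<_ (ℚP.+-identityʳ ⟪ root γ , α i ⟫) refl (ℚP.<-≤-trans
          (ℚP.+-monoʳ-< ⟪ root γ , α i ⟫ 0<i)
          (subst (_≤ 0ℚ) (begin
            ⟪ root γ′ , α i ⟫                             ≡⟨ cong ⟪_, α i ⟫ e ⟩
            ⟪ root γ +ᵥ Σα ms , α i ⟫                     ≡⟨ ⟪⟫-+ˡ (root γ) (Σα ms) (α i) ⟩
            ⟪ root γ , α i ⟫ + ⟪ Σα ms , α i ⟫            ≡⟨ cong (⟪ root γ , α i ⟫ +_) (⟪⟫-comm (Σα ms) (α i)) ⟩
            ⟪ root γ , α i ⟫ + ⟪ α i , Σα ms ⟫            ∎) (ℚP.≮⇒≥ 0≮γ′i)))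

  -- Upper ideals are closed only along chains of covers; this makes them closed under adding an
  -- arbitrary positive root whenever the sum is a root.
  sum⇒≼ : ∀ {γ β γ′} → Pos γ → Pos β → root γ′ ≡ root γ +ᵥ root β → γ ≼ γ′
  sum⇒≼ {γ} {β} {γ′} p q e with Pos⇒Σα q
  ... | ms , f = difference-cone⇒≼ (length ms) ms γ γ′ refl p (trans e (cong (root γ +ᵥ_) f))

  ≼⇒difference-cone : ∀ {γ γ′} → γ ≼ γ′ → ∃[ ms ] root γ′ ≡ root γ +ᵥ Σα ms
  ≼⇒difference-cone {γ} ε = [] , LV.solve 1 (λ x → x ⊜ x ⊞ 𝕫) refl (root γ)
  ≼⇒difference-cone {γ} (_◅_ {j = κ} (i , e) κ≼) with ≼⇒difference-cone κ≼
  ... | ms , f = i ∷ ms , trans f (trans (cong (_+ᵥ Σα ms) e) (QModule.⊕-assoc (V-module n) (root γ) (α i) (Σα ms)))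

  ⋖-Pos : ∀ {γ γ′} → Pos γ → γ ⋖ γ′ → Pos γ′
  ⋖-Pos p (i , e) = Pos-+ p (Pos-α i) e

  -- The affine form and its reflections.

  module A = QModule (AV-module n)

  ⟪⟫^-comm : ∀ x y → ⟪ x , y ⟫^ ≡ ⟪ y , x ⟫^
  ⟪⟫^-comm (u , a , b) (v , c , d) = cong₂ _+_ (⟪⟫-comm u v)
    (ℚS.solve 4 (λ a b c d → a :* d :+ b :* c := c :* b :+ d :* a) refl a b c d)

  ⟪⟫^-+ˡ : ∀ x y z → ⟪ x +^ y , z ⟫^ ≡ ⟪ x , z ⟫^ + ⟪ y , z ⟫^
  ⟪⟫^-+ˡ (u , a , b) (v , c , d) (w , e , f) = trans (cong (_+ ((a + c) * f + (b + d) * e)) (⟪⟫-+ˡ u v w))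
    (ℚS.solve 8 (λ p q a b c d e f → (p :+ q) :+ ((a :+ c) :* f :+ (b :+ d) :* e) :=
      (p :+ (a :* f :+ b :* e)) :+ (q :+ (c :* f :+ d :* e))) refl ⟪ u , w ⟫ ⟪ v , w ⟫ a b c d e f)

  ⟪⟫^-·ˡ : ∀ a x z → ⟪ a ·^ x , z ⟫^ ≡ a * ⟪ x , z ⟫^
  ⟪⟫^-·ˡ k (u , a , b) (w , e , f) = trans (cong (_+ ((k * a) * f + (k * b) * e)) (⟪⟫-·ˡ k u w))
    (ℚS.solve 6 (λ k p a b e f → k :* p :+ ((k :* a) :* f :+ (k :* b) :* e) := k :* (p :+ (a :* f :+ b :* e)))
      refl k ⟪ u , w ⟫ a b e f)

  ⟪⟫^-+ʳ : ∀ x y z → ⟪ x , y +^ z ⟫^ ≡ ⟪ x , y ⟫^ + ⟪ x , z ⟫^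
  ⟪⟫^-+ʳ x y z = trans (⟪⟫^-comm x (y +^ z)) (trans (⟪⟫^-+ˡ y z x) (cong₂ _+_ (⟪⟫^-comm y x) (⟪⟫^-comm z x)))

  ⟪⟫^-·ʳ : ∀ a x z → ⟪ x , a ·^ z ⟫^ ≡ a * ⟪ x , z ⟫^
  ⟪⟫^-·ʳ a x z = trans (⟪⟫^-comm x (a ·^ z)) (trans (⟪⟫^-·ˡ a z x) (cong (a *_) (⟪⟫^-comm z x)))

  pair^ : AV → AV → ℚ
  pair^ x β = (2ℚ * ⟪ x , β ⟫^) ÷₀ ⟪ β , β ⟫^

  pair^-+ : ∀ x y β → pair^ (x +^ y) β ≡ pair^ x β + pair^ y β
  pair^-+ x y β = trans
    (cong (_÷₀ ⟪ β , β ⟫^) (trans (cong (2ℚ *_) (⟪⟫^-+ˡ x y β)) (ℚP.*-distribˡ-+ 2ℚ ⟪ x , β ⟫^ ⟪ y , β ⟫^)))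
    (÷₀-+ (2ℚ * ⟪ x , β ⟫^) (2ℚ * ⟪ y , β ⟫^) ⟪ β , β ⟫^)

  pair^-· : ∀ a x β → pair^ (a ·^ x) β ≡ a * pair^ x β
  pair^-· a x β = trans
    (cong (_÷₀ ⟪ β , β ⟫^) (trans (cong (2ℚ *_) (⟪⟫^-·ˡ a x β))
      (ℚS.solve 2 (λ a p → con 2ℚ :* (a :* p) := a :* (con 2ℚ :* p)) refl a ⟪ x , β ⟫^)))
    (÷₀-· a (2ℚ * ⟪ x , β ⟫^) ⟪ β , β ⟫^)

  refl^-+ : ∀ β x y → refl^ β (x +^ y) ≡ refl^ β x +^ refl^ β y
  refl^-+ β x y = begin
    (x +^ y) +^ ((- pair^ (x +^ y) β) ·^ β)   ≡⟨ cong (λ c → (x +^ y) +^ (c ·^ β)) (trans (cong -_ (pair^-+ x y β)) (ℚP.neg-distrib-+ p q)) ⟩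
    (x +^ y) +^ ((- p + - q) ·^ β)            ≡⟨ cong ((x +^ y) +^_) (A.⊙-distʳ (- p) (- q) β) ⟩
    (x +^ y) +^ (((- p) ·^ β) +^ ((- q) ·^ β)) ≡⟨ A.interchange x y ((- p) ·^ β) ((- q) ·^ β) ⟩
    refl^ β x +^ refl^ β y                    ∎
    where
    p = pair^ x β
    q = pair^ y β

  refl^-· : ∀ β a x → refl^ β (a ·^ x) ≡ a ·^ refl^ β x
  refl^-· β a x = begin
    (a ·^ x) +^ ((- pair^ (a ·^ x) β) ·^ β)   ≡⟨ cong (λ c → (a ·^ x) +^ (c ·^ β)) (trans (cong -_ (pair^-· a x β)) (ℚP.neg-distribʳ-* a p)) ⟩
    (a ·^ x) +^ ((a * - p) ·^ β)              ≡⟨ cong ((a ·^ x) +^_) (A.⊙-assoc a (- p) β) ⟩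
    (a ·^ x) +^ (a ·^ ((- p) ·^ β))           ≡⟨ A.⊙-distˡ a x ((- p) ·^ β) ⟨
    a ·^ refl^ β x                            ∎
    where
    p = pair^ x β

  refl^-fix : ∀ β x → ⟪ x , β ⟫^ ≡ 0ℚ → refl^ β x ≡ x
  refl^-fix β x e = begin
    x +^ ((- pair^ x β) ·^ β)    ≡⟨ cong (λ c → x +^ (c ·^ β)) (cong -_ pair≡0) ⟩
    x +^ (0ℚ ·^ β)               ≡⟨ LA.solve 2 (λ x b → x LA.⊞ 0ℚ LA.⊡ b LA.⊜ x) refl x β ⟩
    x                            ∎
    where
    pair≡0 : pair^ x β ≡ 0ℚ
    pair≡0 = begin
      pair^ x β                       ≡⟨ cong (λ t → (2ℚ * t) ÷₀ ⟪ β , β ⟫^) e ⟩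
      (0ℚ * 0ℚ) ÷₀ ⟪ β , β ⟫^         ≡⟨ ÷₀-· 0ℚ 0ℚ ⟪ β , β ⟫^ ⟩
      0ℚ * (0ℚ ÷₀ ⟪ β , β ⟫^)         ≡⟨ ℚP.*-zeroˡ (0ℚ ÷₀ ⟪ β , β ⟫^) ⟩
      0ℚ                              ∎

  module Nonisotropic (β : AV) (ββ≢0 : ⟪ β , β ⟫^ ≢ 0ℚ) where

    pair^-* : ∀ x → pair^ x β * ⟪ β , β ⟫^ ≡ 2ℚ * ⟪ x , β ⟫^
    pair^-* x = ÷₀-* (2ℚ * ⟪ x , β ⟫^) ⟪ β , β ⟫^ ββ≢0

    refl^-iso : ∀ x y → ⟪ refl^ β x , refl^ β y ⟫^ ≡ ⟪ x , y ⟫^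
    refl^-iso x y = begin
      ⟪ x +^ (p ·^ β) , y +^ (q ·^ β) ⟫^
        ≡⟨ ⟪⟫^-+ˡ x (p ·^ β) (y +^ (q ·^ β)) ⟩
      ⟪ x , y +^ (q ·^ β) ⟫^ + ⟪ p ·^ β , y +^ (q ·^ β) ⟫^
        ≡⟨ cong₂ _+_ (expand x) (trans (⟪⟫^-·ˡ p β (y +^ (q ·^ β))) (cong (p *_) (expand β))) ⟩
      (⟪ x , y ⟫^ + q * ⟪ x , β ⟫^) + p * (⟪ β , y ⟫^ + q * ⟪ β , β ⟫^)
        ≡⟨ cong (λ t → (⟪ x , y ⟫^ + q * ⟪ x , β ⟫^) + p * (t + q * ⟪ β , β ⟫^)) (⟪⟫^-comm β y) ⟩
      (⟪ x , y ⟫^ + q * xβ) + p * (yβ + q * ⟪ β , β ⟫^)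
        -- The excess over `⟪ x , y ⟫^` is arranged into multiples of
        -- `pair^ y β * ⟪ β , β ⟫^ - 2ℚ * yβ` and its counterpart for x, both of which vanish by
        -- `pair^-*`.
        ≡⟨ ℚS.solve 6 (λ xy P Q a b c →
             (xy :+ (:- Q) :* a) :+ (:- P) :* (b :+ (:- Q) :* c) := xy :+ ((con ℚ.½ :* (P :* (Q :* c :+ :- (con 2ℚ :* b)))) :+ (con ℚ.½ :* (Q :* (P :* c :+ :- (con 2ℚ :* a)))) ))
             refl ⟪ x , y ⟫^ (pair^ x β) (pair^ y β) xβ yβ ⟪ β , β ⟫^ ⟩
      ⟪ x , y ⟫^ + (ℚ.½ * (pair^ x β * (pair^ y β * ⟪ β , β ⟫^ - 2ℚ * yβ)) + ℚ.½ * (pair^ y β * (pair^ x β * ⟪ β , β ⟫^ - 2ℚ * xβ)))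
        ≡⟨ cong₂ (λ s t → ⟪ x , y ⟫^ + (ℚ.½ * (pair^ x β * (s - 2ℚ * yβ)) + ℚ.½ * (pair^ y β * (t - 2ℚ * xβ)))) (pair^-* y) (pair^-* x) ⟩
      ⟪ x , y ⟫^ + (ℚ.½ * (pair^ x β * (2ℚ * yβ - 2ℚ * yβ)) + ℚ.½ * (pair^ y β * (2ℚ * xβ - 2ℚ * xβ)))
        ≡⟨ ℚS.solve 5 (λ xy P Q a b →
             xy :+ (con ℚ.½ :* (P :* (con 2ℚ :* b :+ :- (con 2ℚ :* b))) :+ con ℚ.½ :* (Q :* (con 2ℚ :* a :+ :- (con 2ℚ :* a)))) := xy)
             refl ⟪ x , y ⟫^ (pair^ x β) (pair^ y β) xβ yβ ⟩
      ⟪ x , y ⟫^ ∎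
      where
      p = - pair^ x β
      q = - pair^ y β
      xβ = ⟪ x , β ⟫^
      yβ = ⟪ y , β ⟫^
      expand : ∀ z → ⟪ z , y +^ (q ·^ β) ⟫^ ≡ ⟪ z , y ⟫^ + q * ⟪ z , β ⟫^
      expand z = trans (⟪⟫^-+ʳ z y (q ·^ β)) (cong (⟪ z , y ⟫^ +_) (⟪⟫^-·ʳ q z β))

    pair^-self : pair^ β β ≡ 2ℚ
    pair^-self = begin
      (2ℚ * ⟪ β , β ⟫^) ÷₀ ⟪ β , β ⟫^     ≡⟨ ÷₀-· 2ℚ ⟪ β , β ⟫^ ⟪ β , β ⟫^ ⟩
      2ℚ * (⟪ β , β ⟫^ ÷₀ ⟪ β , β ⟫^)     ≡⟨ cong (2ℚ *_) (÷₀-self ⟪ β , β ⟫^ ββ≢0) ⟩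
      2ℚ * 1ℚ                             ∎
      where
      ÷₀-self : ∀ q → q ≢ 0ℚ → q ÷₀ q ≡ 1ℚ
      ÷₀-self q q≢0 with q ℚP.≟ 0ℚ
      ... | yes q≡0 = ⊥-elim (q≢0 q≡0)
      ... | no q≢0 = ℚP.*-inverseʳ q {{≢-nonZero q≢0}}

    refl^-invol : ∀ x → refl^ β (refl^ β x) ≡ x
    refl^-invol x = begin
      refl^ β x +^ ((- pair^ (refl^ β x) β) ·^ β) ≡⟨ cong (λ c → refl^ β x +^ (c ·^ β)) coefficient ⟩
      (x +^ ((- p) ·^ β)) +^ (p ·^ β)             ≡⟨ A.⊕-assoc x ((- p) ·^ β) (p ·^ β) ⟩
      x +^ (((- p) ·^ β) +^ (p ·^ β))             ≡⟨ cong (x +^_) (A.⊙-distʳ (- p) p β) ⟨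
      x +^ ((- p + p) ·^ β)                       ≡⟨ cong (λ c → x +^ (c ·^ β)) (ℚP.+-inverseˡ p) ⟩
      x +^ (0ℚ ·^ β)                              ≡⟨ LA.solve 2 (λ x b → x LA.⊞ 0ℚ LA.⊡ b LA.⊜ x) refl x β ⟩
      x                                           ∎
      where
      p = pair^ x β
      coefficient : - pair^ (refl^ β x) β ≡ p
      coefficient = begin
        - pair^ (refl^ β x) β              ≡⟨ cong -_ (pair^-+ x ((- p) ·^ β) β) ⟩
        - (p + pair^ ((- p) ·^ β) β)       ≡⟨ cong (λ t → - (p + t)) (trans (pair^-· (- p) β β) (cong (- p *_) pair^-self)) ⟩
        - (p + - p * 2ℚ)                   ≡⟨ ℚS.solve 1 (λ p → :- (p :+ :- p :* con 2ℚ) := p) refl p ⟩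
        p                                  ∎

  -- Real affine roots without a choice of sign: unlike `PosAff`, this set is stable under every
  -- word, and `Real-±` recovers the sign afterwards.
  Real : AV → Set
  Real x = ∃[ j ] ∃[ z ] x ≡ (root j , ℤ→ℚ z , 0ℚ)

  ⟪⟫^-finite : ∀ (u v : V n) a c → ⟪ (u , a , 0ℚ) , (v , c , 0ℚ) ⟫^ ≡ ⟪ u , v ⟫
  ⟪⟫^-finite u v a c = ℚS.solve 3 (λ p a c → p :+ (a :* con 0ℚ :+ con 0ℚ :* c) := p) refl ⟪ u , v ⟫ a c

  Real-nonisotropic : ∀ {β} → Real β → ⟪ β , β ⟫^ ≢ 0ℚ
  Real-nonisotropic (j , z , refl) e =
    <-≡⊥ (norm-pos j) (sym (trans (sym (⟪⟫^-finite (root j) (root j) (ℤ→ℚ z) (ℤ→ℚ z))) e))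

  -- As δ is isotropic and orthogonal to V, the pairing is that of the finite parts, a Cartan
  -- integer; so the level remains an integer and the finite part becomes a reflected root.
  Real-refl^ : ∀ {β x} → Real β → Real x → Real (refl^ β x)
  Real-refl^ (i , y , refl) (j , z , refl) = from-closure (refl-closed i j) (crystal i j)
    where
    from-closure : ∃[ k ] refl-s (root i) (root j) ≡ root k → ∃[ t ] pair∨ (root j) (root i) ≡ ℤ→ℚ t →
                   Real (refl^ (root i , ℤ→ℚ y , 0ℚ) (root j , ℤ→ℚ z , 0ℚ))
    from-closure (k , e) (t , f) = k , z ℤ.+ (ℤ.- t) ℤ.* y , cong₂ _,_ first (cong₂ _,_ second third)
      where
      c = - pair^ (root j , ℤ→ℚ z , 0ℚ) (root i , ℤ→ℚ y , 0ℚ)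
      c≡ : c ≡ - pair∨ (root j) (root i)
      c≡ = cong -_ (cong₂ (λ s t → (2ℚ * s) ÷₀ t) (⟪⟫^-finite (root j) (root i) (ℤ→ℚ z) (ℤ→ℚ y)) (⟪⟫^-finite (root i) (root i) (ℤ→ℚ y) (ℤ→ℚ y)))
      first : root j +ᵥ c ·ᵥ root i ≡ root k
      first = begin
        root j +ᵥ c ·ᵥ root i                              ≡⟨ cong (λ c → root j +ᵥ c ·ᵥ root i) c≡ ⟩
        root j +ᵥ (- pair∨ (root j) (root i)) ·ᵥ root i
          ≡⟨ cong (λ c → root j +ᵥ c ·ᵥ root i) (ℚS.solve 1 (λ p → :- p := con -1ℚ :* p) refl (pair∨ (root j) (root i))) ⟩
        root j +ᵥ (-1ℚ * pair∨ (root j) (root i)) ·ᵥ root i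
          ≡⟨ cong (root j +ᵥ_) (QModule.⊙-assoc (V-module n) -1ℚ (pair∨ (root j) (root i)) (root i)) ⟩
        refl-s (root i) (root j)                           ≡⟨ e ⟩
        root k                                             ∎
      second : ℤ→ℚ z + c * ℤ→ℚ y ≡ ℤ→ℚ (z ℤ.+ (ℤ.- t) ℤ.* y)
      second = begin
        ℤ→ℚ z + c * ℤ→ℚ y                  ≡⟨ cong (λ c → ℤ→ℚ z + c * ℤ→ℚ y) (trans c≡ (trans (cong -_ f) (sym (ℤ→ℚ-neg t)))) ⟩
        ℤ→ℚ z + ℤ→ℚ (ℤ.- t) * ℤ→ℚ y        ≡⟨ cong (ℤ→ℚ z +_) (ℤ→ℚ-* (ℤ.- t) y) ⟨
        ℤ→ℚ z + ℤ→ℚ (ℤ.- t ℤ.* y)          ≡⟨ ℤ→ℚ-+ z (ℤ.- t ℤ.* y) ⟨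
        ℤ→ℚ (z ℤ.+ ℤ.- t ℤ.* y)            ∎
      third : 0ℚ + c * 0ℚ ≡ 0ℚ
      third = ℚS.solve 1 (λ c → con 0ℚ :+ c :* con 0ℚ := con 0ℚ) refl c

  -- The highest root and the action of words.

  module Highest (θ : Fin N) (θ-highest : IsHighest θ) where
    open Affine θ

    ht-≼ : ∀ {γ γ′} → γ ≼ γ′ → ht (root γ) ≤ ht (root γ′)
    ht-≼ {γ} {γ′} γ≼γ′ with ≼⇒difference-cone γ≼γ′
    ... | ms , e = subst₂ _≤_ (ℚP.+-identityʳ (ht (root γ)))
      (sym (trans (cong ht e) (trans (ht-+ (root γ) (Σα ms)) (cong (ht (root γ) +_) (ht-Σα ms)))))
      (ℚP.+-monoʳ-≤ (ht (root γ)) (ℕ→ℚ-nonneg (length ms)))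

    ht≤htθ : ∀ {γ} → Pos γ → ht (root γ) ≤ ht (root θ)
    ht≤htθ p = ht-≼ (proj₂ θ-highest _ p)

    θ+α-not-root : ∀ {i k} → root k ≢ root θ +ᵥ α i
    θ+α-not-root {i} {k} e = ≤-≡⊥ (ht≤htθ (Pos-+ (proj₁ θ-highest) (Pos-α i) e))
      (trans (cong ht e) (trans (ht-+ (root θ) (α i)) (cong (ht (root θ) +_) (ht-α i))))

    -- If (αᵢ, θ) < 0, then θ + αᵢ would be a positive root of larger height than θ.
    Σα-θ-nonneg : ∀ ms → 0ℚ ≤ ⟪ Σα ms , root θ ⟫
    Σα-θ-nonneg [] = ℚP.≤-reflexive (sym (⟪⟫-0ˡ (root θ)))
    Σα-θ-nonneg (i ∷ ms) = subst (0ℚ ≤_) (sym (⟪⟫-+ˡ (α i) (Σα ms) (root θ)))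
      (ℚP.+-mono-≤ (ℚP.≮⇒≥ α-θ≮0) (Σα-θ-nonneg ms))
      where
      α-θ≮0 : ¬ ⟪ α i , root θ ⟫ < 0ℚ
      α-θ≮0 h = θ+α-not-root (proj₂ (add-root θ (simple i) (subst (_< 0ℚ) (⟪⟫-comm (α i) (root θ)) h) θ≢-α))
        where
        θ≢-α : root θ ≢ -1ℚ ·ᵥ α i
        θ≢-α e = ≤-≡⊥ (ℚP.+-mono-≤ (Pos⇒1≤ht (proj₁ θ-highest)) (ℚP.<⇒≤ 0<1)) (begin
          1ℚ + 0ℚ ≡⟨⟩
          (-1ℚ * 1ℚ + 1ℚ) + 1ℚ ≡⟨ cong (λ t → (-1ℚ * t + 1ℚ) + 1ℚ) (ht-α i) ⟨
          (-1ℚ * ht (α i) + 1ℚ) + 1ℚ ≡⟨ cong (λ t → (t + 1ℚ) + 1ℚ) (trans (cong ht e) (ht-· -1ℚ (α i))) ⟨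
          (ht (root θ) + 1ℚ) + 1ℚ ∎)

    θ-dominant : ∀ {γ} → Pos γ → 0ℚ ≤ ⟪ root γ , root θ ⟫
    θ-dominant p with Pos⇒Σα p
    ... | ms , e = subst (λ v → 0ℚ ≤ ⟪ v , root θ ⟫) (sym e) (Σα-θ-nonneg ms)

    ⟪θ⟫>0⇒Pos : ∀ {γ} → 0ℚ < ⟪ root γ , root θ ⟫ → Pos γ
    ⟪θ⟫>0⇒Pos {γ} 0<γθ = Sum.fromInj₁ negative (Pos-or-negative γ)
      where
      negative : ∃[ k ] (Pos k × root k ≡ -1ℚ ·ᵥ root γ) → Pos γ
      negative (k , pk , e) = ⊥-elim (<-≡⊥ (ℚP.+-mono-<-≤ 0<γθ (θ-dominant pk)) (begin
        0ℚ + 0ℚ                                    ≡⟨ ℚS.solve 1 (λ x → con (0ℚ + 0ℚ) := x :+ con -1ℚ :* x) refl ⟪ root γ , root θ ⟫ ⟩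
        ⟪ root γ , root θ ⟫ + -1ℚ * ⟪ root γ , root θ ⟫ ≡⟨ cong (⟪ root γ , root θ ⟫ +_) (trans (cong ⟪_, root θ ⟫ e) (⟪⟫-·ˡ -1ℚ (root γ) (root θ))) ⟨
        ⟪ root γ , root θ ⟫ + ⟪ root k , root θ ⟫  ∎))

    α^-Real : ∀ i → Real (α^ i)
    α^-Real (suc i) = simple i , ℤ.0ℤ , refl
    α^-Real zero    = proj₁ (negate θ) , ℤ.1ℤ ,
      cong (_, (1ℚ , 0ℚ)) (trans (LV.solve 1 (λ x → 𝕫 ⊞ -1ℚ ⊡ x ⊜ -1ℚ ⊡ x) refl (root θ)) (sym (proj₂ (negate θ))))

    α^-nonisotropic : ∀ i → ⟪ α^ i , α^ i ⟫^ ≢ 0ℚ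
    α^-nonisotropic i = Real-nonisotropic (α^-Real i)

    act-+ : ∀ w x y → act w (x +^ y) ≡ act w x +^ act w y
    act-+ []      x y = refl
    act-+ (i ∷ w) x y = trans (cong (refl^ (α^ i)) (act-+ w x y)) (refl^-+ (α^ i) (act w x) (act w y))

    act-· : ∀ w a x → act w (a ·^ x) ≡ a ·^ act w x
    act-· []      a x = refl
    act-· (i ∷ w) a x = trans (cong (refl^ (α^ i)) (act-· w a x)) (refl^-· (α^ i) a (act w x))

    act-iso : ∀ w x y → ⟪ act w x , act w y ⟫^ ≡ ⟪ x , y ⟫^
    act-iso []      x y = refl
    act-iso (i ∷ w) x y = trans (Nonisotropic.refl^-iso (α^ i) (α^-nonisotropic i) (act w x) (act w y)) (act-iso w x y)

    act-Real : ∀ w {x} → Real x → Real (act w x)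
    act-Real []      r = r
    act-Real (i ∷ w) r = Real-refl^ (α^-Real i) (act-Real w r)

    act-δ : ∀ w → act w δ ≡ δ
    act-δ []      = refl
    act-δ (i ∷ w) = trans (cong (refl^ (α^ i)) (act-δ w)) (refl^-fix (α^ i) δ (δ-orthogonal (α^-Real i)))
      where
      δ-orthogonal : ∀ {x} → Real x → ⟪ δ , x ⟫^ ≡ 0ℚ
      δ-orthogonal (j , z , refl) = trans (⟪⟫^-finite 0ᵥ (root j) 1ℚ (ℤ→ℚ z)) (⟪⟫-0ˡ (root j))

    act-++ : ∀ u w x → act (u ++ w) x ≡ act u (act w x)
    act-++ []      w x = refl
    act-++ (i ∷ u) w x = cong (refl^ (α^ i)) (act-++ u w x)

    -- Each simple reflection is its own inverse, so the reversed word serves as w⁻¹.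
    act-reverse : ∀ w x → act (List.reverse w) (act w x) ≡ x
    act-reverse []      x = refl
    act-reverse (i ∷ w) x = begin
      act (List.reverse (i ∷ w)) (refl^ (α^ i) (act w x))
        ≡⟨ cong (λ u → act u (refl^ (α^ i) (act w x))) (unfold-reverse i w) ⟩
      act (List.reverse w ++ i ∷ []) (refl^ (α^ i) (act w x))
        ≡⟨ act-++ (List.reverse w) (i ∷ []) (refl^ (α^ i) (act w x)) ⟩
      act (List.reverse w) (refl^ (α^ i) (refl^ (α^ i) (act w x)))
        ≡⟨ cong (act (List.reverse w)) (Nonisotropic.refl^-invol (α^ i) (α^-nonisotropic i) (act w x)) ⟩
      act (List.reverse w) (act w x)
        ≡⟨ act-reverse w x ⟩
      x ∎

    reverse-act : ∀ w x → act w (act (List.reverse w) x) ≡ x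
    reverse-act w x = trans (cong (λ u → act u (act (List.reverse w) x)) (sym (reverse-involutive w))) (act-reverse (List.reverse w) x)

    -- Positive affine roots as sums of simple affine roots; affine heights.

    Σα^ : List (Fin (suc n)) → AV
    Σα^ = List.foldr (λ i x → α^ i +^ x) A.𝟘

    Σα^-++ : ∀ xs ys → Σα^ (xs ++ ys) ≡ Σα^ xs +^ Σα^ ys
    Σα^-++ []       ys = sym (A.⊕-idˡ (Σα^ ys))
    Σα^-++ (i ∷ xs) ys = trans (cong (α^ i +^_) (Σα^-++ xs ys)) (sym (A.⊕-assoc (α^ i) (Σα^ xs) (Σα^ ys)))

    Σα^-ι : ∀ ms → Σα^ (List.map suc ms) ≡ ι (Σα ms)
    Σα^-ι []       = refl
    Σα^-ι (i ∷ ms) = cong (ι (α i) +^_) (Σα^-ι ms)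

    -- Every root is at least -θ, because a negative root -κ satisfies κ ≼ θ. The sum β + θ is what
    -- is left of the finite part of a root β + mδ with m ≥ 1 once one α₀ has been split off.
    root+θ-cone : ∀ j → ∃[ ms ] root j +ᵥ root θ ≡ Σα ms
    root+θ-cone j = by-sign (Pos-or-negative j)
      where
      from-cones : ∃[ ms ] root j ≡ Σα ms → ∃[ ns ] root θ ≡ Σα ns → ∃[ ms ] root j +ᵥ root θ ≡ Σα ms
      from-cones (ms , e) (ns , f) = ms ++ ns , trans (cong₂ _+ᵥ_ e f) (sym (Σα-++ ms ns))

      from-difference : ∀ {k} → root k ≡ -1ℚ ·ᵥ root j → ∃[ ms ] root θ ≡ root k +ᵥ Σα ms → ∃[ ms ] root j +ᵥ root θ ≡ Σα ms
      from-difference e (ms , f) = ms , (begin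
        root j +ᵥ root θ                     ≡⟨ cong (root j +ᵥ_) (trans f (cong (_+ᵥ Σα ms) e)) ⟩
        root j +ᵥ (-1ℚ ·ᵥ root j +ᵥ Σα ms)   ≡⟨ LV.solve 2 (λ x s → x ⊞ (-1ℚ ⊡ x ⊞ s) ⊜ s) refl (root j) (Σα ms) ⟩
        Σα ms                                ∎)

      by-sign : Pos j ⊎ ∃[ k ] (Pos k × root k ≡ -1ℚ ·ᵥ root j) → ∃[ ms ] root j +ᵥ root θ ≡ Σα ms
      by-sign (inj₁ p)           = from-cones (Pos⇒Σα p) (Pos⇒Σα (proj₁ θ-highest))
      by-sign (inj₂ (k , p , e)) = from-difference e (≼⇒difference-cone (proj₂ θ-highest k p))

    level-suc : ∀ k → (ℕ→ℚ (suc k) , 0ℚ) ≡ (1ℚ + (0ℚ + ℕ→ℚ k) , 0ℚ)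
    level-suc k = cong (_, 0ℚ) (trans (ℕ→ℚ-suc k) (cong (1ℚ +_) (sym (ℚP.+-identityˡ (ℕ→ℚ k)))))

    kδ-cone : ∀ k → ∃[ ms ] (0ᵥ , ℕ→ℚ k , 0ℚ) ≡ Σα^ ms
    kδ-cone zero    = [] , refl
    kδ-cone (suc k) = from-cones (kδ-cone k) (Pos⇒Σα (proj₁ θ-highest))
      where
      from-cones : ∃[ ms ] (0ᵥ , ℕ→ℚ k , 0ℚ) ≡ Σα^ ms → ∃[ ns ] root θ ≡ Σα ns → ∃[ ms ] (0ᵥ , ℕ→ℚ (suc k) , 0ℚ) ≡ Σα^ ms
      from-cones (ms , e) (ns , f) = zero ∷ List.map suc ns ++ ms , (begin
        (0ᵥ , ℕ→ℚ (suc k) , 0ℚ)                      ≡⟨ cong₂ _,_ (LV.solve 1 (λ x → 𝕫 ⊜ (𝕫 ⊞ -1ℚ ⊡ x) ⊞ (x ⊞ 𝕫)) refl (root θ)) (level-suc k) ⟩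
        α^ zero +^ (ι (root θ) +^ (0ᵥ , ℕ→ℚ k , 0ℚ)) ≡⟨ cong (α^ zero +^_) (cong₂ _+^_ (trans (cong ι f) (sym (Σα^-ι ns))) e) ⟩
        α^ zero +^ (Σα^ (List.map suc ns) +^ Σα^ ms) ≡⟨ cong (α^ zero +^_) (Σα^-++ (List.map suc ns) ms) ⟨
        Σα^ (zero ∷ List.map suc ns ++ ms)           ∎)

    PosAff⇒Σα^ : ∀ {x} → PosAff x → ∃[ ms ] x ≡ Σα^ ms
    PosAff⇒Σα^ (inj₁ (j , p , refl)) = from-cone (Pos⇒Σα p)
      where
      from-cone : ∃[ ms ] root j ≡ Σα ms → ∃[ ms ] ι (root j) ≡ Σα^ ms
      from-cone (ms , e) = List.map suc ms , trans (cong ι e) (sym (Σα^-ι ms))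
    PosAff⇒Σα^ (inj₂ (j , k , refl)) = from-cones (root+θ-cone j) (kδ-cone k)
      where
      from-cones : ∃[ ms ] root j +ᵥ root θ ≡ Σα ms → ∃[ ns ] (0ᵥ , ℕ→ℚ k , 0ℚ) ≡ Σα^ ns →
                   ∃[ ms ] (root j , ℕ→ℚ (suc k) , 0ℚ) ≡ Σα^ ms
      -- β + (k + 1)δ = α₀ + (β + θ) + kδ, because α₀ = δ - θ.
      from-cones (ms , e) (ns , f) = zero ∷ List.map suc ms ++ ns , (begin
        (root j , ℕ→ℚ (suc k) , 0ℚ)
          ≡⟨ cong₂ _,_ (LV.solve 2 (λ x t → x ⊜ (𝕫 ⊞ -1ℚ ⊡ t) ⊞ ((x ⊞ t) ⊞ 𝕫)) refl (root j) (root θ)) (level-suc k) ⟩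
        α^ zero +^ (ι (root j +ᵥ root θ) +^ (0ᵥ , ℕ→ℚ k , 0ℚ))
          ≡⟨ cong (α^ zero +^_) (cong₂ _+^_ (trans (cong ι e) (sym (Σα^-ι ms))) f) ⟩
        α^ zero +^ (Σα^ (List.map suc ms) +^ Σα^ ns)
          ≡⟨ cong (α^ zero +^_) (Σα^-++ (List.map suc ms) ns) ⟨
        Σα^ (zero ∷ List.map suc ms ++ ns) ∎)

    -- The linear form with prescribed values on α₀, ..., αₙ. The factor of `a` is its value at δ,
    -- forced by δ = α₀ + θ; the value at λ is set to zero.
    functional^ : (Fin (suc n) → ℚ) → AV → ℚ
    functional^ g (v , a , _) = functional (g ∘ suc) v + a * (functional (g ∘ suc) (root θ) + g zero)

    functional^-+ : ∀ g x y → functional^ g (x +^ y) ≡ functional^ g x + functional^ g y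
    functional^-+ g (u , a , _) (v , c , _) = trans
      (cong (_+ (a + c) * H) (functional-+ (g ∘ suc) u v))
      (ℚS.solve 5 (λ p q a c h → (p :+ q) :+ (a :+ c) :* h := (p :+ a :* h) :+ (q :+ c :* h)) refl
        (functional (g ∘ suc) u) (functional (g ∘ suc) v) a c H)
      where H = functional (g ∘ suc) (root θ) + g zero

    functional^-· : ∀ g k x → functional^ g (k ·^ x) ≡ k * functional^ g x
    functional^-· g k (u , a , _) = trans
      (cong (_+ (k * a) * H) (functional-· (g ∘ suc) k u))
      (ℚS.solve 4 (λ k p a h → k :* p :+ (k :* a) :* h := k :* (p :+ a :* h)) refl k (functional (g ∘ suc) u) a H)
      where H = functional (g ∘ suc) (root θ) + g zero

    functional^-α : ∀ g i → functional^ g (α^ i) ≡ g i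
    functional^-α g (suc i) = trans (cong₂ _+_ (functional-α (g ∘ suc) i) (ℚP.*-zeroˡ (functional (g ∘ suc) (root θ) + g zero))) (ℚP.+-identityʳ (g (suc i)))
    functional^-α g zero = begin
      functional f (0ᵥ +ᵥ (-1ℚ ·ᵥ root θ)) + 1ℚ * (functional f (root θ) + g zero)
        ≡⟨ cong (_+ 1ℚ * (functional f (root θ) + g zero))
             (trans (cong (functional f) (QModule.⊕-idˡ (V-module n) (-1ℚ ·ᵥ root θ))) (functional-· f -1ℚ (root θ))) ⟩
      -1ℚ * functional f (root θ) + 1ℚ * (functional f (root θ) + g zero)
        ≡⟨ ℚS.solve 2 (λ t g → con -1ℚ :* t :+ con 1ℚ :* (t :+ g) := g) refl (functional f (root θ)) (g zero) ⟩
      g zero ∎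
      where f = g ∘ suc

    functional^-0 : ∀ g → functional^ g A.𝟘 ≡ 0ℚ
    functional^-0 g = trans (cong₂ _+_ (functional-0 (g ∘ suc)) (ℚP.*-zeroˡ (functional (g ∘ suc) (root θ) + g zero))) refl

    ht^ : AV → ℚ
    ht^ = functional^ (λ _ → 1ℚ)

    ht^-+ : ∀ x y → ht^ (x +^ y) ≡ ht^ x + ht^ y
    ht^-+ = functional^-+ (λ _ → 1ℚ)

    ht^-· : ∀ a x → ht^ (a ·^ x) ≡ a * ht^ x
    ht^-· = functional^-· (λ _ → 1ℚ)

    ht^-α : ∀ i → ht^ (α^ i) ≡ 1ℚ
    ht^-α = functional^-α (λ _ → 1ℚ)

    ht^-Σα^ : ∀ ms → ht^ (Σα^ ms) ≡ ℕ→ℚ (length ms)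
    ht^-Σα^ []       = functional^-0 (λ _ → 1ℚ)
    ht^-Σα^ (i ∷ ms) = begin
      ht^ (α^ i +^ Σα^ ms)      ≡⟨ ht^-+ (α^ i) (Σα^ ms) ⟩
      ht^ (α^ i) + ht^ (Σα^ ms) ≡⟨ cong₂ _+_ (ht^-α i) (ht^-Σα^ ms) ⟩
      1ℚ + ℕ→ℚ (length ms)      ≡⟨ ℕ→ℚ-suc (length ms) ⟨
      ℕ→ℚ (suc (length ms))     ∎

    PosAff⇒Real : ∀ {x} → PosAff x → Real x
    PosAff⇒Real (inj₁ (j , _ , e)) = j , ℤ.0ℤ , e
    PosAff⇒Real (inj₂ (j , k , e)) = j , ℤ.+ suc k , e

    Real≢0 : ∀ {x} → Real x → x ≢ A.𝟘
    Real≢0 (j , z , refl) e = root≢0 j (cong proj₁ e)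

    PosAff⇒1≤ht^ : ∀ {x} → PosAff x → 1ℚ ≤ ht^ x
    PosAff⇒1≤ht^ {x} p = from-cone (PosAff⇒Σα^ p)
      where
      from-cone : ∃[ ms ] x ≡ Σα^ ms → 1ℚ ≤ ht^ x
      from-cone ([]     , e) = ⊥-elim (Real≢0 (PosAff⇒Real p) e)
      from-cone (i ∷ ms , e) = subst (1ℚ ≤_) (sym (trans (cong ht^ e) (ht^-Σα^ (i ∷ ms)))) (1≤ℕ→ℚ-suc (length ms))

    PosAff⇒¬NegAff : ∀ {x} → PosAff x → ¬ NegAff x
    PosAff⇒¬NegAff {x} p q = ≤-≡⊥ (ℚP.+-mono-≤ (PosAff⇒1≤ht^ p) (ℚP.≤-trans (ℚP.<⇒≤ 0<1) (PosAff⇒1≤ht^ q))) (begin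
      1ℚ + 0ℚ                     ≡⟨ ℚS.solve 1 (λ x → con 1ℚ :+ con 0ℚ := (x :+ con -1ℚ :* x) :+ con 1ℚ) refl (ht^ x) ⟩
      (ht^ x + -1ℚ * ht^ x) + 1ℚ  ≡⟨ cong (λ t → (ht^ x + t) + 1ℚ) (ht^-· -1ℚ x) ⟨
      (ht^ x + ht^ (neg^ x)) + 1ℚ ∎)

    neg^-invol : ∀ x → neg^ (neg^ x) ≡ x
    neg^-invol x = LA.solve 1 (λ x → -1ℚ LA.⊡ (-1ℚ LA.⊡ x) LA.⊜ x) refl x

    Real-± : ∀ {x} → Real x → PosAff x ⊎ NegAff x
    Real-± (j , ℤ.+ 0 , refl) = by-sign (Pos-or-negative j)
      where
      by-sign : Pos j ⊎ ∃[ k ] (Pos k × root k ≡ -1ℚ ·ᵥ root j) → PosAff (ι (root j)) ⊎ NegAff (ι (root j))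
      by-sign (inj₁ p)           = inj₁ (inj₁ (j , p , refl))
      by-sign (inj₂ (k , p , e)) = inj₂ (inj₁ (k , p , cong (_, (0ℚ , 0ℚ)) (sym e)))
    Real-± (j , ℤ.+ suc k , refl) = inj₁ (inj₂ (j , k , refl))
    Real-± (j , ℤ.-[1+ k ] , refl) = inj₂ (inj₂ (proj₁ (negate j) , k , cong₂ _,_ (sym (proj₂ (negate j))) (cong (_, 0ℚ) (begin
      -1ℚ * ℤ→ℚ ℤ.-[1+ k ]   ≡⟨ cong (-1ℚ *_) (ℤ→ℚ-neg (ℤ.+ suc k)) ⟩
      -1ℚ * - ℕ→ℚ (suc k)    ≡⟨ ℚS.solve 1 (λ x → con -1ℚ :* :- x := x) refl (ℕ→ℚ (suc k)) ⟩
      ℕ→ℚ (suc k)            ∎))))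

    -- Each summand has height at least one, while αᵢ has height one.
    α^-indecomposable : ∀ {i x y} → α^ i ≡ x +^ y → PosAff x → PosAff y → ⊥
    α^-indecomposable {i} {x} {y} e p q = ≤-≡⊥ (ℚP.+-mono-≤ (PosAff⇒1≤ht^ p) (PosAff⇒1≤ht^ q)) (begin
      1ℚ + 1ℚ                ≡⟨ cong (_+ 1ℚ) (trans (sym (ht^-α i)) (trans (cong ht^ e) (ht^-+ x y))) ⟩
      (ht^ x + ht^ y) + 1ℚ   ∎)

    PosAff-α^ : ∀ i → PosAff (α^ i)
    PosAff-α^ (suc i) = inj₁ (simple i , Pos-α i , refl)
    PosAff-α^ zero    = inj₂ (proj₁ (negate θ) , 0 ,
      cong (_, (1ℚ , 0ℚ)) (trans (LV.solve 1 (λ x → 𝕫 ⊞ -1ℚ ⊡ x ⊜ -1ℚ ⊡ x) refl (root θ)) (sym (proj₂ (negate θ)))))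

    -- Simple reflections and signs.

    module SimpleReflection (i : Fin (suc n)) where
      -- The resulting form counts the summands other than αᵢ in a sum of simple affine roots, a
      -- quantity that sᵢ preserves.
      off : Fin (suc n) → ℚ
      off j = ℕ→ℚ (1 ℕ.∸ kronecker i j)

      off-nonneg : ∀ ms → 0ℚ ≤ functional^ off (Σα^ ms)
      off-nonneg []       = ℚP.≤-reflexive (sym (functional^-0 off))
      off-nonneg (j ∷ ms) = subst (0ℚ ≤_)
        (sym (trans (functional^-+ off (α^ j) (Σα^ ms)) (cong (_+ functional^ off (Σα^ ms)) (functional^-α off j))))
        (ℚP.+-mono-≤ (ℕ→ℚ-nonneg (1 ℕ.∸ kronecker i j)) (off-nonneg ms))

      off-zero : ∀ ms → functional^ off (Σα^ ms) ≤ 0ℚ → Σα^ ms ≡ ℕ→ℚ (length ms) ·^ α^ i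
      off-zero []       _ = LA.solve 1 (λ a → LA.𝕫 LA.⊜ 0ℚ LA.⊡ a) refl (α^ i)
      off-zero (j ∷ ms) ≤0 = by-cases (i FinP.≟ j)
        where
        split : functional^ off (Σα^ (j ∷ ms)) ≡ off j + functional^ off (Σα^ ms)
        split = trans (functional^-+ off (α^ j) (Σα^ ms)) (cong (_+ functional^ off (Σα^ ms)) (functional^-α off j))
        by-cases : Dec (i ≡ j) → Σα^ (j ∷ ms) ≡ ℕ→ℚ (length (j ∷ ms)) ·^ α^ i
        by-cases (no i≢j) = ⊥-elim (≤-≡⊥ (ℚP.+-mono-≤ ≤0 (off-nonneg ms)) (begin
          functional^ off (Σα^ (j ∷ ms)) + 0ℚ
            ≡⟨ cong (_+ 0ℚ) (trans split (cong (λ k → ℕ→ℚ (1 ℕ.∸ k) + functional^ off (Σα^ ms)) (kronecker-≢ i≢j))) ⟩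
          (1ℚ + functional^ off (Σα^ ms)) + 0ℚ
            ≡⟨ ℚS.solve 1 (λ t → (con 1ℚ :+ t) :+ con 0ℚ := (con 0ℚ :+ t) :+ con 1ℚ) refl (functional^ off (Σα^ ms)) ⟩
          (0ℚ + functional^ off (Σα^ ms)) + 1ℚ ∎))
        by-cases (yes refl) = begin
          α^ i +^ Σα^ ms                                ≡⟨ cong (α^ i +^_) (off-zero ms
            (subst (_≤ 0ℚ) (trans split (trans (cong (λ k → ℕ→ℚ (1 ℕ.∸ k) + functional^ off (Σα^ ms)) (kronecker-refl i))
              (ℚP.+-identityˡ (functional^ off (Σα^ ms))))) ≤0)) ⟩
          α^ i +^ (ℕ→ℚ (length ms) ·^ α^ i)             ≡⟨ cong (_+^ (ℕ→ℚ (length ms) ·^ α^ i)) (A.1⊙ (α^ i)) ⟨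
          (1ℚ ·^ α^ i) +^ (ℕ→ℚ (length ms) ·^ α^ i)     ≡⟨ A.⊙-distʳ 1ℚ (ℕ→ℚ (length ms)) (α^ i) ⟨
          (1ℚ + ℕ→ℚ (length ms)) ·^ α^ i                ≡⟨ cong (_·^ α^ i) (ℕ→ℚ-suc (length ms)) ⟨
          ℕ→ℚ (length (i ∷ ms)) ·^ α^ i                 ∎

      -- Both finite parts are roots, and `reduced` admits only the factors 1 and -1 between
      -- proportional roots.
      proportional : ∀ {x} k → PosAff x → x ≡ ℕ→ℚ k ·^ α^ i → x ≡ α^ i
      proportional {x} k p e = from-real (PosAff⇒Real p) (α^-Real i)
        where
        from-real : Real x → Real (α^ i) → x ≡ α^ i
        from-real (j , z , f) (m , y , g) =
          Sum.[ (λ k≡1 → trans e (trans (cong (_·^ α^ i) k≡1) (A.1⊙ (α^ i))))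
              , (λ k≡-1 → ⊥-elim (≤-≡⊥ (ℕ→ℚ-nonneg k) (sym (cong (_+ 1ℚ) k≡-1)))) ]′
            (reduced m j (ℕ→ℚ k) (trans (sym (cong proj₁ f)) (trans (cong proj₁ e) (cong (λ a → ℕ→ℚ k ·ᵥ proj₁ a) g))))

      -- The form given by `off` is nonnegative on x and on -sᵢx, and its two values are opposite.
      -- So both vanish, x is a multiple of αᵢ, and reducedness leaves only αᵢ.
      reflection-PosAff : ∀ {x} → PosAff x → NegAff (refl^ (α^ i) x) → x ≡ α^ i
      reflection-PosAff {x} p q = from-cones (PosAff⇒Σα^ p) (PosAff⇒Σα^ q)
        where
        F = functional^ off
        c = - pair^ x (α^ i)
        off≤0 : ∀ {ms ns} → x ≡ Σα^ ms → neg^ (refl^ (α^ i) x) ≡ Σα^ ns → F (Σα^ ms) ≤ 0ℚ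
        off≤0 {ms} {ns} e f = subst₂ _≤_ (ℚP.+-identityʳ (F (Σα^ ms))) (begin
          F (Σα^ ms) + F (Σα^ ns)               ≡⟨ cong₂ (λ s t → F s + F t) e f ⟨
          F x + F (neg^ (refl^ (α^ i) x))       ≡⟨ cong (F x +_) (functional^-· off -1ℚ (refl^ (α^ i) x)) ⟩
          F x + -1ℚ * F (x +^ (c ·^ α^ i))      ≡⟨ cong (λ t → F x + -1ℚ * t) (trans (functional^-+ off x (c ·^ α^ i))
                                                     (cong (F x +_) (trans (functional^-· off c (α^ i)) (cong (c *_)
                                                       (trans (functional^-α off i) (cong (λ k → ℕ→ℚ (1 ℕ.∸ k)) (kronecker-refl i))))))) ⟩
          F x + -1ℚ * (F x + c * 0ℚ)            ≡⟨ ℚS.solve 2 (λ x c → x :+ con -1ℚ :* (x :+ c :* con 0ℚ) := con 0ℚ) refl (F x) c ⟩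
          0ℚ ∎) (ℚP.+-monoʳ-≤ (F (Σα^ ms)) (off-nonneg ns))
        from-cones : ∃[ ms ] x ≡ Σα^ ms → ∃[ ns ] neg^ (refl^ (α^ i) x) ≡ Σα^ ns → x ≡ α^ i
        from-cones (ms , e) (ns , f) = proportional (length ms) p (trans e (off-zero ms (off≤0 {ms} {ns} e f)))

    open SimpleReflection public using (reflection-PosAff)

    -- The roots δ - γ; decompositions of finite positive roots.

    δ- : Fin N → AV
    δ- γ = δ +^ neg^ (ι (root γ))

    δ-≡ : ∀ γ → δ- γ ≡ (-1ℚ ·ᵥ root γ , 1ℚ , 0ℚ)
    δ-≡ γ = cong (_, _) (QModule.⊕-idˡ (V-module n) (-1ℚ ·ᵥ root γ))

    PosAff-δ- : ∀ γ → PosAff (δ- γ)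
    PosAff-δ- γ = let k , e = negate γ in inj₂ (k , 0 , trans (δ-≡ γ) (cong (_, _) (sym e)))

    -1·-injective : ∀ {u v : V n} → -1ℚ ·ᵥ u ≡ -1ℚ ·ᵥ v → u ≡ v
    -1·-injective {u} {v} e = begin
      u                    ≡⟨ LV.solve 1 (λ u → u ⊜ -1ℚ ⊡ (-1ℚ ⊡ u)) refl u ⟩
      -1ℚ ·ᵥ (-1ℚ ·ᵥ u)    ≡⟨ cong (-1ℚ ·ᵥ_) e ⟩
      -1ℚ ·ᵥ (-1ℚ ·ᵥ v)    ≡⟨ LV.solve 1 (λ u → -1ℚ ⊡ (-1ℚ ⊡ u) ⊜ u) refl v ⟩
      v                    ∎

    δ--injective : ∀ {γ γ′} → δ- γ ≡ δ- γ′ → γ ≡ γ′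
    δ--injective {γ} {γ′} e = root-inj γ γ′ (-1·-injective (cong proj₁ (trans (sym (δ-≡ γ)) (trans e (δ-≡ γ′)))))

    act-injective : ∀ w {x y} → act w x ≡ act w y → x ≡ y
    act-injective w {x} {y} e = trans (sym (act-reverse w x)) (trans (cong (act (List.reverse w)) e) (act-reverse w y))

    PosAff⇒NegAff-neg : ∀ {x} → PosAff x → NegAff (neg^ x)
    PosAff⇒NegAff-neg {x} = subst PosAff (sym (neg^-invol x))

    act-neg : ∀ w x → act w (neg^ x) ≡ neg^ (act w x)
    act-neg w x = act-· w -1ℚ x

    opposite-Pos : ∀ {j k} → Pos j → Pos k → root j ≢ -1ℚ ·ᵥ root k
    opposite-Pos {j} {k} p q e = ≤-≡⊥ (ℚP.+-mono-≤ (Pos⇒1≤ht p) (ℚP.≤-trans (ℚP.<⇒≤ 0<1) (Pos⇒1≤ht q))) (begin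
      1ℚ + 0ℚ                               ≡⟨ ℚS.solve 1 (λ x → con 1ℚ :+ con 0ℚ := (con -1ℚ :* x :+ x) :+ con 1ℚ) refl (ht (root k)) ⟩
      (-1ℚ * ht (root k) + ht (root k)) + 1ℚ ≡⟨ cong (λ t → (t + ht (root k)) + 1ℚ) (trans (cong ht e) (ht-· -1ℚ (root k))) ⟨
      (ht (root j) + ht (root k)) + 1ℚ      ∎)

    α≢Pos+Pos : ∀ {i j k} → Pos j → Pos k → α i ≢ root j +ᵥ root k
    α≢Pos+Pos {i} {j} {k} p q e = ≤-≡⊥ (ℚP.+-mono-≤ (Pos⇒1≤ht p) (Pos⇒1≤ht q))
      (cong (_+ 1ℚ) (trans (sym (ht-α i)) (trans (cong ht e) (ht-+ (root j) (root k)))))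

    -- Were the difference β - αᵢ negative, αᵢ would be the sum of the positive roots β and αᵢ - β,
    -- against its height.
    sub-simple : ∀ {j} i → Pos j → ¬ IsSimple j → 0ℚ < ⟪ root j , α i ⟫ → ∃[ k ] (Pos k × root k ≡ root j -ᵥ α i)
    sub-simple {j} i p j-nonsimple 0<ji = from-root (sub-root j (simple i) 0<ji (λ e → j-nonsimple (i , root-inj (simple i) j (sym e))))
      where
      from-root : ∃[ k ] root k ≡ root j -ᵥ α i → ∃[ k ] (Pos k × root k ≡ root j -ᵥ α i)
      from-root (k , e) = by-sign (Pos-or-negative k)
        where
        by-sign : Pos k ⊎ ∃[ l ] (Pos l × root l ≡ -1ℚ ·ᵥ root k) → ∃[ k ] (Pos k × root k ≡ root j -ᵥ α i)
        by-sign (inj₁ pk) = k , pk , e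
        by-sign (inj₂ (l , pl , f)) = ⊥-elim (α≢Pos+Pos p pl (begin
          α i                                        ≡⟨ LV.solve 2 (λ x a → a ⊜ x ⊞ -1ℚ ⊡ (x ⊞ -1ℚ ⊡ a)) refl (root j) (α i) ⟩
          root j +ᵥ -1ℚ ·ᵥ (root j -ᵥ α i)           ≡⟨ cong (root j +ᵥ_) (trans f (cong (-1ℚ ·ᵥ_) e)) ⟨
          root j +ᵥ root l                           ∎))

    add-back : ∀ {u v w : V n} → u ≡ v -ᵥ w → v ≡ u +ᵥ w
    add-back {u} {v} {w} e = trans (LV.solve 2 (λ v w → v ⊜ (v ⊞ -1ℚ ⊡ w) ⊞ w) refl v w) (cong (_+ᵥ w) (sym e))

    -- (β, β) > 0 forces (αᵢ, β) > 0 for some simple summand αᵢ of β, and `sub-simple` removes it.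
    nonsimple-decomposable : ∀ {j} → Pos j → ¬ IsSimple j → ∃[ i ] ∃[ k ] (Pos k × root j ≡ root k +ᵥ α i)
    nonsimple-decomposable {j} p j-nonsimple = from-cone (Pos⇒Σα p)
      where
      from-simple : ∀ {i} → ∃[ k ] (Pos k × root k ≡ root j -ᵥ α i) → ∃[ i ] ∃[ k ] (Pos k × root j ≡ root k +ᵥ α i)
      from-simple {i} (k , pk , f) = i , k , pk , add-back {root k} {root j} {α i} f

      from-summand : ∀ {ms} → ∃[ xs ] ∃[ i ] ∃[ ys ] (ms ≡ xs ++ i ∷ ys × 0ℚ < ⟪ α i , root j ⟫) →
                     ∃[ i ] ∃[ k ] (Pos k × root j ≡ root k +ᵥ α i)
      from-summand (_ , i , _ , _ , 0<ij) = from-simple (sub-simple i p j-nonsimple (subst (0ℚ <_) (⟪⟫-comm (α i) (root j)) 0<ij))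

      from-cone : ∃[ ms ] root j ≡ Σα ms → ∃[ i ] ∃[ k ] (Pos k × root j ≡ root k +ᵥ α i)
      from-cone (ms , e) = from-summand (positive-summand ms (root j) (subst (λ v → 0ℚ < ⟪ v , root j ⟫) e (norm-pos j)))

    -- Signs under w, and the image of a newly added root.

    module _ (w : List (Fin (suc n))) (I : Subset N) (I-pos : ∀ γ → γ Sub.∈ I → Pos γ) (N≡I : N≡ w I) where

      ∈⇒NegAff : ∀ {γ} → γ Sub.∈ I → NegAff (act w (δ- γ))
      ∈⇒NegAff {γ} γ∈I = proj₂ (N≡I (δ- γ) (PosAff-δ- γ)) (γ , γ∈I , refl)

      ∉⇒PosAff : ∀ {γ} → γ Sub.∉ I → PosAff (act w (δ- γ))
      ∉⇒PosAff {γ} γ∉I = Sum.fromInj₁ negative (Real-± (act-Real w (PosAff⇒Real (PosAff-δ- γ))))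
        where
        negative : NegAff (act w (δ- γ)) → PosAff (act w (δ- γ))
        negative q = let γ′ , γ′∈I , e = proj₁ (N≡I (δ- γ) (PosAff-δ- γ)) q in
          ⊥-elim (γ∉I (subst (Sub._∈ I) (sym (δ--injective e)) γ′∈I))

      -- Members of N(w) have finite part -γ with γ ∈ I positive, so a positive finite part excludes
      -- an inversion.
      Pos-part⇒PosAff : ∀ {x p} → Pos p → proj₁ x ≡ root p → PosAff x → PosAff (act w x)
      Pos-part⇒PosAff {x} {p} pp e px = Sum.fromInj₁ negative (Real-± (act-Real w (PosAff⇒Real px)))
        where
        negative : NegAff (act w x) → PosAff (act w x)
        negative q = let γ , γ∈I , f = proj₁ (N≡I x px) q in
          ⊥-elim (opposite-Pos pp (I-pos γ γ∈I) (trans (sym e) (cong proj₁ (trans f (δ-≡ γ)))))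

      -- All inversions of w are at level one.
      2δ-part⇒PosAff : ∀ {x} → proj₁ (proj₂ x) ≡ 2ℚ → PosAff x → PosAff (act w x)
      2δ-part⇒PosAff {x} e px = Sum.fromInj₁ negative (Real-± (act-Real w (PosAff⇒Real px)))
        where
        negative : NegAff (act w x) → PosAff (act w x)
        negative q = let γ , γ∈I , f = proj₁ (N≡I x px) q in
          ⊥-elim (2≢1 (trans (sym e) (cong (proj₁ ∘ proj₂) f)))
          where
          2≢1 : 2ℚ ≢ 1ℚ
          2≢1 ()

      -- For pulling a decomposition back along w: a summand comes from a positive root or from some
      -- κ - δ with κ ∈ I, and the second case is left to the abelian condition.
      preimage-sign : ∀ {x} → Real x → PosAff (act w x) → PosAff x ⊎ ∃[ γ ] (γ Sub.∈ I × neg^ x ≡ δ- γ)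
      preimage-sign {x} r p = Sum.map₂ (λ q → proj₁ (N≡I (neg^ x) q) (subst NegAff (sym (act-neg w x)) (PosAff⇒NegAff-neg p))) (Real-± r)

      module _ (γ : Fin N) (γ-pos : Pos γ) (γ∉I : γ Sub.∉ I) (I′ : Subset N) (I′-abelian : IsAbelian I′)
               (I⊆I′ : I ⊆ I′) (γ∈I′ : γ Sub.∈ I′) (I′⊆I∪γ : ∀ {κ} → κ Sub.∈ I′ → κ ≡ γ ⊎ κ Sub.∈ I) where

        -- With x = κ - δ the other summand is 2δ - (γ + κ), so γ + κ is a positive root although γ
        -- and κ both lie in I′.
        sum-neg-impossible : ∀ {x y} → Real y → δ- γ ≡ x +^ y → ∃[ κ ] (κ Sub.∈ I × neg^ x ≡ δ- κ) → ⊥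
        sum-neg-impossible {x} {y} (j , z , f) e (κ , κ∈I , g) =
          let k , h = negate j
              k≡γ+κ = begin
                root k                                       ≡⟨ trans h (cong (-1ℚ ·ᵥ_) (sym (cong proj₁ f))) ⟩
                -1ℚ ·ᵥ proj₁ y                               ≡⟨ LV.solve 2 (λ x y → -1ℚ ⊡ y ⊜ -1ℚ ⊡ (x ⊞ y) ⊞ -1ℚ ⊡ (-1ℚ ⊡ x)) refl (proj₁ x) (proj₁ y) ⟩
                -1ℚ ·ᵥ (proj₁ x +ᵥ proj₁ y) +ᵥ -1ℚ ·ᵥ (-1ℚ ·ᵥ proj₁ x)
                  ≡⟨ cong₂ (λ s t → -1ℚ ·ᵥ s +ᵥ -1ℚ ·ᵥ t) (cong proj₁ (trans (sym e) (δ-≡ γ))) (cong proj₁ (trans g (δ-≡ κ))) ⟩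
                -1ℚ ·ᵥ (-1ℚ ·ᵥ root γ) +ᵥ -1ℚ ·ᵥ (-1ℚ ·ᵥ root κ)
                  ≡⟨ LV.solve 2 (λ x y → -1ℚ ⊡ (-1ℚ ⊡ x) ⊞ -1ℚ ⊡ (-1ℚ ⊡ y) ⊜ x ⊞ y) refl (root γ) (root κ) ⟩
                root γ +ᵥ root κ                             ∎
          in proj₂ I′-abelian γ κ γ∈I′ (I⊆I′ κ∈I) (k , Pos-+ γ-pos (I-pos κ κ∈I) k≡γ+κ , k≡γ+κ)

        -- If x is a positive root β, then y = δ - (γ + β). The root γ + β lies above γ, hence in
        -- I′, and differs from γ, hence lies in I; so w makes y negative.
        sum-finite-impossible : ∀ {x y} → δ- γ ≡ x +^ y → ∃[ j ] (Pos j × x ≡ ι (root j)) → Real y → PosAff (act w y) → ⊥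
        sum-finite-impossible {_} {y} e (j , pj , refl) (j′ , z , f) p =
          let κ , h = negate j′
              κ≡γ+j = begin
                root κ                       ≡⟨ trans h (cong (-1ℚ ·ᵥ_) (sym (cong proj₁ f))) ⟩
                -1ℚ ·ᵥ proj₁ y               ≡⟨ LV.solve 2 (λ x y → -1ℚ ⊡ y ⊜ -1ℚ ⊡ (x ⊞ y) ⊞ x) refl (root j) (proj₁ y) ⟩
                -1ℚ ·ᵥ (root j +ᵥ proj₁ y) +ᵥ root j ≡⟨ cong (λ s → -1ℚ ·ᵥ s +ᵥ root j) (cong proj₁ (trans (sym e) (δ-≡ γ))) ⟩
                -1ℚ ·ᵥ (-1ℚ ·ᵥ root γ) +ᵥ root j ≡⟨ LV.solve 2 (λ g x → -1ℚ ⊡ (-1ℚ ⊡ g) ⊞ x ⊜ g ⊞ x) refl (root γ) (root j) ⟩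
                root γ +ᵥ root j             ∎
              κ-pos = Pos-+ γ-pos pj κ≡γ+j
              κ∈I′ = proj₂ (proj₁ I′-abelian) γ κ γ∈I′ κ-pos (sum⇒≼ γ-pos pj κ≡γ+j)
              y≡δ-κ = begin
                y                                   ≡⟨ cong₂ _,_ (trans (LV.solve 1 (λ y → y ⊜ -1ℚ ⊡ (-1ℚ ⊡ y)) refl (proj₁ y))
                                                        (cong (-1ℚ ·ᵥ_) (trans (cong (-1ℚ ·ᵥ_) (cong proj₁ f)) (sym h))))
                                                       (cong₂ _,_ (trans (sym (ℚP.+-identityˡ (proj₁ (proj₂ y)))) (sym (cong (proj₁ ∘ proj₂) e)))
                                                                  (cong (proj₂ ∘ proj₂) f)) ⟩
                (-1ℚ ·ᵥ root κ , 1ℚ , 0ℚ)           ≡⟨ δ-≡ κ ⟨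
                δ- κ                                ∎
          in Sum.[ (λ κ≡γ → γ≢γ+j (trans (cong root (sym κ≡γ)) κ≡γ+j))
                 , (λ κ∈I → PosAff⇒¬NegAff p (subst (NegAff ∘ act w) (sym y≡δ-κ) (∈⇒NegAff κ∈I))) ] (I′⊆I∪γ κ∈I′)
          where
          γ≢γ+j : root γ ≢ root γ +ᵥ root j
          γ≢γ+j e = root≢0 j (begin
            root j                             ≡⟨ LV.solve 2 (λ g x → x ⊜ (g ⊞ x) ⊞ -1ℚ ⊡ g) refl (root γ) (root j) ⟩
            (root γ +ᵥ root j) -ᵥ root γ       ≡⟨ cong (_-ᵥ root γ) e ⟨
            root γ -ᵥ root γ                   ≡⟨ LV.solve 1 (λ g → g ⊞ -1ℚ ⊡ g ⊜ 𝕫) refl (root γ) ⟩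
            0ᵥ                                 ∎)

        sum-impossible : ∀ {x y} → Real x → Real y → PosAff (act w x) → PosAff (act w y) → δ- γ ≡ x +^ y → ⊥
        sum-impossible {x} {y} rx ry p q e = by-sign (preimage-sign rx p) (preimage-sign ry q)
          where
          e′ : δ- γ ≡ y +^ x
          e′ = trans e (A.⊕-comm x y)
          by-sign : PosAff x ⊎ ∃[ κ ] (κ Sub.∈ I × neg^ x ≡ δ- κ) → PosAff y ⊎ ∃[ κ ] (κ Sub.∈ I × neg^ y ≡ δ- κ) → ⊥
          by-sign (inj₂ k) _ = sum-neg-impossible {x} {y} ry e k
          by-sign _ (inj₂ k) = sum-neg-impossible {y} {x} rx e′ k
          by-sign (inj₁ (inj₁ f)) _ = sum-finite-impossible {x} {y} e f ry q
          by-sign _ (inj₁ (inj₁ f)) = sum-finite-impossible {y} {x} e′ f rx p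
          -- Two summands at level at least one cannot add up to level one.
          by-sign (inj₁ (inj₂ (_ , k , f))) (inj₁ (inj₂ (_ , l , g))) =
            ≤-≡⊥ (ℚP.+-mono-≤ (1≤ℕ→ℚ-suc k) (1≤ℕ→ℚ-suc l)) (cong (_+ 1ℚ) δ-coefficient)
            where
            δ-coefficient : 1ℚ ≡ ℕ→ℚ (suc k) + ℕ→ℚ (suc l)
            δ-coefficient = trans (cong (proj₁ ∘ proj₂) e) (cong₂ _+_ (cong (proj₁ ∘ proj₂) f) (cong (proj₁ ∘ proj₂) g))

        image-sum-impossible : ∀ {x y} → PosAff x → PosAff y → act w (δ- γ) ≡ x +^ y → ⊥
        image-sum-impossible {x} {y} p q e = sum-impossible {act (List.reverse w) x} {act (List.reverse w) y}
          (act-Real (List.reverse w) (PosAff⇒Real p)) (act-Real (List.reverse w) (PosAff⇒Real q))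
          (subst PosAff (sym (reverse-act w x)) p) (subst PosAff (sym (reverse-act w y)) q)
          (begin
            δ- γ                                                          ≡⟨ act-reverse w (δ- γ) ⟨
            act (List.reverse w) (act w (δ- γ))                           ≡⟨ cong (act (List.reverse w)) e ⟩
            act (List.reverse w) (x +^ y)                                 ≡⟨ act-+ (List.reverse w) x y ⟩
            act (List.reverse w) x +^ act (List.reverse w) y              ∎)

        -- Since w fixes δ, x would be -w(γ), which is negative as γ is a positive finite root.
        -- Because δ is not a real root, this is no instance of `image-sum-impossible`.
        image-shift-impossible : ∀ {x} → PosAff x → act w (δ- γ) ≡ x +^ δ → ⊥
        image-shift-impossible {x} p e = PosAff⇒¬NegAff
          (Pos-part⇒PosAff γ-pos refl (inj₁ (γ , γ-pos , refl)))
          (subst PosAff (begin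
            x                                                    ≡⟨ LA.solve 2 (λ x d → x LA.⊜ (x LA.⊞ d) LA.⊞ -1ℚ LA.⊡ d) refl x δ ⟩
            (x +^ δ) +^ neg^ δ                                   ≡⟨ cong₂ (λ s t → s +^ neg^ t) (sym e) (sym (act-δ w)) ⟩
            act w (δ- γ) +^ neg^ (act w δ)                       ≡⟨ cong₂ _+^_ (act-+ w δ (neg^ (ι (root γ)))) refl ⟩
            (act w δ +^ act w (neg^ (ι (root γ)))) +^ neg^ (act w δ)
              ≡⟨ LA.solve 2 (λ d y → (d LA.⊞ y) LA.⊞ -1ℚ LA.⊡ d LA.⊜ y) refl (act w δ) (act w (neg^ (ι (root γ)))) ⟩
            act w (neg^ (ι (root γ)))                            ≡⟨ act-neg w (ι (root γ)) ⟩
            neg^ (act w (ι (root γ)))                            ∎) p)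

        -- A positive affine root that is not simple splits off a simple root or δ. At level zero
        -- this is `nonsimple-decomposable`. At level two or more, or at level one with positive
        -- finite part, δ splits off. At level one with finite part -k, either k = θ, which gives
        -- α₀, or k ⋖ κ and δ - k = (δ - κ) + αᵢ.
        image-simple : ∃[ i ] act w (δ- γ) ≡ α^ i
        image-simple = by-shape (∉⇒PosAff γ∉I)
          where
          y = act w (δ- γ)
          to-θ : ∀ {j k} → y ≡ (root j , 1ℚ , 0ℚ) → root k ≡ -1ℚ ·ᵥ root j → k ≼ θ → ∃[ i ] y ≡ α^ i
          to-θ {j} {k} e f ε = zero , trans e (trans (cong (_, _) (begin
            root j               ≡⟨ LV.solve 1 (λ x → x ⊜ -1ℚ ⊡ (-1ℚ ⊡ x)) refl (root j) ⟩
            -1ℚ ·ᵥ (-1ℚ ·ᵥ root j) ≡⟨ cong (-1ℚ ·ᵥ_) f ⟨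
            -1ℚ ·ᵥ root θ        ∎)) (sym (δ-≡ θ)))
          to-θ {j} {k} e f (_◅_ {j = κ} (i , g) _) = ⊥-elim (image-sum-impossible (PosAff-δ- κ) (PosAff-α^ (suc i)) (begin
            y                               ≡⟨ e ⟩
            (root j , 1ℚ , 0ℚ)              ≡⟨ cong (_, _) (begin
              root j                                       ≡⟨ LV.solve 2 (λ x a → x ⊜ -1ℚ ⊡ (-1ℚ ⊡ x ⊞ a) ⊞ a) refl (root j) (α i) ⟩
              -1ℚ ·ᵥ (-1ℚ ·ᵥ root j +ᵥ α i) +ᵥ α i         ≡⟨ cong (λ v → -1ℚ ·ᵥ v +ᵥ α i) (trans g (cong (_+ᵥ α i) f)) ⟨
              -1ℚ ·ᵥ root κ +ᵥ α i                         ∎) ⟩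
            (-1ℚ ·ᵥ root κ , 1ℚ , 0ℚ) +^ ι (α i) ≡⟨ cong (_+^ ι (α i)) (δ-≡ κ) ⟨
            δ- κ +^ ι (α i)                 ∎))

          shift : ∀ {v} k → y ≡ (v , ℕ→ℚ (suc k) , 0ℚ) → y ≡ (v , ℕ→ℚ k , 0ℚ) +^ δ
          shift {v} k e = trans e (cong₂ _,_ (LV.solve 1 (λ v → v ⊜ v ⊞ 𝕫) refl v)
            (cong (_, 0ℚ) (trans (ℕ→ℚ-suc k) (ℚP.+-comm 1ℚ (ℕ→ℚ k)))))

          by-shape : PosAff y → ∃[ i ] y ≡ α^ i
          by-shape (inj₁ (j , p , e)) = by-simple (FinP.any? (λ i → simple i FinP.≟ j))
            where
            by-simple : Dec (IsSimple j) → ∃[ i ] y ≡ α^ i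
            by-simple (yes (i , refl)) = suc i , e
            by-simple (no j-nonsimple) = let i , k , pk , f = nonsimple-decomposable p j-nonsimple in
              ⊥-elim (image-sum-impossible (inj₁ (k , pk , refl)) (PosAff-α^ (suc i)) (trans e (cong ι f)))
          by-shape (inj₂ (j , suc k , e)) = ⊥-elim (image-shift-impossible (inj₂ (j , k , refl)) (shift (suc k) e))
          by-shape (inj₂ (j , zero , e)) = Sum.[ (λ p → ⊥-elim (image-shift-impossible (inj₁ (j , p , refl)) (shift 0 e)))
                                               , (λ (k , pk , f) → to-θ e f (proj₂ θ-highest k pk)) ] (Pos-or-negative j)

    -- Adding one root to an abelian ideal.

    move-summand : ∀ x y z → x ≡ y +^ z → y ≡ x +^ neg^ z
    move-summand x y z e = trans (LA.solve 2 (λ y z → y LA.⊜ (y LA.⊞ z) LA.⊞ -1ℚ LA.⊡ z) refl y z) (cong (_+^ neg^ z) (sym e))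

    insert-upper : ∀ {I γ} → IsUpperIdeal I → Pos γ → (∀ κ → γ ⋖ κ → κ Sub.∈ I) → IsUpperIdeal (I ∪ ⁅ γ ⁆)
    insert-upper {I} {γ} (I-pos , I-upper) γ-pos covers =
      (λ κ κ∈ → Sum.[ (λ κ≡γ → subst Pos (sym κ≡γ) γ-pos) , I-pos κ ] (∈-insert⁻ κ∈)) ,
      (λ κ κ′ κ∈ κ′-pos κ≼κ′ → Sum.[ (λ { refl → above κ′-pos κ≼κ′ }) , (λ κ∈I → ⊆-insert (I-upper κ κ′ κ∈I κ′-pos κ≼κ′)) ] (∈-insert⁻ κ∈))
      where
      above : ∀ {κ′} → Pos κ′ → γ ≼ κ′ → κ′ Sub.∈ I ∪ ⁅ γ ⁆
      above _ ε = ∈-insert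
      above {κ′} p (_◅_ {j = κ} c κ≼κ′) = ⊆-insert (I-upper κ κ′ (covers κ c) p κ≼κ′)

    insert-abelian⇒covers : ∀ {I γ} → IsAbelian I → IsAbelian (I ∪ ⁅ γ ⁆) → γ Sub.∉ I → AbCovers I (I ∪ ⁅ γ ⁆)
    insert-abelian⇒covers {I} {γ} a a′ γ∉I = a , a′ , (⊆-insert , λ e → γ∉I (subst (γ Sub.∈_) (sym e) ∈-insert)) , between
      where
      between : ∀ J → IsAbelian J → I ⊂ J → ¬ (J ⊂ (I ∪ ⁅ γ ⁆))
      between J _ (I⊆J , I≢J) (J⊆ , J≢) = by-membership (γ SubP.∈? J)
        where
        by-membership : Dec (γ Sub.∈ J) → ⊥
        by-membership (yes γ∈J) = J≢ (SubP.⊆-antisym J⊆ (insert-⊆ I⊆J γ∈J))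
        by-membership (no γ∉J)  = I≢J (SubP.⊆-antisym I⊆J (λ κ∈J →
          Sum.[ (λ κ≡γ → ⊥-elim (γ∉J (subst (Sub._∈ J) κ≡γ κ∈J))) , id ] (∈-insert⁻ (J⊆ κ∈J))))

    -- Climbs along covers that lie outside I but stay in I′. The number k bounds the height still
    -- available below θ, so the climb ends.
    maximal-new : ∀ k {I I′ γ} → IsUpperIdeal I′ → γ Sub.∈ I′ → γ Sub.∉ I → ht (root θ) ≤ ht (root γ) + ℕ→ℚ k →
      ∃[ κ ] (κ Sub.∈ I′ × κ Sub.∉ I × (∀ κ′ → κ ⋖ κ′ → κ′ Sub.∈ I))
    maximal-new k {I} {I′} {γ} up γ∈I′ γ∉I bound = climb k bound (FinP.any? (λ κ → new-cover? κ))
      where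
      new-cover? : ∀ κ → Dec (γ ⋖ κ × κ Sub.∉ I)
      new-cover? κ = FinP.any? (λ i → VecP.≡-dec ℚP._≟_ (root κ) (root γ +ᵥ α i)) ×-dec ¬? (κ SubP.∈? I)
      climb : ∀ k → ht (root θ) ≤ ht (root γ) + ℕ→ℚ k → Dec (∃[ κ ] (γ ⋖ κ × κ Sub.∉ I)) →
              ∃[ κ ] (κ Sub.∈ I′ × κ Sub.∉ I × (∀ κ′ → κ ⋖ κ′ → κ′ Sub.∈ I))
      climb _ _ (no none) = γ , γ∈I′ , γ∉I , λ κ c → decidable-stable (κ SubP.∈? I) (λ κ∉I → none (κ , c , κ∉I))
      climb k b (yes (κ , c@(i , e) , κ∉I)) = next k b
        where
        κ-pos = ⋖-Pos (proj₁ up γ γ∈I′) c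
        htκ : ht (root κ) ≡ ht (root γ) + 1ℚ
        htκ = trans (cong ht e) (trans (ht-+ (root γ) (α i)) (cong (ht (root γ) +_) (ht-α i)))
        next : ∀ k → ht (root θ) ≤ ht (root γ) + ℕ→ℚ k → ∃[ κ ] (κ Sub.∈ I′ × κ Sub.∉ I × (∀ κ′ → κ ⋖ κ′ → κ′ Sub.∈ I))
        next zero    b = ⊥-elim (≤-≡⊥ (ℚP.≤-trans (ht≤htθ κ-pos) b) (trans htκ (cong (_+ 1ℚ) (sym (ℚP.+-identityʳ (ht (root γ)))))))
        next (suc k) b = maximal-new k up (proj₂ up γ κ γ∈I′ κ-pos (c ◅ ε)) κ∉I (subst (ht (root θ) ≤_) (begin
          ht (root γ) + ℕ→ℚ (suc k)    ≡⟨ cong (ht (root γ) +_) (ℕ→ℚ-suc k) ⟩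
          ht (root γ) + (1ℚ + ℕ→ℚ k)   ≡⟨ ℚP.+-assoc (ht (root γ)) 1ℚ (ℕ→ℚ k) ⟨
          (ht (root γ) + 1ℚ) + ℕ→ℚ k   ≡⟨ cong (_+ ℕ→ℚ k) htκ ⟨
          ht (root κ) + ℕ→ℚ k          ∎) b)

    -- Take γ in I′ but not in I, with all its covers in I. Then I ∪ {γ} is an upper ideal, and it
    -- is abelian as a subset of I′. No abelian ideal lies strictly between I and I′, so it equals
    -- I′; decidability of equality of subsets keeps this constructive.
    covers⇒insert : ∀ {I I′} → AbCovers I I′ → ∃[ γ ] (γ Sub.∉ I × Pos γ × I′ ≡ I ∪ ⁅ γ ⁆)
    covers⇒insert {I} {I′} (I-ab , I′-ab , (I⊆I′ , I≢I′) , between) = from-new (FinP.any? (λ κ → (κ SubP.∈? I′) ×-dec ¬? (κ SubP.∈? I)))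
      where
      from-maximal : ∃[ γ ] (γ Sub.∈ I′ × γ Sub.∉ I × (∀ κ → γ ⋖ κ → κ Sub.∈ I)) → ∃[ γ ] (γ Sub.∉ I × Pos γ × I′ ≡ I ∪ ⁅ γ ⁆)
      from-maximal (γ , γ∈I′ , γ∉I , maximal) = γ , γ∉I , γ-pos ,
        decidable-stable (VecP.≡-dec BoolP._≟_ I′ (I ∪ ⁅ γ ⁆)) (λ I′≢J → between (I ∪ ⁅ γ ⁆) J-abelian
          (⊆-insert , λ e → γ∉I (subst (γ Sub.∈_) (sym e) ∈-insert)) (J⊆I′ , λ e → I′≢J (sym e)))
        where
        γ-pos = proj₁ (proj₁ I′-ab) γ γ∈I′
        J⊆I′ = insert-⊆ I⊆I′ γ∈I′
        J-abelian : IsAbelian (I ∪ ⁅ γ ⁆)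
        J-abelian = insert-upper (proj₁ I-ab) γ-pos maximal , λ κ κ′ κ∈ κ′∈ → proj₂ I′-ab κ κ′ (J⊆I′ κ∈) (J⊆I′ κ′∈)

      from-new : Dec (∃[ κ ] (κ Sub.∈ I′ × κ Sub.∉ I)) → ∃[ γ ] (γ Sub.∉ I × Pos γ × I′ ≡ I ∪ ⁅ γ ⁆)
      from-new (no none) = ⊥-elim (I≢I′ (SubP.⊆-antisym I⊆I′ (λ {κ} κ∈I′ → decidable-stable (κ SubP.∈? I) (λ κ∉I → none (κ , κ∈I′ , κ∉I)))))
      from-new (yes (κ , κ∈I′ , κ∉I)) =
        let ms , e = ≼⇒difference-cone (proj₂ θ-highest κ (proj₁ (proj₁ I′-ab) κ κ∈I′))
        in from-maximal (maximal-new (length ms) (proj₁ I′-ab) κ∈I′ κ∉I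
             (ℚP.≤-reflexive (trans (cong ht e) (trans (ht-+ (root κ) (Σα ms)) (cong (ht (root κ) +_) (ht-Σα ms))))))

    -- Passing from I and w to I ∪ {γ} and sᵢw.

    module Extension (w : List (Fin (suc n))) (I : Subset N) (I-abelian : IsAbelian I) (N≡I : N≡ w I) where
      I-pos : ∀ γ → γ Sub.∈ I → Pos γ
      I-pos = proj₁ (proj₁ I-abelian)

      covers⇒image-simple : ∀ {I′} → AbCovers I I′ → ∃[ γ ] (γ Sub.∉ I × Pos γ × I′ ≡ I ∪ ⁅ γ ⁆ × ∃[ i ] act w (δ- γ) ≡ α^ i)
      covers⇒image-simple {I′} c@(_ , I′-ab , _) = from-insert (covers⇒insert c)
        where
        from-insert : ∃[ γ ] (γ Sub.∉ I × Pos γ × I′ ≡ I ∪ ⁅ γ ⁆) → ∃[ γ ] (γ Sub.∉ I × Pos γ × I′ ≡ I ∪ ⁅ γ ⁆ × ∃[ i ] act w (δ- γ) ≡ α^ i)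
        from-insert (γ , γ∉I , γ-pos , refl) = γ , γ∉I , γ-pos , refl ,
          image-simple w I I-pos N≡I γ γ-pos γ∉I (I ∪ ⁅ γ ⁆) I′-ab ⊆-insert ∈-insert ∈-insert⁻

      module Simple (γ : Fin N) (γ-pos : Pos γ) (i : Fin (suc n)) (image : act w (δ- γ) ≡ α^ i) where

        γ∉I : γ Sub.∉ I
        γ∉I γ∈I = PosAff⇒¬NegAff (PosAff-α^ i) (subst NegAff image (∈⇒NegAff w I I-pos N≡I γ∈I))

        -- If κ = γ + αⱼ were outside I, then αᵢ = w(δ - κ) + w(αⱼ) would be a sum of two positive
        -- roots.
        covers-in : ∀ κ → γ ⋖ κ → κ Sub.∈ I
        covers-in κ (j , e) = decidable-stable (κ SubP.∈? I) (λ κ∉I → α^-indecomposable {i} {act w (δ- κ)} {act w (ι (α j))} (begin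
          α^ i                                ≡⟨ image ⟨
          act w (δ- γ)                        ≡⟨ cong (act w) (begin
            δ- γ                                    ≡⟨ δ-≡ γ ⟩
            (-1ℚ ·ᵥ root γ , 1ℚ , 0ℚ)               ≡⟨ cong (_, _) (LV.solve 2 (λ g a → -1ℚ ⊡ g ⊜ -1ℚ ⊡ (g ⊞ a) ⊞ a) refl (root γ) (α j)) ⟩
            (-1ℚ ·ᵥ (root γ +ᵥ α j) +ᵥ α j , 1ℚ , 0ℚ) ≡⟨ cong (λ v → (-1ℚ ·ᵥ v +ᵥ α j , 1ℚ , 0ℚ)) e ⟨
            (-1ℚ ·ᵥ root κ , 1ℚ , 0ℚ) +^ ι (α j)    ≡⟨ cong (_+^ ι (α j)) (δ-≡ κ) ⟨
            δ- κ +^ ι (α j)                         ∎) ⟩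
          act w (δ- κ +^ ι (α j))             ≡⟨ act-+ w (δ- κ) (ι (α j)) ⟩
          act w (δ- κ) +^ act w (ι (α j))     ∎)
          (∉⇒PosAff w I I-pos N≡I κ∉I)
          (Pos-part⇒PosAff w I I-pos N≡I (Pos-α j) refl (PosAff-α^ (suc j))))

        -- If γ + κ were a root, 2δ - (γ + κ) would stay positive under w, being at level two, while
        -- -w(δ - κ) is positive because κ ∈ I. These images add up to w(δ - γ) = αᵢ, which is
        -- indecomposable.
        sum-not-root : ∀ {κ} → κ Sub.∈ I → ¬ (∃[ k ] (Pos k × root k ≡ root γ +ᵥ root κ))
        sum-not-root {κ} κ∈I (k , pk , e) = from-negative (negate k)
          where
          from-negative : ∃[ l ] root l ≡ -1ℚ ·ᵥ root k → ⊥
          from-negative (l , f) = α^-indecomposable {i} {act w x} {neg^ (act w (δ- κ))} image-sum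
            (2δ-part⇒PosAff w I I-pos N≡I {x} refl (inj₂ (l , 1 , refl)))
            (∈⇒NegAff w I I-pos N≡I κ∈I)
            where
            x : AV
            x = (root l , 2ℚ , 0ℚ)
            x≡ : x ≡ δ- γ +^ δ- κ
            x≡ = begin
              (root l , 2ℚ , 0ℚ)                          ≡⟨ cong (_, (2ℚ , 0ℚ)) (trans f (cong (-1ℚ ·ᵥ_) e)) ⟩
              (-1ℚ ·ᵥ (root γ +ᵥ root κ) , 2ℚ , 0ℚ)       ≡⟨ cong (_, (2ℚ , 0ℚ)) (QModule.⊙-distˡ (V-module n) -1ℚ (root γ) (root κ)) ⟩
              (-1ℚ ·ᵥ root γ , 1ℚ , 0ℚ) +^ (-1ℚ ·ᵥ root κ , 1ℚ , 0ℚ) ≡⟨ cong₂ _+^_ (δ-≡ γ) (δ-≡ κ) ⟨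
              δ- γ +^ δ- κ                                ∎
            γ-sum : δ- γ ≡ x +^ neg^ (δ- κ)
            γ-sum = move-summand x (δ- γ) (δ- κ) x≡
            image-sum : α^ i ≡ act w x +^ neg^ (act w (δ- κ))
            image-sum = begin
              α^ i                            ≡⟨ image ⟨
              act w (δ- γ)                    ≡⟨ cong (act w) γ-sum ⟩
              act w (x +^ neg^ (δ- κ))        ≡⟨ act-+ w x (neg^ (δ- κ)) ⟩
              act w x +^ act w (neg^ (δ- κ))  ≡⟨ cong (act w x +^_) (act-neg w (δ- κ)) ⟩
              act w x +^ neg^ (act w (δ- κ))  ∎

        double-not-root : ¬ (∃[ k ] (Pos k × root k ≡ root γ +ᵥ root γ))
        double-not-root (k , _ , e) = Sum.[ (λ ()) , (λ ()) ]
          (reduced γ k 2ℚ (trans e (LV.solve 1 (λ g → g ⊞ g ⊜ 2ℚ ⊡ g) refl (root γ))))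

        insert-abelian : IsAbelian (I ∪ ⁅ γ ⁆)
        insert-abelian = insert-upper (proj₁ I-abelian) γ-pos covers-in ,
          λ κ κ′ κ∈ κ′∈ → by-membership (∈-insert⁻ κ∈) (∈-insert⁻ κ′∈)
          where
          by-membership : ∀ {κ κ′} → κ ≡ γ ⊎ κ Sub.∈ I → κ′ ≡ γ ⊎ κ′ Sub.∈ I → ¬ (∃[ k ] (Pos k × root k ≡ root κ +ᵥ root κ′))
          by-membership (inj₁ refl) (inj₁ refl) = double-not-root
          by-membership (inj₁ refl) (inj₂ κ′∈I) = sum-not-root κ′∈I
          by-membership {κ} {κ′} (inj₂ κ∈I) (inj₁ refl) (k , pk , e) =
            sum-not-root κ∈I (k , pk , trans e (QModule.⊕-comm (V-module n) (root κ) (root κ′)))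
          by-membership {κ} {κ′} (inj₂ κ∈I) (inj₂ κ′∈I) = proj₂ I-abelian κ κ′ κ∈I κ′∈I

        refl^-α : refl^ (α^ i) (α^ i) ≡ neg^ (α^ i)
        refl^-α = trans (cong (λ c → α^ i +^ ((- c) ·^ α^ i)) (Nonisotropic.pair^-self (α^ i) (α^-nonisotropic i)))
          (LA.solve 1 (λ a → a LA.⊞ (- 2ℚ) LA.⊡ a LA.⊜ -1ℚ LA.⊡ a) refl (α^ i))

        -- Among real roots sᵢ changes the sign only of ±αᵢ, so replacing w by sᵢw affects only ±(δ
        -- - γ), and δ - γ joins the inversions.
        N≡-insert : N≡ (i ∷ w) (I ∪ ⁅ γ ⁆)
        N≡-insert x px = forward , backward
          where
          y = act w x
          y-Real : Real y
          y-Real = act-Real w (PosAff⇒Real px)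
          forward : NegAff (refl^ (α^ i) y) → ∃[ κ ] (κ Sub.∈ I ∪ ⁅ γ ⁆ × x ≡ δ- κ)
          forward q = Sum.[ (λ p → γ , ∈-insert , act-injective w (trans (reflection-PosAff i p q) (sym image)))
                          , (λ ny → let κ , κ∈I , e = proj₁ (N≡I x px) ny in κ , ⊆-insert κ∈I , e) ] (Real-± y-Real)
          backward : ∃[ κ ] (κ Sub.∈ I ∪ ⁅ γ ⁆ × x ≡ δ- κ) → NegAff (refl^ (α^ i) y)
          backward (κ , κ∈ , e) = Sum.[ at-γ , in-I ] (∈-insert⁻ κ∈)
            where
            at-γ : κ ≡ γ → NegAff (refl^ (α^ i) y)
            at-γ refl = subst NegAff (sym (trans (cong (refl^ (α^ i)) (trans (cong (act w) e) image)) refl^-α)) (PosAff⇒NegAff-neg (PosAff-α^ i))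
            in-I : κ Sub.∈ I → NegAff (refl^ (α^ i) y)
            in-I κ∈I = Sum.fromInj₂ absurd (Real-± (Real-refl^ (α^-Real i) y-Real))
              where
              ny : NegAff y
              ny = proj₂ (N≡I x px) (κ , κ∈I , e)
              absurd : PosAff (refl^ (α^ i) y) → NegAff (refl^ (α^ i) y)
              -- Here sᵢ would turn the negative root y = w(δ - κ) positive, so -y = αᵢ and κ - δ =
              -- δ - γ, whose levels are -1 and 1.
              absurd p = ⊥-elim (-1≢1 (cong (proj₁ ∘ proj₂) (act-injective w (begin
                act w (neg^ (δ- κ))    ≡⟨ act-neg w (δ- κ) ⟩
                neg^ (act w (δ- κ))    ≡⟨ cong (neg^ ∘ act w) e ⟨
                neg^ y                 ≡⟨ reflection-PosAff i ny (subst NegAff (sym (refl^-· (α^ i) -1ℚ y)) (PosAff⇒NegAff-neg p)) ⟩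
                α^ i                   ≡⟨ image ⟨
                act w (δ- γ)           ∎))))
                where
                -1≢1 : -1ℚ ≢ 1ℚ
                -1≢1 ()

    -- The root 2δ - θ; comparison of words with the same inversions.

    2δ-θ : AV
    2δ-θ = (2ℚ ·^ δ) +^ neg^ (ι (root θ))

    2δ-θ-≡ : 2δ-θ ≡ (-1ℚ ·ᵥ root θ , 2ℚ , 0ℚ)
    2δ-θ-≡ = cong (_, _) (LV.solve 1 (λ t → 2ℚ ⊡ 𝕫 ⊞ -1ℚ ⊡ t ⊜ -1ℚ ⊡ t) refl (root θ))

    -- If θ - γ were negative, γ would exceed θ in height.
    sub-θ-Pos : ∀ {γ p} → Pos γ → root p ≡ root θ -ᵥ root γ → Pos p
    sub-θ-Pos {γ} {p} γ-pos e = Sum.fromInj₁ negative (Pos-or-negative p)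
      where
      negative : ∃[ k ] (Pos k × root k ≡ -1ℚ ·ᵥ root p) → Pos p
      negative (k , k-pos , f) = ⊥-elim (≤-≡⊥
        (ℚP.≤-trans (ℚP.+-monoʳ-≤ (ht (root θ)) (Pos⇒1≤ht k-pos)) (subst (_≤ ht (root θ)) htγ (ht≤htθ γ-pos))) refl)
        where
        htγ : ht (root γ) ≡ ht (root θ) + ht (root k)
        htγ = trans (cong ht (begin
          root γ                                        ≡⟨ LV.solve 2 (λ t g → g ⊜ t ⊞ -1ℚ ⊡ (t ⊞ -1ℚ ⊡ g)) refl (root θ) (root γ) ⟩
          root θ +ᵥ -1ℚ ·ᵥ (root θ -ᵥ root γ)           ≡⟨ cong (root θ +ᵥ_) (trans f (cong (-1ℚ ·ᵥ_) e)) ⟨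
          root θ +ᵥ root k                              ∎)) (ht-+ (root θ) (root k))

    -- An element of Ŵ preserving positivity cannot lower heights on Δ⁺ and fixes δ,
    -- so comparing α₀ = δ − θ with its image bounds it on θ, hence on every positive root.
    module PositivityPreserving (u : AV → AV) (u-+ : ∀ x y → u (x +^ y) ≡ u x +^ u y) (u-· : ∀ a x → u (a ·^ x) ≡ a ·^ u x)
           (u-δ : u δ ≡ δ) (u-pos : ∀ {x} → PosAff x → PosAff (u x)) where

      raises-ht : ∀ ms → ht (Σα ms) ≤ ht^ (u (ι (Σα ms)))
      raises-ht [] = ℚP.≤-reflexive (begin
        ht 0ᵥ               ≡⟨ functional-0 (λ _ → 1ℚ) ⟩
        0ℚ                  ≡⟨ ℚP.*-zeroˡ (ht^ (u (ι 0ᵥ))) ⟨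
        0ℚ * ht^ (u (ι 0ᵥ)) ≡⟨ ht^-· 0ℚ (u (ι 0ᵥ)) ⟨
        ht^ (0ℚ ·^ u (ι 0ᵥ)) ≡⟨ cong ht^ (u-· 0ℚ (ι 0ᵥ)) ⟨
        ht^ (u (0ℚ ·^ ι 0ᵥ)) ≡⟨ cong (ht^ ∘ u) (A.0⊙ (ι 0ᵥ)) ⟩
        ht^ (u (ι 0ᵥ))       ∎)
      raises-ht (i ∷ ms) = subst₂ _≤_
        (trans (cong (_+ ht (Σα ms)) (sym (ht-α i))) (sym (ht-+ (α i) (Σα ms))))
        (trans (sym (ht^-+ (u (ι (α i))) (u (ι (Σα ms))))) (cong ht^ (sym (u-+ (ι (α i)) (ι (Σα ms))))))
        (ℚP.+-mono-≤ (PosAff⇒1≤ht^ (u-pos (PosAff-α^ (suc i)))) (raises-ht ms))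

      -- ht δ = ht θ + 1, and u(α₀) = δ - u(θ) has height at least one.
      bounded-on-θ : ht^ (u (ι (root θ))) ≤ ht (root θ)
      bounded-on-θ = subst₂ _≤_
        (ℚS.solve 1 (λ x → con 1ℚ :+ (x :+ :- con 1ℚ) := x) refl (ht^ (u (ι (root θ)))))
        (begin
          ht^ (u (α^ zero)) + (L - 1ℚ)    ≡⟨ cong (_+ (L - 1ℚ)) (begin
            ht^ (u (α^ zero))                   ≡⟨ cong ht^ (u-+ δ (neg^ (ι (root θ)))) ⟩
            ht^ (u δ +^ u (neg^ (ι (root θ))))  ≡⟨ ht^-+ (u δ) (u (neg^ (ι (root θ)))) ⟩
            ht^ (u δ) + ht^ (u (neg^ (ι (root θ)))) ≡⟨ cong₂ _+_ (cong ht^ u-δ) (trans (cong ht^ (u-· -1ℚ (ι (root θ)))) (ht^-· -1ℚ (u (ι (root θ))))) ⟩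
            ht^ δ + -1ℚ * L                     ≡⟨ cong (λ t → (t + 1ℚ * (ht (root θ) + 1ℚ)) + -1ℚ * L) (functional-0 (λ _ → 1ℚ)) ⟩
            (0ℚ + 1ℚ * (ht (root θ) + 1ℚ)) + -1ℚ * L ∎) ⟩
          ((0ℚ + 1ℚ * (ht (root θ) + 1ℚ)) + -1ℚ * L) + (L - 1ℚ)
            ≡⟨ ℚS.solve 2 (λ t l → ((con 0ℚ :+ con 1ℚ :* (t :+ con 1ℚ)) :+ con -1ℚ :* l) :+ (l :+ :- con 1ℚ) := t) refl (ht (root θ)) L ⟩
          ht (root θ) ∎)
        (ℚP.+-monoˡ-≤ (L - 1ℚ) (PosAff⇒1≤ht^ (u-pos (PosAff-α^ zero))))
        where
        L = ht^ (u (ι (root θ)))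

      bounded : ∀ {μ} → Pos μ → ht^ (u (ι (root μ))) ≤ ht (root μ)
      bounded {μ} p = from-cone (≼⇒difference-cone (proj₂ θ-highest μ p))
        where
        L = ht^ (u (ι (root μ)))
        from-cone : ∃[ ms ] root θ ≡ root μ +ᵥ Σα ms → L ≤ ht (root μ)
        -- With S the sum over `ms`: ht(uμ) + ht S ≤ ht(uμ) + ht(uS) = ht(uθ) ≤ ht θ = ht μ + ht S.
        from-cone (ms , e) = 0≤-⇒≤ (subst (0ℚ ≤_) (ℚS.solve 3 (λ m s l → (m :+ s) :+ :- (l :+ s) := m :+ :- l) refl (ht (root μ)) (ht (Σα ms)) L)
          (≤⇒0≤- (ℚP.≤-trans (ℚP.+-monoʳ-≤ L (raises-ht ms)) (subst₂ _≤_
            (trans (cong (ht^ ∘ u ∘ ι) e) (trans (cong ht^ (u-+ (ι (root μ)) (ι (Σα ms)))) (ht^-+ (u (ι (root μ))) (u (ι (Σα ms))))))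
            (trans (cong ht e) (ht-+ (root μ) (Σα ms))) bounded-on-θ))))

    -- Put y = w⁻¹x. A positive y is not an inversion of w, hence not of w′; for a negative y, -y is
    -- an inversion of w, hence of w′. Either way w′y is positive.
    same-inversions⇒pos : ∀ {w w′ J} → N≡ w J → N≡ w′ J → ∀ {x} → PosAff x → PosAff (act w′ (act (List.reverse w) x))
    same-inversions⇒pos {w} {w′} {J} N≡J N≡′J {x} px = by-sign (Real-± y-Real)
      where
      y = act (List.reverse w) x
      y-Real : Real y
      y-Real = act-Real (List.reverse w) (PosAff⇒Real px)
      wy≡x : act w y ≡ x
      wy≡x = reverse-act w x
      by-sign : PosAff y ⊎ NegAff y → PosAff (act w′ y)
      by-sign (inj₁ py) = Sum.fromInj₁
        (λ ny → ⊥-elim (PosAff⇒¬NegAff px (subst NegAff wy≡x (proj₂ (N≡J y py) (proj₁ (N≡′J y py) ny)))))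
        (Real-± (act-Real w′ y-Real))
      by-sign (inj₂ ny) = subst PosAff (trans (cong neg^ (act-neg w′ y)) (neg^-invol (act w′ y)))
        (proj₂ (N≡′J (neg^ y) ny) (proj₁ (N≡J (neg^ y) ny)
          (subst NegAff (sym (trans (act-neg w y) (cong neg^ wy≡x))) (PosAff⇒NegAff-neg px))))

    -- Pairing with μ, and which covers leave 𝔄𝔟_μ.

    module AtRoot (μ : Fin N) (μ-pos : Pos μ) (μ-nonsimple : ¬ IsSimple μ)
                  (w : List (Fin (suc n))) (I : Subset N) (I-abelian : IsAbelian I) (N≡I : N≡ w I)
                  (τ : act w 2δ-θ ≡ ι (root μ)) where
      open Extension w I I-abelian N≡I

      ⟪⟫^-image : ∀ x → ⟪ ι (root μ) , act w x ⟫^ ≡ ⟪ 2δ-θ , x ⟫^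
      ⟪⟫^-image x = trans (cong ⟪_, act w x ⟫^ (sym τ)) (act-iso w 2δ-θ x)

      orthogonal⇒InAb : ∀ {γ i} → Pos γ → act w (δ- γ) ≡ α^ i → ⟪ ι (root μ) , α^ i ⟫^ ≡ 0ℚ → InAb μ (I ∪ ⁅ γ ⁆)
      orthogonal⇒InAb {γ} {i} γ-pos image ⊥i = S.insert-abelian , i ∷ w , S.N≡-insert ,
        trans (cong (refl^ (α^ i)) τ) (refl^-fix (α^ i) (ι (root μ)) ⊥i)
        where module S = Simple γ γ-pos i image

      ⟪μ,α^⟫-nonneg : ∀ {γ i} → Pos γ → act w (δ- γ) ≡ α^ i → 0ℚ ≤ ⟪ ι (root μ) , α^ i ⟫^
      ⟪μ,α^⟫-nonneg {γ} {i} γ-pos image = subst (0ℚ ≤_) (begin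
        ⟪ root γ , root θ ⟫                             ≡⟨ ℚS.solve 1 (λ x → x := con -1ℚ :* (con -1ℚ :* x)) refl ⟪ root γ , root θ ⟫ ⟩
        -1ℚ * (-1ℚ * ⟪ root γ , root θ ⟫)               ≡⟨ cong (λ t → -1ℚ * (-1ℚ * t)) (⟪⟫-comm (root γ) (root θ)) ⟩
        -1ℚ * (-1ℚ * ⟪ root θ , root γ ⟫)               ≡⟨ trans (⟪⟫-·ˡ -1ℚ (root θ) (-1ℚ ·ᵥ root γ)) (cong (-1ℚ *_) (⟪⟫-·ʳ -1ℚ (root θ) (root γ))) ⟨
        ⟪ -1ℚ ·ᵥ root θ , -1ℚ ·ᵥ root γ ⟫               ≡⟨ ⟪⟫^-finite (-1ℚ ·ᵥ root θ) (-1ℚ ·ᵥ root γ) 2ℚ 1ℚ ⟨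
        ⟪ (-1ℚ ·ᵥ root θ , 2ℚ , 0ℚ) , (-1ℚ ·ᵥ root γ , 1ℚ , 0ℚ) ⟫^ ≡⟨ cong₂ ⟪_,_⟫^ 2δ-θ-≡ (δ-≡ γ) ⟨
        ⟪ 2δ-θ , δ- γ ⟫^                                ≡⟨ ⟪⟫^-image (δ- γ) ⟨
        ⟪ ι (root μ) , act w (δ- γ) ⟫^                  ≡⟨ cong ⟪ ι (root μ) ,_⟫^ image ⟩
        ⟪ ι (root μ) , α^ i ⟫^                          ∎) (θ-dominant γ-pos)

      ⟪μ,α₀⟫-nonpos : ⟪ ι (root μ) , α^ zero ⟫^ ≤ 0ℚ
      ⟪μ,α₀⟫-nonpos = subst (_≤ 0ℚ) (begin
        - ⟪ root μ , root θ ⟫               ≡⟨ ℚS.solve 1 (λ x → :- x := con -1ℚ :* x) refl ⟪ root μ , root θ ⟫ ⟩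
        -1ℚ * ⟪ root μ , root θ ⟫           ≡⟨ ⟪⟫-·ʳ -1ℚ (root μ) (root θ) ⟨
        ⟪ root μ , -1ℚ ·ᵥ root θ ⟫          ≡⟨ ⟪⟫^-finite (root μ) (-1ℚ ·ᵥ root θ) 0ℚ 1ℚ ⟨
        ⟪ ι (root μ) , (-1ℚ ·ᵥ root θ , 1ℚ , 0ℚ) ⟫^ ≡⟨ cong ⟪ ι (root μ) ,_⟫^ (δ-≡ θ) ⟨
        ⟪ ι (root μ) , α^ zero ⟫^           ∎) (ℚP.neg-antimono-≤ (θ-dominant μ-pos))

      leaving⇒positive : ∀ {γ} i → Pos γ → act w (δ- γ) ≡ α^ i → ¬ InAb μ (I ∪ ⁅ γ ⁆) →
                         ∃[ j ] (i ≡ suc j × 0ℚ < ⟪ root μ , α j ⟫)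
      leaving⇒positive {γ} i γ-pos image I∪γ∉ = from-index i image refl
        where
        pos : ∀ i → act w (δ- γ) ≡ α^ i → 0ℚ < ⟪ ι (root μ) , α^ i ⟫^
        pos i image = ≤∧≢⇒< (⟪μ,α^⟫-nonneg γ-pos image) (λ e → I∪γ∉ (orthogonal⇒InAb γ-pos image (sym e)))
        from-index : ∀ i′ → act w (δ- γ) ≡ α^ i′ → i ≡ i′ → ∃[ j ] (i ≡ suc j × 0ℚ < ⟪ root μ , α j ⟫)
        from-index zero    image _ = ⊥-elim (ℚP.<-irrefl refl (ℚP.<-≤-trans (pos zero image) ⟪μ,α₀⟫-nonpos))
        from-index (suc j) image e = j , e , subst (0ℚ <_) (⟪⟫^-finite (root μ) (α j) 0ℚ 0ℚ) (pos (suc j) image)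

      positive⇒preimage : ∀ i → 0ℚ < ⟪ root μ , α i ⟫ → ∃[ γ ] (Pos γ × act w (δ- γ) ≡ α^ (suc i))
      positive⇒preimage i 0<μi = from-real (act-Real (List.reverse w) (α^-Real (suc i)))
        where
        ν = act (List.reverse w) (α^ (suc i))
        wν : act w ν ≡ α^ (suc i)
        wν = reverse-act w (α^ (suc i))

        Result = ∃[ γ ] (Pos γ × act w (δ- γ) ≡ α^ (suc i))

        module FromReal (j : Fin N) (z : ℤ) (ν≡ : ν ≡ (root j , ℤ→ℚ z , 0ℚ))
                        (γ : Fin N) (γ≡ : root γ ≡ -1ℚ ·ᵥ root j) where
          j≡ : root j ≡ -1ℚ ·ᵥ root γ
          j≡ = trans (LV.solve 1 (λ x → x ⊜ -1ℚ ⊡ (-1ℚ ⊡ x)) refl (root j)) (cong (-1ℚ ·ᵥ_) (sym γ≡))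

          0<θγ : 0ℚ < ⟪ root θ , root γ ⟫
          0<θγ = subst (0ℚ <_) (begin
            ⟪ root μ , α i ⟫                        ≡⟨ ⟪⟫^-finite (root μ) (α i) 0ℚ 0ℚ ⟨
            ⟪ ι (root μ) , α^ (suc i) ⟫^            ≡⟨ cong ⟪ ι (root μ) ,_⟫^ wν ⟨
            ⟪ ι (root μ) , act w ν ⟫^               ≡⟨ ⟪⟫^-image ν ⟩
            ⟪ 2δ-θ , ν ⟫^                           ≡⟨ cong₂ ⟪_,_⟫^ 2δ-θ-≡ ν≡ ⟩
            ⟪ (-1ℚ ·ᵥ root θ , 2ℚ , 0ℚ) , (root j , ℤ→ℚ z , 0ℚ) ⟫^ ≡⟨ ⟪⟫^-finite (-1ℚ ·ᵥ root θ) (root j) 2ℚ (ℤ→ℚ z) ⟩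
            ⟪ -1ℚ ·ᵥ root θ , root j ⟫              ≡⟨ ⟪⟫-·ˡ -1ℚ (root θ) (root j) ⟩
            -1ℚ * ⟪ root θ , root j ⟫               ≡⟨ ⟪⟫-·ʳ -1ℚ (root θ) (root j) ⟨
            ⟪ root θ , -1ℚ ·ᵥ root j ⟫              ≡⟨ cong ⟪ root θ ,_⟫ γ≡ ⟨
            ⟪ root θ , root γ ⟫                     ∎) 0<μi

          γ-pos : Pos γ
          γ-pos = ⟪θ⟫>0⇒Pos (subst (0ℚ <_) (⟪⟫-comm (root θ) (root γ)) 0<θγ)

          -- The negative of (2 - k)δ - (θ - γ), where k is the level of ν: its finite part θ - γ is
          -- positive, so `Pos-part⇒PosAff` applies, and w sends it to αᵢ - μ.
          x₂ : AV
          x₂ = neg^ 2δ-θ +^ ν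

          wx₂ : act w x₂ ≡ neg^ (ι (root μ)) +^ α^ (suc i)
          wx₂ = trans (act-+ w (neg^ 2δ-θ) ν) (cong₂ _+^_ (trans (act-neg w 2δ-θ) (cong neg^ τ)) wν)

          x₂≡ : x₂ ≡ (root θ -ᵥ root γ , -1ℚ * 2ℚ + ℤ→ℚ z , 0ℚ)
          x₂≡ = trans (cong₂ (λ s t → neg^ s +^ t) 2δ-θ-≡ ν≡) (cong (_, (-1ℚ * 2ℚ + ℤ→ℚ z , 0ℚ)) (begin
            -1ℚ ·ᵥ (-1ℚ ·ᵥ root θ) +ᵥ root j            ≡⟨ cong (-1ℚ ·ᵥ (-1ℚ ·ᵥ root θ) +ᵥ_) j≡ ⟩
            -1ℚ ·ᵥ (-1ℚ ·ᵥ root θ) +ᵥ -1ℚ ·ᵥ root γ     ≡⟨ LV.solve 2 (λ t g → -1ℚ ⊡ (-1ℚ ⊡ t) ⊞ -1ℚ ⊡ g ⊜ t ⊞ -1ℚ ⊡ g) refl (root θ) (root γ) ⟩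
            root θ -ᵥ root γ                            ∎))

          -- If γ = θ then ν is 2δ − θ up to a multiple of δ, which w fixes, so μ would be the simple root αᵢ.
          θ≢γ : root θ ≢ root γ
          θ≢γ e = μ-nonsimple (i , root-inj (simple i) μ (begin
            α i                                             ≡⟨ LV.solve 2 (λ m a → a ⊜ m ⊞ (-1ℚ ⊡ m ⊞ a)) refl (root μ) (α i) ⟩
            root μ +ᵥ (-1ℚ ·ᵥ root μ +ᵥ α i)                ≡⟨ cong (root μ +ᵥ_) (cong proj₁ (trans (sym wx₂) wx₂≡cδ)) ⟩
            root μ +ᵥ (c ·ᵥ 0ᵥ)                             ≡⟨ cong (root μ +ᵥ_) (QModule.⊙𝟘 (V-module n) c) ⟩
            root μ +ᵥ 0ᵥ                                    ≡⟨ LV.solve 1 (λ m → m ⊞ 𝕫 ⊜ m) refl (root μ) ⟩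
            root μ                                          ∎))
            where
            c = -1ℚ * 2ℚ + ℤ→ℚ z
            x₂≡cδ : x₂ ≡ c ·^ δ
            x₂≡cδ = trans x₂≡ (cong₂ _,_ (begin
              root θ -ᵥ root γ      ≡⟨ cong (_-ᵥ root γ) e ⟩
              root γ -ᵥ root γ      ≡⟨ LV.solve 1 (λ m → m ⊞ -1ℚ ⊡ m ⊜ 𝕫) refl (root γ) ⟩
              0ᵥ                    ≡⟨ QModule.⊙𝟘 (V-module n) c ⟨
              c ·ᵥ 0ᵥ               ∎) (cong₂ _,_ (sym (ℚP.*-identityʳ c)) (sym (ℚP.*-zeroʳ c))))
            wx₂≡cδ : act w x₂ ≡ c ·^ δ
            wx₂≡cδ = trans (cong (act w) x₂≡cδ) (trans (act-· w c δ) (cong (c ·^_) (act-δ w)))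

          neg-ν : ∀ {a} → - ℤ→ℚ z ≡ a → neg^ ν ≡ (root γ , a , 0ℚ)
          neg-ν {a} e = trans (cong neg^ ν≡) (cong₂ _,_ (sym γ≡) (cong (_, 0ℚ) (trans (ℚS.solve 1 (λ x → con -1ℚ :* x := :- x) refl (ℤ→ℚ z)) e)))

          -- The root -ν has the positive finite part γ, so w cannot make it negative; yet w(-ν) =
          -- -αᵢ.
          level-nonpos-impossible : PosAff (neg^ ν) → ⊥
          level-nonpos-impossible p = PosAff⇒¬NegAff
            (Pos-part⇒PosAff w I I-pos N≡I {neg^ ν} γ-pos (cong proj₁ (neg-ν refl)) p)
            (subst PosAff (trans (sym wν) (trans (sym (neg^-invol (act w ν))) (cong neg^ (sym (act-neg w ν))))) (PosAff-α^ (suc i)))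

          θ-γ : ∃[ p ] root p ≡ root θ -ᵥ root γ
          θ-γ = sub-root θ γ 0<θγ θ≢γ

          p₂ = proj₁ θ-γ

          -- Being positive with positive finite part, `x₂` stays positive under w. But its image is
          -- -(μ - αᵢ), and μ - αᵢ is a positive root because μ is not simple.
          level-≥2-impossible : PosAff x₂ → ⊥
          level-≥2-impossible p = PosAff⇒¬NegAff
            (Pos-part⇒PosAff w I I-pos N≡I {x₂} {p₂} (sub-θ-Pos {γ} {p₂} γ-pos (proj₂ θ-γ)) (trans (cong proj₁ x₂≡) (sym (proj₂ θ-γ))) p)
            (from-κ (sub-simple i μ-pos μ-nonsimple 0<μi))
            where
            from-κ : ∃[ κ ] (Pos κ × root κ ≡ root μ -ᵥ α i) → NegAff (act w x₂)
            from-κ (κ , κ-pos , e) = inj₁ (κ , κ-pos , trans (cong neg^ wx₂) (cong (_, (0ℚ , 0ℚ))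
              (trans (LV.solve 2 (λ m a → -1ℚ ⊡ (-1ℚ ⊡ m ⊞ a) ⊜ m ⊞ -1ℚ ⊡ a) refl (root μ) (α i)) (sym e))))

          x₂-form : ∀ {a} → -1ℚ * 2ℚ + ℤ→ℚ z ≡ a → x₂ ≡ (root p₂ , a , 0ℚ)
          x₂-form e = trans x₂≡ (cong₂ _,_ (sym (proj₂ θ-γ)) (cong (_, 0ℚ) e))

        from-real : Real ν → Result
        from-real (j , z , ν≡) = by-level z ν≡
          where
          γ = proj₁ (negate j)
          by-level : ∀ z → ν ≡ (root j , ℤ→ℚ z , 0ℚ) → Result
          by-level (ℤ.+ 0) ν≡ = ⊥-elim (F.level-nonpos-impossible (inj₁ (γ , F.γ-pos , F.neg-ν refl)))
            where module F = FromReal j (ℤ.+ 0) ν≡ γ (proj₂ (negate j))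
          by-level (ℤ.+ 1) ν≡ = γ , F.γ-pos , trans (cong (act w) (trans (δ-≡ γ) (trans (cong (_, _) (sym F.j≡)) (sym ν≡)))) wν
            where module F = FromReal j (ℤ.+ 1) ν≡ γ (proj₂ (negate j))
          by-level (ℤ.+ suc (suc k)) ν≡ = ⊥-elim (F.level-≥2-impossible (x₂-PosAff k (F.x₂-form level)))
            where
            module F = FromReal j (ℤ.+ suc (suc k)) ν≡ γ (proj₂ (negate j))
            level : -1ℚ * 2ℚ + ℕ→ℚ (suc (suc k)) ≡ ℕ→ℚ k
            level = trans (cong (-1ℚ * 2ℚ +_) (trans (ℕ→ℚ-suc (suc k)) (cong (1ℚ +_) (ℕ→ℚ-suc k))))
              (ℚS.solve 1 (λ k → con (-1ℚ * 2ℚ) :+ (con 1ℚ :+ (con 1ℚ :+ k)) := k) refl (ℕ→ℚ k))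
            x₂-PosAff : ∀ k → F.x₂ ≡ (root F.p₂ , ℕ→ℚ k , 0ℚ) → PosAff F.x₂
            x₂-PosAff zero    e = inj₁ (F.p₂ , sub-θ-Pos {γ} {F.p₂} F.γ-pos (proj₂ F.θ-γ) , e)
            x₂-PosAff (suc k) e = inj₂ (F.p₂ , k , e)
          by-level ℤ.-[1+ k ] ν≡ = ⊥-elim (F.level-nonpos-impossible (inj₂ (γ , k , F.neg-ν level)))
            where
            module F = FromReal j ℤ.-[1+ k ] ν≡ γ (proj₂ (negate j))
            level : - ℤ→ℚ ℤ.-[1+ k ] ≡ ℕ→ℚ (suc k)
            level = sym (ℤ→ℚ-neg ℤ.-[1+ k ])

      positive⇒leaving : ∀ {γ} i → 0ℚ < ⟪ root μ , α i ⟫ → Pos γ → act w (δ- γ) ≡ α^ (suc i) → ¬ InAb μ (I ∪ ⁅ γ ⁆)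
      positive⇒leaving {γ} i 0<μi γ-pos image (_ , w″ , N≡″ , τ″) =
        ℚP.<-irrefl refl (ℚP.<-≤-trans 0<cL cL≤0)
        where
        module S = Simple γ γ-pos (suc i) image
        w′ = suc i ∷ w
        u : AV → AV
        u x = act w″ (act (List.reverse w′) x)
        module U = PositivityPreserving u
          (λ x y → trans (cong (act w″) (act-+ (List.reverse w′) x y)) (act-+ w″ (act (List.reverse w′) x) (act (List.reverse w′) y)))
          (λ a x → trans (cong (act w″) (act-· (List.reverse w′) a x)) (act-· w″ a (act (List.reverse w′) x)))
          (trans (cong (act w″) (act-δ (List.reverse w′))) (act-δ w″))
          (same-inversions⇒pos {w′} {w″} {I ∪ ⁅ γ ⁆} S.N≡-insert N≡″)
        β = α^ (suc i)
        -- The Cartan pairing of μ with αᵢ, so that sᵢμ = μ - cαᵢ.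
        c = pair^ (ι (root μ)) β
        L = ht^ (u β)

        0<ββ : 0ℚ < ⟪ β , β ⟫^
        0<ββ = subst (0ℚ <_) (sym (⟪⟫^-finite (α i) (α i) 0ℚ 0ℚ)) (norm-pos (simple i))

        0<c : 0ℚ < c
        0<c = *-cancel-0< (ℚP.<⇒≤ 0<ββ) (subst (0ℚ <_) (sym (Nonisotropic.pair^-* β (α^-nonisotropic (suc i)) (ι (root μ))))
          (*-pos {2ℚ} (ℚP.positive⁻¹ 2ℚ) (subst (0ℚ <_) (sym (⟪⟫^-finite (root μ) (α i) 0ℚ 0ℚ)) 0<μi)))

        0<cL : 0ℚ < c * L
        0<cL = *-pos 0<c (ℚP.<-≤-trans 0<1 (PosAff⇒1≤ht^ (same-inversions⇒pos {w′} {w″} {I ∪ ⁅ γ ⁆} S.N≡-insert N≡″ (PosAff-α^ (suc i)))))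

        -- The word w′ sends 2δ - θ to sᵢμ, and w″ is assumed to send it to μ.
        u-sμ : u (refl^ β (ι (root μ))) ≡ ι (root μ)
        u-sμ = begin
          u (refl^ β (ι (root μ)))                             ≡⟨ cong (u ∘ refl^ β) τ ⟨
          act w″ (act (List.reverse w′) (act w′ 2δ-θ))         ≡⟨ cong (act w″) (act-reverse w′ 2δ-θ) ⟩
          act w″ 2δ-θ                                          ≡⟨ τ″ ⟩
          ι (root μ)                                           ∎

        htμ : ht (root μ) ≡ ht^ (u (ι (root μ))) + - c * L
        htμ = begin
          ht (root μ)
            ≡⟨ ℚS.solve 2 (λ t h → t := t :+ con 0ℚ :* h) refl (ht (root μ)) (ht (root θ) + 1ℚ) ⟩
          ht^ (ι (root μ))
            ≡⟨ cong ht^ u-sμ ⟨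
          ht^ (u (ι (root μ) +^ ((- c) ·^ β)))
            ≡⟨ cong ht^ (trans (cong (act w″) (act-+ (List.reverse w′) (ι (root μ)) ((- c) ·^ β)))
                 (act-+ w″ (act (List.reverse w′) (ι (root μ))) (act (List.reverse w′) ((- c) ·^ β)))) ⟩
          ht^ (u (ι (root μ)) +^ u ((- c) ·^ β))
            ≡⟨ ht^-+ (u (ι (root μ))) (u ((- c) ·^ β)) ⟩
          ht^ (u (ι (root μ))) + ht^ (u ((- c) ·^ β))
            ≡⟨ cong (λ x → ht^ (u (ι (root μ))) + ht^ x) (trans (cong (act w″) (act-· (List.reverse w′) (- c) β)) (act-· w″ (- c) (act (List.reverse w′) β))) ⟩
          ht^ (u (ι (root μ))) + ht^ ((- c) ·^ u β)
            ≡⟨ cong (ht^ (u (ι (root μ))) +_) (ht^-· (- c) (u β)) ⟩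
          ht^ (u (ι (root μ))) + - c * L ∎

        cL≤0 : c * L ≤ 0ℚ
        cL≤0 = subst₂ _≤_
          (ℚS.solve 3 (λ l c b → l :+ (c :* b :+ :- l) := c :* b) refl (ht^ (u (ι (root μ)))) c L)
          (trans (cong (_+ (c * L - ht^ (u (ι (root μ))))) htμ)
            (ℚS.solve 3 (λ l c b → (l :+ :- c :* b) :+ (c :* b :+ :- l) := con 0ℚ) refl (ht^ (u (ι (root μ)))) c L))
          (ℚP.+-monoˡ-≤ (c * L - ht^ (u (ι (root μ)))) (U.bounded μ-pos))

    -- Counting.

    module Covering (μ : Fin N) (μ-pos : Pos μ) (μ-nonsimple : ¬ IsSimple μ) where

      -- The coordinate form at i, available by independence of the simple roots, separates αᵢ from
      -- every other simple root.
      α-injective : ∀ {i j} → α i ≡ α j → i ≡ j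
      α-injective {i} {j} e = decidable-stable (i FinP.≟ j) λ i≢j → ℚP.1≢0 (begin
        1ℚ                       ≡⟨ cong ℕ→ℚ (kronecker-refl i) ⟨
        f i                      ≡⟨ functional-α f i ⟨
        functional f (α i)       ≡⟨ cong (functional f) e ⟩
        functional f (α j)       ≡⟨ functional-α f j ⟩
        f j                      ≡⟨ cong ℕ→ℚ (kronecker-≢ i≢j) ⟩
        0ℚ                       ∎)
        where
        f : Fin n → ℚ
        f k = ℕ→ℚ (kronecker i k)

      positive? : ∀ i → Dec (0ℚ < ⟪ root μ , α i ⟫)
      positive? i = 0ℚ ℚP.<? ⟪ root μ , α i ⟫

      positives : List (Fin n)
      positives = List.filter positive? (allFin n)

      positives-unique : Unique positives
      positives-unique = filter⁺ positive? (allFin⁺ n)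

      ∈-positives⁻ : ∀ {i} → i LM.∈ positives → 0ℚ < ⟪ root μ , α i ⟫
      ∈-positives⁻ i∈ = proj₂ (∈-filter⁻ positive? {xs = allFin n} i∈)

      ∈-positives⁺ : ∀ {i} → 0ℚ < ⟪ root μ , α i ⟫ → i LM.∈ positives
      ∈-positives⁺ {i} p = ∈-filter⁺ positive? (∈-allFin i) p

      card-leaving-covers : ∀ {I} → InAb μ I → HasCard (λ I′ → AbCovers I I′ × ¬ InAb μ I′) (posPairCount μ)
      card-leaving-covers {I} (I-abelian , w , N≡I , τ) = HasCard-image positives-unique total sound complete
        where
        open Extension w I I-abelian N≡I
        open AtRoot μ μ-pos μ-nonsimple w I I-abelian N≡I τ

        -- The index is shifted by `suc` because a cover arising from α₀ stays in 𝔄𝔟_μ: its pairing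
        -- with μ is both nonnegative and nonpositive.
        _~_ : Fin n → Subset N → Set
        i ~ I′ = ∃[ γ ] (Pos γ × act w (δ- γ) ≡ α^ (suc i) × I′ ≡ I ∪ ⁅ γ ⁆)

        functional~ : ∀ {i I′ I″} → i ~ I′ → i ~ I″ → I′ ≡ I″
        functional~ (_ , _ , e , refl) (_ , _ , e′ , refl) =
          cong (λ γ → I ∪ ⁅ γ ⁆) (δ--injective (act-injective w (trans e (sym e′))))

        injective~ : ∀ {i j I′} → i ~ I′ → j ~ I′ → i ≡ j
        injective~ {i} {j} (γ , γ-pos , e , refl) (γ′ , _ , e′ , f) = Sum.[ same , (λ γ∈I → ⊥-elim (Simple.γ∉I γ γ-pos (suc i) e γ∈I)) ]
          (∈-insert⁻ (subst (γ Sub.∈_) f ∈-insert))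
          where
          same : γ ≡ γ′ → i ≡ j
          same refl = α-injective (cong proj₁ (trans (sym e) e′))

        open Correspondence _~_ functional~ injective~

        total : ∀ {i} → i LM.∈ positives → ∃[ I′ ] i ~ I′
        total {i} i∈ = let γ , γ-pos , e = positive⇒preimage i (∈-positives⁻ i∈) in I ∪ ⁅ γ ⁆ , γ , γ-pos , e , refl

        sound : ∀ {i I′} → i LM.∈ positives → i ~ I′ → AbCovers I I′ × ¬ InAb μ I′
        sound {i} i∈ (γ , γ-pos , e , refl) =
          insert-abelian⇒covers I-abelian S.insert-abelian S.γ∉I , positive⇒leaving i (∈-positives⁻ i∈) γ-pos e
          where module S = Simple γ γ-pos (suc i) e

        complete : ∀ {I′} → AbCovers I I′ × ¬ InAb μ I′ → ∃[ i ] (i LM.∈ positives × i ~ I′)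
        complete (c , I′∉) = from-image (covers⇒image-simple c) I′∉
          where
          from-image : ∀ {I′} → ∃[ γ ] (γ Sub.∉ I × Pos γ × I′ ≡ I ∪ ⁅ γ ⁆ × ∃[ i ] act w (δ- γ) ≡ α^ i) → ¬ InAb μ I′ →
                       ∃[ i ] (i LM.∈ positives × i ~ I′)
          from-image (γ , _ , γ-pos , refl , i , e) I′∉ = from-index (leaving⇒positive i γ-pos e I′∉)
            where
            from-index : ∃[ j ] (i ≡ suc j × 0ℚ < ⟪ root μ , α j ⟫) → ∃[ j ] (j LM.∈ positives × j ~ (I ∪ ⁅ γ ⁆))
            from-index (j , refl , p) = j , ∈-positives⁺ p , γ , γ-pos , e , refl

      -- Each αᵢ with (μ, αᵢ) > 0 gives the covered root μ - αᵢ; equal root lengths give the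
      -- converse.
      card-covered : SimplyLaced → HasCard (λ γ → Pos γ × γ ⋖ μ) (posPairCount μ)
      card-covered laced = HasCard-image positives-unique total sound complete
        where
        _~_ : Fin n → Fin N → Set
        i ~ γ = root μ ≡ root γ +ᵥ α i

        open Correspondence _~_
          (λ {i} {γ} {γ′} e e′ → root-inj γ γ′ (begin
            root γ                      ≡⟨ LV.solve 2 (λ g a → g ⊜ (g ⊞ a) ⊞ -1ℚ ⊡ a) refl (root γ) (α i) ⟩
            (root γ +ᵥ α i) -ᵥ α i      ≡⟨ cong (_-ᵥ α i) (trans (sym e) e′) ⟩
            (root γ′ +ᵥ α i) -ᵥ α i     ≡⟨ LV.solve 2 (λ g a → (g ⊞ a) ⊞ -1ℚ ⊡ a ⊜ g) refl (root γ′) (α i) ⟩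
            root γ′                     ∎))
          (λ {i} {j} {γ} e e′ → α-injective (begin
            α i                         ≡⟨ LV.solve 2 (λ g a → a ⊜ (g ⊞ a) ⊞ -1ℚ ⊡ g) refl (root γ) (α i) ⟩
            (root γ +ᵥ α i) -ᵥ root γ   ≡⟨ cong (_-ᵥ root γ) (trans (sym e) e′) ⟩
            (root γ +ᵥ α j) -ᵥ root γ   ≡⟨ LV.solve 2 (λ g a → (g ⊞ a) ⊞ -1ℚ ⊡ g ⊜ a) refl (root γ) (α j) ⟩
            α j                         ∎))

        sub : ∀ {i} → 0ℚ < ⟪ root μ , α i ⟫ → ∃[ γ ] (Pos γ × i ~ γ)
        sub {i} p = let γ , γ-pos , e = sub-simple i μ-pos μ-nonsimple p in γ , γ-pos , add-back {root γ} {root μ} {α i} e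

        total : ∀ {i} → i LM.∈ positives → ∃[ γ ] i ~ γ
        total i∈ = let γ , _ , e = sub (∈-positives⁻ i∈) in γ , e

        sound : ∀ {i γ} → i LM.∈ positives → i ~ γ → Pos γ × γ ⋖ μ
        sound {i} {γ} i∈ e = let γ′ , γ′-pos , e′ = sub (∈-positives⁻ i∈) in
          -- Positivity of γ is inherited from the root that `sub` produces, as both equal μ - αᵢ.
          subst Pos (root-inj γ′ γ (begin
            root γ′                     ≡⟨ LV.solve 2 (λ g a → g ⊜ (g ⊞ a) ⊞ -1ℚ ⊡ a) refl (root γ′) (α i) ⟩
            (root γ′ +ᵥ α i) -ᵥ α i     ≡⟨ cong (_-ᵥ α i) (trans (sym e′) e) ⟩
            (root γ +ᵥ α i) -ᵥ α i      ≡⟨ LV.solve 2 (λ g a → (g ⊞ a) ⊞ -1ℚ ⊡ a ⊜ g) refl (root γ) (α i) ⟩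
            root γ                      ∎)) γ′-pos , (i , e)

        -- Equating the norms of μ − αᵢ and μ gives 2(μ, αᵢ) = (αᵢ, αᵢ).
        complete : ∀ {γ} → Pos γ × γ ⋖ μ → ∃[ i ] (i LM.∈ positives × i ~ γ)
        complete {γ} (_ , i , e) = i , ∈-positives⁺ 0<μi , e
          where
          m = ⟪ root μ , root μ ⟫
          a = ⟪ α i , α i ⟫
          b = ⟪ root μ , α i ⟫
          γ≡ : root γ ≡ root μ -ᵥ α i
          γ≡ = trans (LV.solve 2 (λ g a → g ⊜ (g ⊞ a) ⊞ -1ℚ ⊡ a) refl (root γ) (α i)) (cong (_-ᵥ α i) (sym e))
          norms : m ≡ (m + a) - 2ℚ * b
          norms = trans (laced μ γ) (trans (cong₂ ⟪_,_⟫ γ≡ γ≡) (⟪⟫-sub (root μ) (α i)))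
          2b≡a : b * 2ℚ ≡ a
          2b≡a = begin
            b * 2ℚ                           ≡⟨ ℚS.solve 2 (λ m b → b :* con 2ℚ := (m :+ con 2ℚ :* b) :+ :- m) refl m b ⟩
            (m + 2ℚ * b) - m                 ≡⟨ cong (λ t → (t + 2ℚ * b) - m) norms ⟩
            (((m + a) - 2ℚ * b) + 2ℚ * b) - m ≡⟨ ℚS.solve 3 (λ m a b → (((m :+ a) :+ :- (con 2ℚ :* b)) :+ con 2ℚ :* b) :+ :- m := a) refl m a b ⟩
            a                                ∎
          0<μi : 0ℚ < b
          0<μi = *-cancel-0< {b} {2ℚ} (ℕ→ℚ-nonneg 2) (subst (0ℚ <_) (sym 2b≡a) (norm-pos (simple i)))

theorem4p7 : ∀ {n} (R : RootSystem n) → let open RootSystem R in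
    ∀ θ → IsHighest θ →
    ∀ μ → Pos μ → Long μ → ¬ IsSimple μ →
    ∀ (I : Subset N) → Affine.InAb θ μ I →
    HasCard (λ I' → AbCovers I I' × ¬ Affine.InAb θ μ I') (posPairCount μ)
    × (SimplyLaced → HasCard (λ γ → Pos γ × γ ⋖ μ) (posPairCount μ))
theorem4p7 R θ θ-highest μ μ-pos _ μ-nonsimple I I∈ =
  card-leaving-covers R θ θ-highest μ μ-pos μ-nonsimple I∈ , card-covered R θ θ-highest μ μ-pos μ-nonsimple
  where open RootSystemProperties.Highest.Covering
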